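{- There exists an absolute constant $C>0$ such that the following holds. Let $n,t$ be positive integers with $n\ge C t\log^2 t$, and let $\mathcal{F}\subset\mathcal{B}_n$ be a $t$-intersecting family of partitions of $[n]$. Then $|\mathcal{F}|\le B_{n-t}$, and equality is only possible if $\mathcal{F}$ is the family of all partitions of $[n]$ that contain $\{x_1\},\ldots,\{x_t\}$ as parts, for some $t$ distinct elements $x_1,\ldots,x_t\in[n]$.
   Context: $[n]=\{1,\ldots,n\}$. $\mathcal{B}_n$ denotes the family of all partitions of $[n]$ (into any number of nonempty parts), and $B_m=|\mathcal{B}_m|$ is the $m$-th Bell number. Two partitions $P,Q$ of $[n]$ are $t$-intersecting if they share at least $t$ parts (i.e., there are $t$ distinct parts of $P$ each of which is also a part of $Q$). A family of partitions is $t$-intersecting if any two partitions in it are $t$-intersecting.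
   Formalization: log² t is read as (1+⌊log₂ t⌋)², equivalent up to the constant for t ≥ 2; for t = 1 it requires n ≥ C, since with log 1 = 0 the equality claim fails (n = 2, t = 1, F consisting only of the partition with the single part {1,2}). -}

module Defs where

open import Data.Nat using (ℕ; zero; suc)
open import Data.Bool using (Bool; true; false)
import Data.Bool.Properties as BoolP
open import Data.Fin using (Fin)
open import Data.Fin.Subset using (Subset; _∈_)
open import Data.Fin.Subset.Properties using (_∈?_)
open import Data.Fin.Properties using (all?)
open import Data.Vec using (Vec; []; _∷_; lookup)
open import Data.Vec.Properties using (≡-dec)
open import Data.List using (List; []; _∷_; map; concatMap; filter; length)
open import Data.List.Membership.Propositional using () renaming (_∈_ to _∈ₗ_)
open import Data.Product using (_×_; Σ; ∃; ∃-syntax)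
open import Relation.Binary.PropositionalEquality using (_≡_; _≢_)
open import Relation.Nullary.Decidable using (Dec; _×-dec_; _→-dec_)

-- Encoding of a partition of [n] = Fin n: the vector P assigns to each
-- element x the part (block) of the partition containing x, as a subset of [n].
BlockMap : ℕ → Set
BlockMap n = Vec (Subset n) n

blockOf : ∀ {n} → BlockMap n → Fin n → Subset n
blockOf P x = lookup P x

-- P really describes a partition of [n]: every x lies in its own part, and
-- if y lies in the part of x, then the part of y is the part of x.
-- (Hence the parts are nonempty, pairwise disjoint and cover [n]; partitions
-- of [n] correspond bijectively to such block maps.)
IsPartition : ∀ {n} → BlockMap n → Set
IsPartition {n} P =
  ((x : Fin n) → x ∈ blockOf P x) ×
  ((x y : Fin n) → y ∈ blockOf P x → blockOf P y ≡ blockOf P x)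

IsPart : ∀ {n} → BlockMap n → Subset n → Set
IsPart {n} P S = ∃[ x ] (blockOf P x ≡ S)

TIntersecting : ∀ {n} → ℕ → BlockMap n → BlockMap n → Set
TIntersecting {n} t P Q =
  Σ (Fin t → Fin n) λ f → (((i j : Fin t) → blockOf P (f i) ≡ blockOf P (f j) → i ≡ j) ×
          ((i : Fin t) → IsPart Q (blockOf P (f i))))

TIntersectingFamily : ∀ {n} → ℕ → List (BlockMap n) → Set
TIntersectingFamily {n} t F =
  (P Q : BlockMap n) → P ∈ₗ F → Q ∈ₗ F → P ≢ Q → TIntersecting t P Q

isPartition? : ∀ {n} (P : BlockMap n) → Dec (IsPartition P)
isPartition? {n} P =
  all? (λ x → x ∈? blockOf P x) ×-dec
  all? (λ x → all? (λ y → (y ∈? blockOf P x) →-dec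
                           ≡-dec BoolP._≟_ (blockOf P y) (blockOf P x)))

allVecs : ∀ {A : Set} → List A → (n : ℕ) → List (Vec A n)
allVecs xs zero = [] ∷ []
allVecs xs (suc n) = concatMap (λ x → map (x ∷_) (allVecs xs n)) xs

allBlockMaps : (m : ℕ) → List (BlockMap m)
allBlockMaps m = allVecs (allVecs (true ∷ false ∷ []) m) m

allPartitions : (m : ℕ) → List (BlockMap m)
allPartitions m = filter isPartition? (allBlockMaps m)

Bell : ℕ → ℕ
Bell m = length (allPartitions m)

-- Splitting a point i off the block of j (Ku and Renshaw) turns a t-intersecting family of
-- partitions into one of the same size in which any two members share t singletons.  If some
-- member then has only t singletons, the family lies in a star.  Otherwise left-shift the
-- singletons: by Frankl's walk argument every member has, for some i, at least t + i
-- singletons among the first t + 2 i points.  Consecutive Bell numbers near n grow by a factor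
-- R of order n / log n, so the members with i ≥ 1 contribute about ∑ C(t + 2 i, i) R ^ (- i)
-- relative to Bell (n ∸ t), which is small as t is small compared with R.  If there is a member
-- Q of moderate size that misses one of the first t points, those with i = 0 must meet Q outside
-- these points and are few as well; if there is none, the partitions of [n ∸ t] without
-- singletons are lost, which outweighs the members with very many singletons.  Finally, no
-- family other than a star is taken to a star by a splitting step.
module Submission where

open import Defs
open import Data.Bool using (Bool; true; false; _∧_; _∨_; not; if_then_else_) renaming (_≟_ to _≟ᵇ_)
open import Data.Bool.Properties using (∧-zeroʳ; ∧-comm)
open import Data.Empty using (⊥; ⊥-elim)
open import Data.Fin as Fin using (Fin; zero; suc; toℕ; fromℕ<; punchIn; punchOut)
open import Data.Fin.Properties as Finₚ using (_≟_; toℕ<n; toℕ-fromℕ<; toℕ-injective; suc-injective)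
open import Data.Fin.Subset using (⁅_⁆) renaming (_∈_ to _∈ₛ_)
open import Data.Fin.Subset.Properties using (x∈⁅x⁆; x∈⁅y⁆⇒x≡y)
open import Data.List as List using (List; []; _∷_; _++_; map; length; filter; concatMap; cartesianProduct; cartesianProductWith; upTo; applyUpTo)
open import Data.List.Membership.Propositional using (_∈_; _∉_)
open import Data.List.Membership.Propositional.Properties using (∈-map⁺; ∈-map⁻; ∈-filter⁺; ∈-filter⁻; ∈-cartesianProduct⁺; ∈-cartesianProductWith⁺; ∈-upTo⁺; ∈-upTo⁻; ∈-concatMap⁺; ∈-concatMap⁻; ∈-tabulate⁻; ∈-lookup)
open import Data.List.Membership.Propositional.Properties.WithK using (unique∧set⇒bag)
open import Data.List.Properties using (length-map; length-tabulate; map-∘; map-concatMap)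
open import Data.List.Relation.Binary.BagAndSetEquality using (∼bag⇒↭)
open import Data.List.Relation.Binary.Permutation.Propositional as Perm using (_↭_)
open import Data.List.Relation.Unary.All as All using (All; []; _∷_)
open import Data.List.Relation.Unary.AllPairs using ([]; _∷_)
open import Data.List.Relation.Unary.Any as Any using (Any; here; there)
open import Data.List.Relation.Unary.Any.Properties using (lookup-index)
open import Data.List.Relation.Unary.Unique.Propositional using (Unique)
import Data.List.Relation.Unary.Unique.Propositional.Properties as Uniqueₚ
open import Data.Nat using (ℕ; zero; suc; pred; _+_; _*_; _^_; _∸_; _!; _≤_; _<_; _≥_; z≤n; s≤s; _≤?_; _<?_; >-nonZero)
open import Data.Nat.Logarithm using (⌊log₂_⌋; ⌊log₂⌋-mono-≤; ⌊log₂[2^n]⌋≡n; ⌊log₂[2*b]⌋≡1+⌊log₂b⌋)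
open import Data.Nat.Properties hiding (_≟_; suc-injective)
open import Data.Nat.Tactic.RingSolver using (solve-∀)
open import Data.Product using (_×_; Σ; ∃-syntax; _,_; proj₁; proj₂)
open import Data.Sum using (_⊎_; inj₁; inj₂; [_,_])
open import Data.Vec as Vec using (Vec; lookup; tabulate)
open import Data.Vec.Properties using (≡-dec; lookup⇒[]=; []=⇒lookup; lookup∘tabulate; tabulate∘lookup; tabulate-cong)
open import Function using (_∘_; mk⇔)
open import Relation.Binary.Definitions using (tri<; tri≈; tri>)
open import Relation.Binary.PropositionalEquality using (_≡_; _≢_; refl; sym; trans; cong; cong₂; subst; module ≡-Reasoning)
open import Relation.Nullary using (¬_; Dec; yes; no; contradiction)
open import Relation.Nullary.Decidable using (does; ¬?; _×-dec_)

-- Families are Boolean tests on block maps, so that a compression is a pointwise formula on the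
-- pairs {P, ι P} of an involution; splitting and shifting are instances of one scheme. They are
-- used differently. A shift only has to preserve the size of the family and the lower bounds on
-- singletons, because families whose members all have more than t singletons obey a strict bound.
-- The uniqueness of stars, in contrast, has to be carried back through every split.
--
-- The delicate choice is the cut-off s for very many singletons. The walk sum asks for t + 2 s to
-- be at most a quarter of R, while `binom n s * Bell (n ∸ s)` has to stay below `Bell (n ∸ t ∸ 2)`,
-- which follows from n ^ s < s ! * R ^ (s - t - 2). Since n / R is of order log n, the powers of R
-- alone are too small; the factorial makes up for it, because s is itself of order n / log n.
-- Taking n of order ℓ 2 ^ ℓ, the numbers s, R and the bound on t are all fixed multiples of 2 ^ ℓ.

private variable
  A B : Set
  m n : ℕ

-- Boolean tests and their reflection

b2n : Bool → ℕ
b2n true  = 1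
b2n false = 0

b2n≤1 : ∀ b → b2n b ≤ 1
b2n≤1 true  = s≤s z≤n
b2n≤1 false = z≤n

true≢false : true ≢ false
true≢false ()

conflict : ∀ {b} {W : Set} → b ≡ true → b ≡ false → W
conflict p q = ⊥-elim (true≢false (trans (sym p) q))

true-or-false : ∀ b → b ≡ true ⊎ b ≡ false
true-or-false true  = inj₁ refl
true-or-false false = inj₂ refl

¬true⇒false : ∀ {b} → ¬ (b ≡ true) → b ≡ false
¬true⇒false {true}  h = ⊥-elim (h refl)
¬true⇒false {false} h = refl

not-true : ∀ {b} → not b ≡ true → b ≡ false
not-true {false} _ = refl

iff⇒≡ : ∀ {a b} → (a ≡ true → b ≡ true) → (b ≡ true → a ≡ true) → a ≡ b
iff⇒≡ {true}  {true}  _ _ = refl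
iff⇒≡ {true}  {false} f _ = sym (f refl)
iff⇒≡ {false} {true}  _ g = g refl
iff⇒≡ {false} {false} _ _ = refl

∧-intro : ∀ {a b} → a ≡ true → b ≡ true → a ∧ b ≡ true
∧-intro refl refl = refl

∧-elimˡ : ∀ {a b} → a ∧ b ≡ true → a ≡ true
∧-elimˡ {true} _ = refl

∧-elimʳ : ∀ {a b} → a ∧ b ≡ true → b ≡ true
∧-elimʳ {true} e = e

∨-introˡ : ∀ {a b} → a ≡ true → a ∨ b ≡ true
∨-introˡ refl = refl

∨-introʳ : ∀ {a b} → b ≡ true → a ∨ b ≡ true
∨-introʳ {true}  _ = refl
∨-introʳ {false} e = e

∨-elim : ∀ {a b} → a ∨ b ≡ true → a ≡ true ⊎ b ≡ true
∨-elim {true}  _ = inj₁ refl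
∨-elim {false} e = inj₂ e

dec-true : ∀ {P : Set} (d : Dec P) → P → does d ≡ true
dec-true (yes _) _ = refl
dec-true (no ¬p) p = ⊥-elim (¬p p)

dec-false : ∀ {P : Set} (d : Dec P) → ¬ P → does d ≡ false
dec-false (yes p) ¬p = ⊥-elim (¬p p)
dec-false (no _)  _  = refl

from-does : ∀ {P : Set} (d : Dec P) → does d ≡ true → P
from-does (yes p) _ = p

b2n-mono : ∀ {a b} → (a ≡ true → b ≡ true) → b2n a ≤ b2n b
b2n-mono {true}  h rewrite h refl = ≤-refl
b2n-mono {false} _ = z≤n

-- Counting in lists

sumOf : (A → ℕ) → List A → ℕ
sumOf g []       = 0
sumOf g (x ∷ xs) = g x + sumOf g xs

count : (A → Bool) → List A → ℕ
count p = sumOf (λ x → b2n (p x))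

sumOf-mono : ∀ {g h : A → ℕ} xs → (∀ {x} → x ∈ xs → g x ≤ h x) → sumOf g xs ≤ sumOf h xs
sumOf-mono []       _ = z≤n
sumOf-mono (x ∷ xs) l = +-mono-≤ (l (here refl)) (sumOf-mono xs (l ∘ there))

sumOf-strict : ∀ {g h : A → ℕ} {xs x} → (∀ {x} → x ∈ xs → g x ≤ h x) → x ∈ xs → g x < h x →
               sumOf g xs < sumOf h xs
sumOf-strict {xs = x ∷ xs} l (here refl) s = +-mono-<-≤ s (sumOf-mono xs (l ∘ there))
sumOf-strict {xs = x ∷ xs} l (there i)   s = +-mono-≤-< (l (here refl)) (sumOf-strict (l ∘ there) i s)

sumOf-cong : ∀ {g h : A → ℕ} xs → (∀ {x} → x ∈ xs → g x ≡ h x) → sumOf g xs ≡ sumOf h xs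
sumOf-cong []       _ = refl
sumOf-cong (x ∷ xs) e = cong₂ _+_ (e (here refl)) (sumOf-cong xs (e ∘ there))

sumOf-+ : ∀ (g h : A → ℕ) xs → sumOf (λ x → g x + h x) xs ≡ sumOf g xs + sumOf h xs
sumOf-+ g h []       = refl
sumOf-+ g h (x ∷ xs) rewrite sumOf-+ g h xs = lemma (g x) (h x) (sumOf g xs) (sumOf h xs)
  where
  lemma : ∀ a b c d → a + b + (c + d) ≡ a + c + (b + d)
  lemma = solve-∀

sumOf-* : ∀ c (g : A → ℕ) xs → sumOf (λ x → c * g x) xs ≡ c * sumOf g xs
sumOf-* c g []       = sym (*-zeroʳ c)
sumOf-* c g (x ∷ xs) rewrite sumOf-* c g xs = sym (*-distribˡ-+ c (g x) (sumOf g xs))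

sumOf-++ : ∀ (g : A → ℕ) xs ys → sumOf g (xs ++ ys) ≡ sumOf g xs + sumOf g ys
sumOf-++ g []       ys = refl
sumOf-++ g (x ∷ xs) ys rewrite sumOf-++ g xs ys = sym (+-assoc (g x) _ _)

sumOf-map : ∀ (g : B → ℕ) (φ : A → B) xs → sumOf g (map φ xs) ≡ sumOf (λ x → g (φ x)) xs
sumOf-map g φ []       = refl
sumOf-map g φ (x ∷ xs) = cong (g (φ x) +_) (sumOf-map g φ xs)

sumOf-concatMap : ∀ (g : B → ℕ) (φ : A → List B) xs → sumOf g (concatMap φ xs) ≡ sumOf (λ x → sumOf g (φ x)) xs
sumOf-concatMap g φ []       = refl
sumOf-concatMap g φ (x ∷ xs) = trans (sumOf-++ g (φ x) _) (cong (sumOf g (φ x) +_) (sumOf-concatMap g φ xs))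

sumOf-const : ∀ c (xs : List A) → sumOf (λ _ → c) xs ≡ length xs * c
sumOf-const c []       = refl
sumOf-const c (x ∷ xs) = cong (c +_) (sumOf-const c xs)

sumOf-↭ : ∀ (g : A → ℕ) {xs ys} → xs ↭ ys → sumOf g xs ≡ sumOf g ys
sumOf-↭ g Perm.refl         = refl
sumOf-↭ g (Perm.prep x p)   = cong (g x +_) (sumOf-↭ g p)
sumOf-↭ g (Perm.swap {xs} {ys} x y p) = begin
  g x + (g y + sumOf g xs) ≡⟨ +-assoc (g x) (g y) _ ⟨
  g x + g y + sumOf g xs   ≡⟨ cong₂ _+_ (+-comm (g x) (g y)) (sumOf-↭ g p) ⟩
  g y + g x + sumOf g ys   ≡⟨ +-assoc (g y) (g x) _ ⟩
  g y + (g x + sumOf g ys) ∎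
  where open ≡-Reasoning
sumOf-↭ g (Perm.trans p q)  = trans (sumOf-↭ g p) (sumOf-↭ g q)

map-unique : ∀ {φ : A → B} {xs} → (∀ {x y} → x ∈ xs → y ∈ xs → φ x ≡ φ y → x ≡ y) → Unique xs → Unique (map φ xs)
map-unique inj [] = []
map-unique {φ = φ} {xs = x ∷ xs} inj (x∉ ∷ u) =
  All.tabulate (λ {b} b∈ φx≡b → case-map b∈ φx≡b) ∷ map-unique (λ i j → inj (there i) (there j)) u
  where
  case-map : ∀ {b} → b ∈ map φ xs → φ x ≡ b → ⊥
  case-map b∈ e with ∈-map⁻ φ b∈
  ... | y , y∈ , refl = All.lookup x∉ y∈ (inj (here refl) (there y∈) e)

-- The list `map ι xs` is duplicate-free and has the same members as `xs`, hence is a permutation of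
-- it.
sumOf-involution : ∀ {xs : List A} (ι : A → A) → Unique xs → (∀ {x} → x ∈ xs → ι x ∈ xs) →
                   (∀ {x} → x ∈ xs → ι (ι x) ≡ x) → (g : A → ℕ) → sumOf (λ x → g (ι x)) xs ≡ sumOf g xs
sumOf-involution {xs = xs} ι u cl inv g =
  trans (sym (sumOf-map g ι xs)) (sumOf-↭ g (∼bag⇒↭ (unique∧set⇒bag u′ u (mk⇔ to from))))
  where
  u′ : Unique (map ι xs)
  u′ = map-unique (λ i j e → trans (sym (inv i)) (trans (cong ι e) (inv j))) u
  to : ∀ {x} → x ∈ map ι xs → x ∈ xs
  to i with ∈-map⁻ ι i
  ... | y , y∈ , refl = cl y∈
  from : ∀ {x} → x ∈ xs → x ∈ map ι xs
  from i = subst (_∈ map ι xs) (inv i) (∈-map⁺ ι (cl i))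

count-mono : ∀ {p q : A → Bool} xs → (∀ {x} → x ∈ xs → p x ≡ true → q x ≡ true) → count p xs ≤ count q xs
count-mono xs l = sumOf-mono xs (λ i → b2n-mono (l i))

count-cong : ∀ {p q : A → Bool} xs → (∀ {x} → x ∈ xs → p x ≡ q x) → count p xs ≡ count q xs
count-cong xs e = sumOf-cong xs (λ i → cong b2n (e i))

count≤length : ∀ (p : A → Bool) xs → count p xs ≤ length xs
count≤length p []       = z≤n
count≤length p (x ∷ xs) = +-mono-≤ (b2n≤1 (p x)) (count≤length p xs)

count-true : ∀ (xs : List A) → count (λ _ → true) xs ≡ length xs
count-true []       = refl
count-true (x ∷ xs) = cong suc (count-true xs)

∨-b2n : ∀ a b → b2n (a ∨ b) ≤ b2n a + b2n b
∨-b2n true  b = s≤s z≤n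
∨-b2n false b = ≤-refl

∨∧-b2n : ∀ a b → b2n (a ∨ b) + b2n (a ∧ b) ≡ b2n a + b2n b
∨∧-b2n true  b = refl
∨∧-b2n false b = +-identityʳ _

count-∨ : ∀ (p q : A → Bool) xs → count (λ x → p x ∨ q x) xs ≤ count p xs + count q xs
count-∨ p q xs = ≤-trans (sumOf-mono xs (λ {x} _ → ∨-b2n (p x) (q x))) (≤-reflexive (sumOf-+ _ _ xs))

count-∨∧ : ∀ (p q : A → Bool) xs →
           count (λ x → p x ∨ q x) xs + count (λ x → p x ∧ q x) xs ≡ count p xs + count q xs
count-∨∧ p q xs = trans (sym (sumOf-+ _ _ xs)) (trans (sumOf-cong xs (λ {x} _ → ∨∧-b2n (p x) (q x))) (sumOf-+ _ _ xs))

search : ∀ (p : A → Bool) xs → (∃[ x ] (x ∈ xs × p x ≡ true)) ⊎ (∀ {x} → x ∈ xs → p x ≡ false)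
search p []       = inj₂ (λ ())
search p (x ∷ xs) with true-or-false (p x)
... | inj₁ t = inj₁ (x , here refl , t)
... | inj₂ f with search p xs
...   | inj₁ (y , i , t) = inj₁ (y , there i , t)
...   | inj₂ h = inj₂ (λ { (here refl) → f ; (there i) → h i })

count≡0 : ∀ {p : A → Bool} xs → (∀ {x} → x ∈ xs → p x ≡ false) → count p xs ≡ 0
count≡0 xs h = trans (sumOf-cong xs (λ i → cong b2n (h i))) (trans (sumOf-const 0 xs) (*-zeroʳ (length xs)))

count>0 : ∀ {p : A → Bool} {xs x} → x ∈ xs → p x ≡ true → 1 ≤ count p xs
count>0 {xs = x ∷ xs} (here refl) e rewrite e = s≤s z≤n
count>0 {p = p} {xs = y ∷ xs} (there i) e = ≤-trans (count>0 i e) (m≤n+m _ (b2n (p y)))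

count<length : ∀ (p : A → Bool) xs → count p xs < length xs → ∃[ x ] (x ∈ xs × p x ≡ false)
count<length p (x ∷ xs) l with true-or-false (p x)
... | inj₂ f = x , here refl , f
... | inj₁ t rewrite t with count<length p xs (≤-pred l)
...   | y , i , f = y , there i , f

remove : ∀ {ys : List A} {y} (q : A → Bool) → y ∈ ys → q y ≡ true →
         ∃[ ys′ ] (count q ys ≡ suc (count q ys′) × (∀ {z} → z ∈ ys → z ≢ y → z ∈ ys′))
remove {ys = y ∷ ys} q (here refl) e rewrite e =
  ys , refl , λ { (here refl) ne → ⊥-elim (ne refl) ; (there i) _ → i }
remove {ys = x ∷ ys} q (there i) e with remove q i e
... | ys′ , c , r = x ∷ ys′ , trans (cong (b2n (q x) +_) c) (+-suc _ _) ,
  λ { (here refl) _ → here refl ; (there k) ne → there (r k ne) }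

-- Removing the image of each counted element from `ys` leaves all later images available, since
-- injectivity makes them different from it.
count-injection : ∀ {xs : List A} {ys : List B} {p : A → Bool} {q : B → Bool} (φ : A → B) → Unique xs →
                  (∀ {x} → x ∈ xs → p x ≡ true → φ x ∈ ys) →
                  (∀ {x} → x ∈ xs → p x ≡ true → q (φ x) ≡ true) →
                  (∀ {x y} → x ∈ xs → y ∈ xs → p x ≡ true → p y ≡ true → φ x ≡ φ y → x ≡ y) →
                  count p xs ≤ count q ys
count-injection {xs = []} φ _ _ _ _ = z≤n
count-injection {xs = x ∷ xs} {ys} {p} {q} φ (x∉ ∷ u) into good inj with true-or-false (p x)
... | inj₂ f rewrite f = count-injection φ u (into ∘ there) (good ∘ there) (λ i j → inj (there i) (there j))
... | inj₁ t with remove q (into (here refl) t) (good (here refl) t)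
...   | ys′ , c , r rewrite t | c = s≤s (count-injection φ u
          (λ i e → r (into (there i) e) (λ eq → All.lookup x∉ i (sym (inj (there i) (here refl) e t eq))))
          (good ∘ there) (λ i j → inj (there i) (there j)))

count-⊆ : ∀ {xs ys : List A} {p q : A → Bool} → Unique xs →
          (∀ {x} → x ∈ xs → p x ≡ true → x ∈ ys × q x ≡ true) → count p xs ≤ count q ys
count-⊆ u l = count-injection (λ x → x) u (λ i e → proj₁ (l i e)) (λ i e → proj₂ (l i e)) (λ _ _ _ _ e → e)

length-⊆ : ∀ {xs ys : List A} → Unique xs → (∀ {x} → x ∈ xs → x ∈ ys) → length xs ≤ length ys
length-⊆ {xs = xs} {ys} u l = subst₂≤ (count-true xs) (count-true ys) (count-⊆ u (λ i _ → l i , refl))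
  where
  subst₂≤ : ∀ {a b c d} → a ≡ b → c ≡ d → a ≤ c → b ≤ d
  subst₂≤ refl refl h = h

-- Completeness and uniqueness of the list of partitions

allVecs-product : ∀ {A : Set} (xs : List A) n → ∀ zs →
                  concatMap (λ x → map (Vec._∷_ x) (allVecs xs n)) zs ≡ cartesianProductWith Vec._∷_ zs (allVecs xs n)
allVecs-product xs n []       = refl
allVecs-product xs n (z ∷ zs) = cong (map (Vec._∷_ z) (allVecs xs n) ++_) (allVecs-product xs n zs)

allVecs-unique : ∀ {A : Set} {xs : List A} → Unique xs → ∀ n → Unique (allVecs xs n)
allVecs-unique u zero    = [] ∷ []
allVecs-unique {xs = xs} u (suc n) rewrite allVecs-product xs n xs =
  Uniqueₚ.cartesianProductWith⁺ Vec._∷_ (λ { refl → refl , refl }) u (allVecs-unique u n)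

allVecs-complete : ∀ {A : Set} {xs : List A} → (∀ x → x ∈ xs) → ∀ {n} (v : Vec A n) → v ∈ allVecs xs n
allVecs-complete c Vec.[]      = here refl
allVecs-complete {xs = xs} c {suc n} (x Vec.∷ v) rewrite allVecs-product xs n xs =
  ∈-cartesianProductWith⁺ Vec._∷_ (c x) (allVecs-complete c v)

allPartitions-unique : ∀ n → Unique (allPartitions n)
allPartitions-unique n = Uniqueₚ.filter⁺ isPartition? (allVecs-unique (allVecs-unique (((λ ()) ∷ []) ∷ [] ∷ []) n) n)

∈-allPartitions : ∀ {n} {P : BlockMap n} → IsPartition P → P ∈ allPartitions n
∈-allPartitions {P = P} p = ∈-filter⁺ isPartition? (allVecs-complete (allVecs-complete bools) P) p
  where
  bools : ∀ b → b ∈ (true ∷ false ∷ [])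
  bools true  = here refl
  bools false = there (here refl)

allPartitions-sound : ∀ {n} {P : BlockMap n} → P ∈ allPartitions n → IsPartition P
allPartitions-sound {n} i = proj₂ (∈-filter⁻ isPartition? {xs = allBlockMaps n} i)

-- IsPartition unfolds to a product, from which P cannot be inferred; the record can.
record Partition (P : BlockMap n) : Set where
  constructor partition
  field isPartition : IsPartition P
open Partition public

-- Partitions as equivalence relations

vec-ext : ∀ {A : Set} {u v : Vec A n} → (∀ x → lookup u x ≡ lookup v x) → u ≡ v
vec-ext {u = u} {v} e = trans (sym (tabulate∘lookup u)) (trans (tabulate-cong e) (tabulate∘lookup v))

record IsEquiv (R : Fin n → Fin n → Bool) : Set where
  field
    reflᵣ  : ∀ x → R x x ≡ true
    symᵣ   : ∀ x y → R x y ≡ true → R y x ≡ true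
    transᵣ : ∀ x y z → R x y ≡ true → R y z ≡ true → R x z ≡ true
open IsEquiv public

opaque
  -- Being opaque, the relation stays folded in goals instead of turning into nested lookups; the
  -- lemmas of this block mediate between it and the rows.
  rel : BlockMap n → Fin n → Fin n → Bool
  rel P x y = lookup (lookup P x) y

  matrix : (Fin n → Fin n → Bool) → BlockMap n
  matrix R = tabulate (λ x → tabulate (R x))

  rel-matrix : ∀ (R : Fin n → Fin n → Bool) x y → rel (matrix R) x y ≡ R x y
  rel-matrix R x y = trans (cong (λ r → lookup r y) (lookup∘tabulate (λ x → tabulate (R x)) x)) (lookup∘tabulate (R x) y)

  rel-ext : {P Q : BlockMap n} → (∀ x y → rel P x y ≡ rel Q x y) → P ≡ Q
  rel-ext e = vec-ext (λ x → vec-ext (e x))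

  rel-rows : {P Q : BlockMap n} {x y : Fin n} → lookup P x ≡ lookup Q y → ∀ z → rel P x z ≡ rel Q y z
  rel-rows e z = cong (λ r → lookup r z) e

  rel-refl : {P : BlockMap n} → Partition P → ∀ x → rel P x x ≡ true
  rel-refl (partition p) x = []=⇒lookup (proj₁ p x)

  rel⇒row≡ : {P : BlockMap n} → Partition P → ∀ {x y} → rel P x y ≡ true → lookup P y ≡ lookup P x
  rel⇒row≡ {P = P} (partition p) {x} {y} e = proj₂ p x y (lookup⇒[]= y (lookup P x) e)

  equiv⇒partition : {P : BlockMap n} → IsEquiv (rel P) → Partition P
  equiv⇒partition {P = P} q = partition
    ((λ x → lookup⇒[]= x (lookup P x) (reflᵣ q x)) ,
    λ x y y∈ → let e = []=⇒lookup y∈ in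
      vec-ext (λ z → iff⇒≡ (transᵣ q x y z e) (transᵣ q y x z (symᵣ q x y e))))

row≡⇒rel : {P : BlockMap n} → Partition P → ∀ {x y} → lookup P x ≡ lookup P y → rel P x y ≡ true
row≡⇒rel {P = P} p {x} {y} e = trans (rel-rows {P = P} {P} e y) (rel-refl p y)

rel-sym : {P : BlockMap n} → Partition P → ∀ {x y} → rel P x y ≡ true → rel P y x ≡ true
rel-sym p e = row≡⇒rel p (rel⇒row≡ p e)

rel-trans : {P : BlockMap n} → Partition P → ∀ {x y z} → rel P x y ≡ true → rel P y z ≡ true → rel P x z ≡ true
rel-trans {P = P} p {z = z} e f = trans (rel-rows {P = P} {P} (sym (rel⇒row≡ p e)) z) f

rel-comm : {P : BlockMap n} → Partition P → ∀ x y → rel P x y ≡ rel P y x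
rel-comm p x y = iff⇒≡ (rel-sym p) (rel-sym p)

matrix-partition : {R : Fin n → Fin n → Bool} → IsEquiv R → Partition (matrix R)
matrix-partition {R = R} q = equiv⇒partition (record
  { reflᵣ  = λ x → trans (rel-matrix R x x) (reflᵣ q x)
  ; symᵣ   = λ x y e → trans (rel-matrix R y x) (symᵣ q x y (trans (sym (rel-matrix R x y)) e))
  ; transᵣ = λ x y z e f → trans (rel-matrix R x z)
      (transᵣ q x y z (trans (sym (rel-matrix R x y)) e) (trans (sym (rel-matrix R y z)) f)) })

-- One operation for several purposes: a restriction for injective `e`, a relabelling for a
-- transposition, and the insertion of a point into a block for a map that identifies two points.
pull : (Fin m → Fin n) → BlockMap n → BlockMap m
pull e P = matrix (λ a b → rel P (e a) (e b))

rel-pull : ∀ (e : Fin m → Fin n) P a b → rel (pull e P) a b ≡ rel P (e a) (e b)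
rel-pull e P = rel-matrix _

pull-partition : ∀ (e : Fin m → Fin n) {P} → Partition P → Partition (pull e P)
pull-partition e p = matrix-partition (record
  { reflᵣ = λ a → rel-refl p (e a) ; symᵣ = λ _ _ → rel-sym p ; transᵣ = λ _ _ _ → rel-trans p })

-- Singleton blocks

opaque
  unfolding rel

  single : BlockMap n → Fin n → Bool
  single P x = does (≡-dec _≟ᵇ_ (lookup P x) ⁅ x ⁆)

  single⇒row : ∀ {P : BlockMap n} {x} → single P x ≡ true → lookup P x ≡ ⁅ x ⁆
  single⇒row {P = P} {x} = from-does (≡-dec _≟ᵇ_ (lookup P x) ⁅ x ⁆)

  row⇒single : ∀ {P : BlockMap n} {x} → lookup P x ≡ ⁅ x ⁆ → single P x ≡ true
  row⇒single {P = P} {x} = dec-true (≡-dec _≟ᵇ_ (lookup P x) ⁅ x ⁆)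

  single⇒≡ : ∀ {P : BlockMap n} {x y} → single P x ≡ true → rel P x y ≡ true → y ≡ x
  single⇒≡ {P = P} {x} {y} s e =
    x∈⁅y⁆⇒x≡y x (lookup⇒[]= y ⁅ x ⁆ (trans (cong (λ r → lookup r y) (sym (single⇒row {P = P} s))) e))

  single-intro : ∀ {P : BlockMap n} {x} → Partition P → (∀ y → rel P x y ≡ true → y ≡ x) → single P x ≡ true
  single-intro {P = P} {x} p h = row⇒single {P = P} (vec-ext (λ y → iff⇒≡
    (λ e → subst (λ z → lookup ⁅ x ⁆ z ≡ true) (sym (h y e)) ([]=⇒lookup (x∈⁅x⁆ x)))
    (λ e → subst (λ z → rel P x z ≡ true) (sym (x∈⁅y⁆⇒x≡y x (lookup⇒[]= y ⁅ x ⁆ e))) (rel-refl p x))))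

¬single⇒≢ : ∀ {P : BlockMap n} {x y} → rel P x y ≡ true → y ≢ x → single P x ≡ false
¬single⇒≢ e ne = ¬true⇒false (λ s → ne (single⇒≡ s e))

¬single⇒partner : ∀ {P : BlockMap n} {x} → Partition P → single P x ≡ false → ∃[ y ] (y ≢ x × rel P x y ≡ true)
¬single⇒partner {n = n} {P = P} {x} p s with Finₚ.any? (λ y → ¬? (y ≟ x) ×-dec (rel P x y ≟ᵇ true))
... | yes (y , ne , e) = y , ne , e
... | no h = conflict (single-intro p (λ y e → decide y e)) s
  where
  decide : ∀ y → rel P x y ≡ true → y ≡ x
  decide y e with y ≟ x
  ... | yes eq = eq
  ... | no ne  = ⊥-elim (h (y , ne , e))

-- Initial segments of the ground set, and sizes of families

below : ∀ {n} → ℕ → List (Fin n)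
below zero = []
below {n} (suc k) with k <? n
... | yes k<n = fromℕ< k<n ∷ below k
... | no _    = below k

below-sound : ∀ k {x : Fin n} → x ∈ below k → toℕ x < k
below-sound {n} (suc k) i with k <? n
below-sound {n} (suc k) (here refl) | yes k<n = s≤s (≤-reflexive (toℕ-fromℕ< k<n))
below-sound {n} (suc k) (there i)   | yes k<n = m<n⇒m<1+n (below-sound k i)
below-sound {n} (suc k) i           | no _    = m<n⇒m<1+n (below-sound k i)

∈-below : ∀ k {x : Fin n} → toℕ x < k → x ∈ below k
∈-below {n} (suc k) {x} l with k <? n | m≤n⇒m<n∨m≡n (≤-pred l)
... | yes k<n | inj₁ x<k = there (∈-below k x<k)
... | yes k<n | inj₂ x≡k = here (toℕ-injective (trans x≡k (sym (toℕ-fromℕ< k<n))))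
... | no _    | inj₁ x<k = ∈-below k x<k
... | no k≮n  | inj₂ x≡k = contradiction (subst (_< n) x≡k (toℕ<n x)) k≮n

below-unique : ∀ k → Unique (below {n} k)
below-unique zero = []
below-unique {n} (suc k) with k <? n
... | yes k<n = All.tabulate (λ i e → <⇒≢ (below-sound k i) (trans (cong toℕ (sym e)) (toℕ-fromℕ< k<n))) ∷ below-unique k
... | no _    = below-unique k

length-below : ∀ {k} → k ≤ n → length (below {n} k) ≡ k
length-below {k = zero} _ = refl
length-below {n} {suc k} l with k <? n
... | yes k<n = cong suc (length-below (≤-trans (n≤1+n k) l))
... | no k≮n  = contradiction l k≮n

length-below≤ : ∀ k → length (below {n} k) ≤ k
length-below≤ zero = z≤n
length-below≤ {n} (suc k) with k <? n
... | yes k<n = s≤s (length-below≤ k)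
... | no k≮n  = ≤-trans (length-below≤ k) (n≤1+n k)

elements : ∀ n → List (Fin n)
elements n = below n

∈-elements : ∀ (x : Fin n) → x ∈ elements n
∈-elements {n} x = ∈-below n (toℕ<n x)

elements-unique : ∀ n → Unique (elements n)
elements-unique n = below-unique n

length-elements : ∀ n → length (elements n) ≡ n
length-elements n = length-below ≤-refl

sound : ∀ {P : BlockMap n} → P ∈ allPartitions n → Partition P
sound i = partition (allPartitions-sound i)

complete : ∀ {P : BlockMap n} → Partition P → P ∈ allPartitions n
complete p = ∈-allPartitions (isPartition p)

-- Families are tests rather than lists, so that membership in a compressed family is a formula in
-- membership in the old one; only partitions are counted.
cnt : (BlockMap n → Bool) → ℕ
cnt {n} f = count f (allPartitions n)

cnt-injection : ∀ {p : BlockMap n → Bool} {q : BlockMap m → Bool} (φ : BlockMap n → BlockMap m) →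
                (∀ {P} → Partition P → p P ≡ true → Partition (φ P) × q (φ P) ≡ true) →
                (∀ {P Q} → Partition P → Partition Q → p P ≡ true → p Q ≡ true → φ P ≡ φ Q → P ≡ Q) →
                cnt p ≤ cnt q
cnt-injection φ good inj = count-injection φ (allPartitions-unique _)
  (λ i e → complete (proj₁ (good (sound i) e)))
  (λ i e → proj₂ (good (sound i) e))
  (λ i j → inj (sound i) (sound j))

cnt-mono : ∀ {p q : BlockMap n → Bool} → (∀ {P} → Partition P → p P ≡ true → q P ≡ true) → cnt p ≤ cnt q
cnt-mono l = count-mono (allPartitions _) (λ i → l (sound i))

Bell≡cnt : ∀ n → cnt {n} (λ _ → true) ≡ Bell n
Bell≡cnt n = count-true (allPartitions n)

-- Stars: partitions with prescribed singletons

module _ {n : ℕ} where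

  hasSingles : List (Fin n) → BlockMap n → Bool
  hasSingles []       P = true
  hasSingles (x ∷ xs) P = single P x ∧ hasSingles xs P

  hasSingles⁺ : ∀ xs {P} → (∀ {x} → x ∈ xs → single P x ≡ true) → hasSingles xs P ≡ true
  hasSingles⁺ []       h = refl
  hasSingles⁺ (x ∷ xs) {P} h = ∧-intro (h (here refl)) (hasSingles⁺ xs {P} (λ i → h (there i)))

  hasSingles⁻ : ∀ xs {P} → hasSingles xs P ≡ true → ∀ {x} → x ∈ xs → single P x ≡ true
  hasSingles⁻ (x ∷ xs) {P} e (here refl) = ∧-elimˡ {b = hasSingles xs P} e
  hasSingles⁻ (x ∷ xs) {P} e (there i)   = hasSingles⁻ xs {P} (∧-elimʳ {single P x} e) i

  -- Points are deleted one at a time. A new point `a` lies outside the earlier list, so it has a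
  -- position `k` in the enumeration so far, and `punchIn k` skips that position.
  complement : ∀ (A : List (Fin n)) → Unique A →
               Σ (Fin (n ∸ length A) → Fin n) λ e → (∀ x → x ∉ A → ∃[ k ] e k ≡ x) × (∀ {k l} → e k ≡ e l → k ≡ l)
  complement [] _ = (λ k → k) , (λ x _ → x , refl) , λ eq → eq
  complement (a ∷ A) (a∉ ∷ u) with complement A u
  ... | e , surj , inj with surj a (λ i → All.lookup a∉ i refl)
  ...   | k , ek≡a = removing (n ∸ length A) (n ∸ suc (length A)) (sym (pred[m∸n]≡m∸[1+n] n (length A))) e surj inj k ek≡a
    where
    removing : ∀ m m′ → m′ ≡ pred m → (e : Fin m → Fin n) → (∀ x → x ∉ A → ∃[ k ] e k ≡ x) →
               (∀ {k l} → e k ≡ e l → k ≡ l) → (k : Fin m) → e k ≡ a →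
               Σ (Fin m′ → Fin n) λ e′ → (∀ x → x ∉ a ∷ A → ∃[ l ] e′ l ≡ x) × (∀ {k l} → e′ k ≡ e′ l → k ≡ l)
    removing (suc m) .m refl e surj inj k ek =
      (λ l → e (punchIn k l)) , new , λ eq → Finₚ.punchIn-injective k _ _ (inj eq)
      where
      new : ∀ x → x ∉ a ∷ A → ∃[ l ] e (punchIn k l) ≡ x
      new x x∉ with surj x (λ i → x∉ (there i))
      ... | j , ej≡x = punchOut k≢j , trans (cong e (Finₚ.punchIn-punchOut k≢j)) ej≡x
        where
        k≢j : k ≢ j
        k≢j refl = x∉ (here (trans (sym ej≡x) ek))

  -- Rows and columns at points of `A` are forced in both partitions; all remaining entries are
  -- visible after restriction along `e`.
  star-restriction : ∀ {m} {A : List (Fin n)} (e : Fin m → Fin n) → (∀ x → x ∉ A → ∃[ k ] e k ≡ x) →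
                     ∀ {P Q} → Partition P → Partition Q → hasSingles A P ≡ true → hasSingles A Q ≡ true →
                     pull e P ≡ pull e Q → P ≡ Q
  star-restriction {A = A} e surj {P} {Q} p q a b eq = rel-ext (λ x y → entry x y (x ∈? A) (y ∈? A))
    where
    open import Data.List.Membership.DecPropositional (_≟_ {n}) using (_∈?_)
    single-entry : ∀ {x} → x ∈ A → ∀ y → rel P x y ≡ rel Q x y
    single-entry {x} i = rel-rows {P = P} {Q}
      (trans (single⇒row (hasSingles⁻ A {P} a i)) (sym (single⇒row (hasSingles⁻ A {Q} b i))))
    entry : ∀ x y → Dec (x ∈ A) → Dec (y ∈ A) → rel P x y ≡ rel Q x y
    entry x y (yes i) _       = single-entry i y
    entry x y (no _)  (yes i) = trans (rel-comm p x y) (trans (single-entry i x) (rel-comm q y x))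
    entry x y (no x∉) (no y∉) with surj x x∉ | surj y y∉
    ... | k , refl | l , refl = trans (sym (rel-pull e P k l)) (trans (cong (λ R → rel R k l) eq) (rel-pull e Q k l))

  cnt-star≤ : ∀ {A} → Unique A → cnt (hasSingles A) ≤ Bell (n ∸ length A)
  cnt-star≤ {A} u with complement A u
  ... | e , surj , _ = ≤-trans
    (cnt-injection (pull e) (λ p _ → pull-partition e p , refl) (star-restriction e surj))
    (≤-reflexive (Bell≡cnt (n ∸ length A)))

  cnt-empty : ∀ {f : BlockMap n → Bool} → (∀ {P} → Partition P → f P ≡ false) → cnt f ≡ 0
  cnt-empty h = count≡0 (allPartitions n) (λ i → h (sound i))

-- Compression along an involution

double-injective : ∀ {a b} → a + a ≡ b + b → a ≡ b
double-injective {a} {b} e with <-cmp a b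
... | tri≈ _ a≡b _ = a≡b
... | tri< a<b _ _ = contradiction e (<⇒≢ (+-mono-< a<b a<b))
... | tri> _ _ b<a = contradiction (sym e) (<⇒≢ (+-mono-< b<a b<a))

double-cancel-< : ∀ {a b} → a + a < b + b → a < b
double-cancel-< {a} {b} l with a <? b
... | yes a<b = a<b
... | no a≮b  = contradiction l (≤⇒≯ (+-mono-≤ (≮⇒≥ a≮b) (≮⇒≥ a≮b)))

-- The rule on one pair. If `u` holds, the partition under test is the upper one of its pair and
-- takes the union of both memberships; if `v` holds, its partner is the upper one and it keeps only
-- the intersection.
pairCompress : Bool → Bool → Bool → Bool → Bool
pairCompress u v a b = if u then a ∨ b else if v then a ∧ b else a

pairCompress-sum : ∀ u v a b → (u ≡ true → v ≡ false) →
                   b2n (pairCompress u v a b) + b2n (pairCompress v u b a) ≡ b2n a + b2n b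
pairCompress-sum true  true  a b ex = conflict refl (ex refl)
pairCompress-sum false false a b ex = refl
pairCompress-sum true  false true  true  ex = refl
pairCompress-sum true  false true  false ex = refl
pairCompress-sum true  false false true  ex = refl
pairCompress-sum true  false false false ex = refl
pairCompress-sum false true  true  true  ex = refl
pairCompress-sum false true  true  false ex = refl
pairCompress-sum false true  false true  ex = refl
pairCompress-sum false true  false false ex = refl

pairCompress-rank : ∀ u v a b {r s} → (u ≡ true → s < r) → (v ≡ true → r < s) →
  b2n a * r + b2n b * s ≤ b2n (pairCompress u v a b) * r + b2n (pairCompress v u b a) * s
pairCompress-rank true  true  a b h k = contradiction (h refl) (<⇒≯ (k refl))
pairCompress-rank false false a b h k = ≤-refl
pairCompress-rank true  false true  true  h k = ≤-refl
pairCompress-rank true  false true  false h k = ≤-refl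
pairCompress-rank true  false false false h k = ≤-refl
pairCompress-rank true  false false true {r} {s} h k rewrite +-identityʳ s | +-identityʳ r | +-identityʳ r = <⇒≤ (h refl)
pairCompress-rank false true  true  true  h k = ≤-refl
pairCompress-rank false true  false true  h k = ≤-refl
pairCompress-rank false true  false false h k = ≤-refl
pairCompress-rank false true  true false {r} {s} h k rewrite +-identityʳ r | +-identityʳ s | +-identityʳ r = <⇒≤ (k refl)

-- The common part of shifting and splitting. `ι k` pairs partitions up, `up k P` marks the member
-- of a pair towards which the compression pushes, and `rank` is the potential that grows.
module Compression {n : ℕ} {K : Set} (keys : List K) (key∈ : ∀ k → k ∈ keys)
  (ι : K → BlockMap n → BlockMap n) (up : K → BlockMap n → Bool) (rank : BlockMap n → ℕ)
  (ι-partition : ∀ k {P} → Partition P → Partition (ι k P))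
  (ι-involutive : ∀ k {P} → Partition P → ι k (ι k P) ≡ P)
  (up-flips : ∀ k {P} → Partition P → up k P ≡ true → up k (ι k P) ≡ false)
  (up-rank : ∀ k {P} → Partition P → up k P ≡ true → rank (ι k P) < rank P)
  where

  Family : Set
  Family = BlockMap n → Bool

  compress : K → Family → Family
  compress k f P = pairCompress (up k P) (up k (ι k P)) (f P) (f (ι k P))

  -- The dichotomy behind the preservation proofs: a member is either old, together with its upper
  -- partner if it has one, or raised from an old partner.
  compress-elim : ∀ k (f : Family) {P} → Partition P → compress k f P ≡ true →
                  (f P ≡ true × (up k (ι k P) ≡ true → f (ι k P) ≡ true)) ⊎ (up k P ≡ true × f (ι k P) ≡ true)
  compress-elim k f {P} p e with up k P in u
  ... | true with ∨-elim {f P} e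
  ...   | inj₁ fP  = inj₁ (fP , λ v → conflict v (up-flips k p u))
  ...   | inj₂ fιP = inj₂ (refl , fιP)
  compress-elim k f {P} p e | false with up k (ι k P) in v
  ...   | true  = inj₁ (∧-elimˡ e , λ _ → ∧-elimʳ {f P} e)
  ...   | false = inj₁ (e , λ ())

  up-after-ι : ∀ k {P} → Partition P → up k (ι k P) ≡ true → up k P ≡ false
  up-after-ι k p u = trans (sym (cong (up k) (ι-involutive k p))) (up-flips k (ι-partition k p) u)

  compress-down : ∀ k (f : Family) {P} → Partition P → f P ≡ true → compress k f P ≡ false →
                  up k (ι k P) ≡ true × compress k f (ι k P) ≡ true
  compress-down k f {P} p fP e with up k (ι k P) in v
  ... | true rewrite up-after-ι k p v | ι-involutive k p | fP | e = refl , refl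
  ... | false with up k P
  ...   | true  rewrite fP = conflict refl e
  ...   | false = conflict fP e

  -- Every partition is counted twice. Comparing doubled sums avoids choosing a representative of
  -- each pair and treats the fixed points of `ι k` uniformly.
  sum-pairs : ∀ k (g : BlockMap n → ℕ) →
              sumOf (λ P → g P + g (ι k P)) (allPartitions n) ≡ sumOf g (allPartitions n) + sumOf g (allPartitions n)
  sum-pairs k g = trans (sumOf-+ g (λ P → g (ι k P)) (allPartitions n)) (cong (sumOf g (allPartitions n) +_)
    (sumOf-involution (ι k) (allPartitions-unique n) (λ i → complete (ι-partition k (sound i)))
      (λ i → ι-involutive k (sound i)) g))

  compress-ι : ∀ k f {P} → Partition P →
               compress k f (ι k P) ≡ pairCompress (up k (ι k P)) (up k P) (f (ι k P)) (f P)
  compress-ι k f {P} p = cong (λ Q → pairCompress (up k (ι k P)) (up k Q) (f (ι k P)) (f Q)) (ι-involutive k p)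

  cnt-compress : ∀ k f → cnt (compress k f) ≡ cnt f
  cnt-compress k f = double-injective (trans (sym (sum-pairs k _)) (trans
    (sumOf-cong (allPartitions n) (λ {P} i → trans
      (cong (λ z → b2n (compress k f P) + b2n z) (compress-ι k f (sound i)))
      (pairCompress-sum (up k P) (up k (ι k P)) (f P) (f (ι k P)) (up-flips k (sound i)))))
    (sum-pairs k _)))

  totalRank : Family → ℕ
  totalRank f = sumOf (λ P → b2n (f P) * rank P) (allPartitions n)

  totalRank-bound : ∀ f → totalRank f ≤ sumOf rank (allPartitions n)
  totalRank-bound f = sumOf-mono (allPartitions n) (λ {P} _ →
    ≤-trans (*-monoˡ-≤ (rank P) (b2n≤1 (f P))) (≤-reflexive (*-identityˡ (rank P))))

  Stable : Family → Set
  Stable f = ∀ k {P} → Partition P → f P ≡ true → up k (ι k P) ≡ true → f (ι k P) ≡ true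

  down-rank : ∀ k {P} → Partition P → up k (ι k P) ≡ true → rank P < rank (ι k P)
  down-rank k {P} p v = subst (λ Q → rank Q < rank (ι k P)) (ι-involutive k p) (up-rank k (ι-partition k p) v)

  compress-increases : ∀ k f {P} → Partition P → f P ≡ true → up k (ι k P) ≡ true → f (ι k P) ≡ false →
                       totalRank f < totalRank (compress k f)
  compress-increases k f {P} p fP v fιP = double-cancel-< (≤-trans (s≤s (≤-reflexive (sym (sum-pairs k _))))
    (≤-trans (sumOf-strict (λ i → pointwise (sound i)) (complete p) strict) (≤-reflexive (sum-pairs k _))))
    where
    pointwise : ∀ {Q} → Partition Q →
      b2n (f Q) * rank Q + b2n (f (ι k Q)) * rank (ι k Q) ≤
      b2n (compress k f Q) * rank Q + b2n (compress k f (ι k Q)) * rank (ι k Q)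
    pointwise {Q} q rewrite compress-ι k f q =
      pairCompress-rank (up k Q) (up k (ι k Q)) (f Q) (f (ι k Q)) (up-rank k q) (down-rank k q)
    strict : b2n (f P) * rank P + b2n (f (ι k P)) * rank (ι k P) <
             b2n (compress k f P) * rank P + b2n (compress k f (ι k P)) * rank (ι k P)
    strict rewrite compress-ι k f p | up-after-ι k p v | v | fP | fιP
      | +-identityʳ (rank P) | +-identityʳ (rank P) | +-identityʳ (rank (ι k P)) = down-rank k p v

  unstable : Family → K → BlockMap n → Bool
  unstable f k P = f P ∧ (up k (ι k P) ∧ not (f (ι k P)))

  -- The property travels backwards along compressions. An unstable family has a compression of
  -- strictly larger total rank, and the total rank never exceeds the sum of all ranks, which
  -- therefore serves as fuel.
  compression-induction : (C : Family → Set) → (∀ f → Stable f → C f) → (∀ k f → C (compress k f) → C f) → ∀ f → C f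
  compression-induction C base step f = go (sumOf rank (allPartitions n)) f (m≤m+n _ _)
    where
    not-false : ∀ {a b} → a ∧ not b ≡ false → a ≡ true → b ≡ true
    not-false {true} {true} _ _ = refl
    ∧-false : ∀ {a b} → a ∧ b ≡ false → a ≡ true → b ≡ false
    ∧-false {true} e _ = e

    hasUnstable : Family → K → Bool
    hasUnstable f k with search (unstable f k) (allPartitions n)
    ... | inj₁ _ = true
    ... | inj₂ _ = false

    findUnstable : ∀ f → (∃[ k ] ∃[ P ] (Partition P × unstable f k P ≡ true)) ⊎ Stable f
    findUnstable f with search (hasUnstable f) keys
    ... | inj₁ (k , _ , e) with search (unstable f k) (allPartitions n)
    ...   | inj₁ (P , i , t) = inj₁ (k , P , sound i , t)
    findUnstable f | inj₂ h = inj₂ (λ k p fP u → stable k p fP u (h (key∈ k)))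
      where
      stable : ∀ k {P} → Partition P → f P ≡ true → up k (ι k P) ≡ true → hasUnstable f k ≡ false → f (ι k P) ≡ true
      stable k p fP u e with search (unstable f k) (allPartitions n)
      ... | inj₁ _    = conflict refl e
      ... | inj₂ none = not-false (∧-false (none (complete p)) fP) u

    go : ∀ fuel f → sumOf rank (allPartitions n) ≤ fuel + totalRank f → C f
    go fuel f l with findUnstable f
    ... | inj₂ st = base f st
    ... | inj₁ (k , P , p , e) = continue fuel l
      where
      grows : totalRank f < totalRank (compress k f)
      grows = compress-increases k f p (∧-elimˡ e) (∧-elimˡ (∧-elimʳ {f P} e))
                (not-true (∧-elimʳ {up k (ι k P)} (∧-elimʳ {f P} e)))
      continue : ∀ fuel → sumOf rank (allPartitions n) ≤ fuel + totalRank f → C f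
      continue zero    l = contradiction (totalRank-bound (compress k f)) (<⇒≱ (≤-<-trans l grows))
      continue (suc m) l = step k f (go m (compress k f)
        (≤-trans l (≤-trans (≤-reflexive (sym (+-suc m (totalRank f)))) (+-monoʳ-≤ m grows))))

-- Keys of the compressions, and common singletons

pairs : ∀ n → List (Fin n × Fin n)
pairs n = cartesianProduct (elements n) (elements n)

∈-pairs : ∀ (k : Fin n × Fin n) → k ∈ pairs n
∈-pairs (i , j) = ∈-cartesianProduct⁺ (∈-elements i) (∈-elements j)

size : BlockMap n → ℕ
size {n} P = count (single P) (elements n)

commonSingles : BlockMap n → BlockMap n → ℕ
commonSingles {n} P Q = count (λ x → single P x ∧ single Q x) (elements n)

-- `P` and `Q` may coincide, so every member has at least `t` singletons.
record SinglesIntersecting (t : ℕ) (f : BlockMap n → Bool) : Set where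
  constructor singlesIntersecting
  field meet : ∀ {P Q} → Partition P → Partition Q → f P ≡ true → f Q ≡ true → t ≤ commonSingles P Q
open SinglesIntersecting public

-- Left-shifting of singletons

transpose : Fin n → Fin n → Fin n → Fin n
transpose i j x with x ≟ i
... | yes _ = j
... | no _ with x ≟ j
...   | yes _ = i
...   | no _  = x

transpose-left : ∀ (i j : Fin n) → transpose i j i ≡ j
transpose-left i j with i ≟ i
... | yes _ = refl
... | no ne = ⊥-elim (ne refl)

transpose-right : ∀ (i j : Fin n) → transpose i j j ≡ i
transpose-right i j with j ≟ i
... | yes e = e
... | no _ with j ≟ j
...   | yes _ = refl
...   | no ne = ⊥-elim (ne refl)

transpose-other : ∀ {i j x : Fin n} → x ≢ i → x ≢ j → transpose i j x ≡ x
transpose-other {i = i} {j} {x} x≢i x≢j with x ≟ i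
... | yes e = ⊥-elim (x≢i e)
... | no _ with x ≟ j
...   | yes e = ⊥-elim (x≢j e)
...   | no _  = refl

transpose-elim : ∀ (i j : Fin n) (W : Fin n → Fin n → Set) → W i j → W j i →
                 (∀ x → x ≢ i → x ≢ j → W x x) → ∀ x → W x (transpose i j x)
transpose-elim i j W a b c x with x ≟ i
... | yes refl = a
... | no x≢i with x ≟ j
...   | yes refl = b
...   | no x≢j   = c x x≢i x≢j

transpose-involutive : ∀ (i j : Fin n) x → transpose i j (transpose i j x) ≡ x
transpose-involutive i j = transpose-elim i j (λ x y → transpose i j y ≡ x)
  (transpose-right i j) (transpose-left i j) (λ x → transpose-other)

pull-involutive : ∀ {τ : Fin n → Fin n} → (∀ x → τ (τ x) ≡ x) → ∀ P → pull τ (pull τ P) ≡ P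
pull-involutive {τ = τ} inv P = rel-ext (λ x y → trans (rel-pull τ (pull τ P) x y)
  (trans (rel-pull τ P (τ x) (τ y)) (cong₂ (rel P) (inv x) (inv y))))

single-pull : ∀ {τ : Fin n → Fin n} → (∀ x → τ (τ x) ≡ x) → ∀ {P} → Partition P →
              ∀ x → single (pull τ P) x ≡ single P (τ x)
single-pull {τ = τ} inv {P} p x = iff⇒≡
  (λ s → single-intro p (λ y r → trans (sym (inv y)) (cong τ (single⇒≡ s
    (trans (rel-pull τ P x (τ y)) (trans (cong (rel P (τ x)) (inv y)) r))))))
  (λ s → single-intro (pull-partition τ p) (λ y r →
    trans (sym (inv y)) (trans (cong τ (single⇒≡ s (trans (sym (rel-pull τ P x y)) r))) (inv x))))

sum-elements-involution : ∀ {τ : Fin n → Fin n} → (∀ x → τ (τ x) ≡ x) → ∀ (g : Fin n → ℕ) →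
                          sumOf (λ x → g (τ x)) (elements n) ≡ sumOf g (elements n)
sum-elements-involution {n} {τ} inv g = sumOf-involution τ (elements-unique n) (λ _ → ∈-elements _) (λ {x} _ → inv x) g

size-pull : ∀ {τ : Fin n → Fin n} → (∀ x → τ (τ x) ≡ x) → ∀ {P} → Partition P → size (pull τ P) ≡ size P
size-pull {n} {τ} inv {P} p = trans (count-cong (elements n) (λ {x} _ → single-pull inv p x))
  (sum-elements-involution inv (λ x → b2n (single P x)))

commonSingles-pull : ∀ {τ : Fin n → Fin n} → (∀ x → τ (τ x) ≡ x) → ∀ {P Q} → Partition P → Partition Q →
                     commonSingles (pull τ P) (pull τ Q) ≡ commonSingles P Q
commonSingles-pull {n} {τ} inv {P} {Q} p q =
  trans (count-cong (elements n) (λ {x} _ → cong₂ _∧_ (single-pull inv p x) (single-pull inv q x)))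
    (sum-elements-involution inv (λ x → b2n (single P x ∧ single Q x)))

commonSingles-comm : ∀ (P Q : BlockMap n) → commonSingles P Q ≡ commonSingles Q P
commonSingles-comm {n} P Q = count-cong (elements n) (λ {x} _ → ∧-comm (single P x) (single Q x))

module Shifting (n : ℕ) where

  swap : Fin n × Fin n → BlockMap n → BlockMap n
  swap (i , j) = pull (transpose i j)

  shifted : Fin n × Fin n → BlockMap n → Bool
  shifted (i , j) P = does (i Fin.<? j) ∧ (single P i ∧ not (single P j))

  -- Singletons further left weigh more, so that a shift raises the total.
  weight : BlockMap n → ℕ
  weight P = sumOf (λ x → b2n (single P x) * (n ∸ toℕ x)) (elements n)

  shifted⁻ : ∀ {i j P} → shifted (i , j) P ≡ true → (i Fin.< j) × single P i ≡ true × single P j ≡ false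
  shifted⁻ {i} {j} {P} e = from-does (i Fin.<? j) (∧-elimˡ e) , ∧-elimˡ rest , not-true (∧-elimʳ {single P i} rest)
    where
    rest : single P i ∧ not (single P j) ≡ true
    rest = ∧-elimʳ {does (i Fin.<? j)} e

  shifted⁺ : ∀ {i j P} → i Fin.< j → single P i ≡ true → single P j ≡ false → shifted (i , j) P ≡ true
  shifted⁺ {i} {j} {P} i<j a b = ∧-intro (dec-true (i Fin.<? j) i<j) (∧-intro a (cong not b))

  single-swap : ∀ i j {P} → Partition P → ∀ x → single (swap (i , j) P) x ≡ single P (transpose i j x)
  single-swap i j = single-pull (transpose-involutive i j)

  single-swap-i : ∀ i j {P} → Partition P → single (swap (i , j) P) i ≡ single P j
  single-swap-i i j {P} p = trans (single-swap i j p i) (cong (single P) (transpose-left i j))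

  single-swap-j : ∀ i j {P} → Partition P → single (swap (i , j) P) j ≡ single P i
  single-swap-j i j {P} p = trans (single-swap i j p j) (cong (single P) (transpose-right i j))

  shifted-flips : ∀ k {P} → Partition P → shifted k P ≡ true → shifted k (swap k P) ≡ false
  shifted-flips (i , j) {P} p u with shifted⁻ {i} {j} {P} u
  ... | _ , _ , b = ¬true⇒false λ v →
    conflict (proj₁ (proj₂ (shifted⁻ {i} {j} {swap (i , j) P} v))) (trans (single-swap-i i j p) b)

  shifted-weight : ∀ k {P} → Partition P → shifted k P ≡ true → weight (swap k P) < weight P
  shifted-weight (i , j) {P} p u with shifted⁻ {i} {j} {P} u
  ... | i<j , a , b = ≤-trans (s≤s (≤-reflexive reindexed)) (sumOf-strict (λ {x} _ → pointwise x) (∈-elements i) strict)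
    where
    τ : Fin n → Fin n
    τ = transpose i j
    reindexed : weight (swap (i , j) P) ≡ sumOf (λ x → b2n (single P x) * (n ∸ toℕ (τ x))) (elements n)
    reindexed = trans (sumOf-cong (elements n) (λ {x} _ → cong₂ (λ b y → b2n b * (n ∸ toℕ y))
      (single-swap i j p x) (sym (transpose-involutive i j x))))
      (sum-elements-involution (transpose-involutive i j) (λ x → b2n (single P x) * (n ∸ toℕ (τ x))))
    pointwise : ∀ x → b2n (single P x) * (n ∸ toℕ (τ x)) ≤ b2n (single P x) * (n ∸ toℕ x)
    pointwise = transpose-elim i j (λ x y → b2n (single P x) * (n ∸ toℕ y) ≤ b2n (single P x) * (n ∸ toℕ x))
      (*-monoʳ-≤ (b2n (single P i)) (∸-monoʳ-≤ n (<⇒≤ i<j)))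
      (subst (λ z → b2n z * (n ∸ toℕ i) ≤ b2n z * (n ∸ toℕ j)) (sym b) z≤n)
      (λ _ _ _ → ≤-refl)
    strict : b2n (single P i) * (n ∸ toℕ (τ i)) < b2n (single P i) * (n ∸ toℕ i)
    strict rewrite transpose-left i j | a | +-identityʳ (n ∸ toℕ j) | +-identityʳ (n ∸ toℕ i) =
      ∸-monoʳ-< i<j (<⇒≤ (toℕ<n j))

  swap-partition : ∀ k {P} → Partition P → Partition (swap k P)
  swap-partition (i , j) = pull-partition (transpose i j)

  swap-involutive : ∀ k {P} → Partition P → swap k (swap k P) ≡ P
  swap-involutive (i , j) {P} _ = pull-involutive (transpose-involutive i j) P

  open Compression (pairs n) ∈-pairs swap shifted weight swap-partition swap-involutive shifted-flips shifted-weight public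

  -- The critical case is a shifted `P` against an old `Q`. If `Q` has the singleton `j` but not
  -- `i`, then `swap k Q` belongs to `f` too, and both partitions can be swapped; if it has both,
  -- the swap fixes its set of singletons; if it lacks `j`, passing from `swap k P` to `P` loses no
  -- common singleton.
  compress-meet : ∀ {t f} k → SinglesIntersecting t f → SinglesIntersecting t (compress k f)
  compress-meet {t} {f} k@(i , j) (singlesIntersecting h) = singlesIntersecting go
    where
    inv : ∀ x → transpose i j (transpose i j x) ≡ x
    inv = transpose-involutive i j
    swapP : ∀ {P} → Partition P → Partition (swap k P)
    swapP = swap-partition k

    mixed : ∀ {P Q} → Partition P → Partition Q → shifted k P ≡ true → f (swap k P) ≡ true → f Q ≡ true →
            (shifted k (swap k Q) ≡ true → f (swap k Q) ≡ true) → t ≤ commonSingles P Q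
    mixed {P} {Q} p q u fιP fQ st with shifted⁻ {i} {j} {P} u | true-or-false (single Q j) | true-or-false (single Q i)
    ... | i<j , a , b | inj₁ Qj | inj₂ Qi =
      ≤-trans (h (swapP p) (swapP q) fιP (st (shifted⁺ {i} {j} {swap k Q} i<j
          (trans (single-swap-i i j q) Qj) (trans (single-swap-j i j q) Qi))))
        (≤-reflexive (commonSingles-pull inv p q))
    ... | i<j , a , b | inj₁ Qj | inj₁ Qi =
      ≤-trans (h (swapP p) q fιP fQ) (≤-reflexive (trans
        (count-cong (elements n) (λ {x} _ → cong₂ _∧_ (single-swap i j p x) (invariant x)))
        (sum-elements-involution inv (λ x → b2n (single P x ∧ single Q x)))))
      where
      invariant : ∀ x → single Q x ≡ single Q (transpose i j x)
      invariant = transpose-elim i j (λ x y → single Q x ≡ single Q y) (trans Qi (sym Qj)) (trans Qj (sym Qi)) (λ _ _ _ → refl)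
    ... | i<j , a , b | inj₂ Qj | _ =
      ≤-trans (h (swapP p) q fιP fQ) (count-mono (elements n) (λ {x} _ e →
        ∧-intro (stays x (trans (sym (single-swap i j p x)) (∧-elimˡ e)) (∧-elimʳ {single (swap k P) x} e))
          (∧-elimʳ {single (swap k P) x} e)))
      where
      stays : ∀ x → single P (transpose i j x) ≡ true → single Q x ≡ true → single P x ≡ true
      stays = transpose-elim i j (λ x y → single P y ≡ true → single Q x ≡ true → single P x ≡ true)
        (λ e _ → a) (λ _ e → conflict e Qj) (λ _ _ _ e _ → e)

    go : ∀ {P Q} → Partition P → Partition Q → compress k f P ≡ true → compress k f Q ≡ true → t ≤ commonSingles P Q
    go {P} {Q} p q cP cQ with compress-elim k f p cP | compress-elim k f q cQ
    ... | inj₁ (fP , _)   | inj₁ (fQ , _)   = h p q fP fQ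
    ... | inj₂ (_ , fιP)  | inj₂ (_ , fιQ)  = ≤-trans (h (swapP p) (swapP q) fιP fιQ) (≤-reflexive (commonSingles-pull inv p q))
    ... | inj₂ (u , fιP)  | inj₁ (fQ , st)  = mixed p q u fιP fQ st
    ... | inj₁ (fP , st)  | inj₂ (u , fιQ)  = ≤-trans (mixed q p u fιQ fP st) (≤-reflexive (commonSingles-comm Q P))

  compress-size : ∀ {r f} k → (∀ {P} → Partition P → f P ≡ true → r ≤ size P) →
                  ∀ {P} → Partition P → compress k f P ≡ true → r ≤ size P
  compress-size {f = f} k@(i , j) h {P} p e with compress-elim k f p e
  ... | inj₁ (fP , _)  = h p fP
  ... | inj₂ (_ , fιP) = ≤-trans (h (pull-partition (transpose i j) p) fιP)
                           (≤-reflexive (size-pull (transpose-involutive i j) p))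

-- Frankl's walk argument

below-suc : ∀ {k} (k<n : k < n) → below {n} (suc k) ≡ fromℕ< k<n ∷ below k
below-suc {n} {k} k<n with k <? n
... | yes _  = refl
... | no k≮n = contradiction k<n k≮n

count-flip : ∀ {A : Set} {p q : A → Bool} {xs y} → Unique xs → y ∈ xs → p y ≡ false → q y ≡ true →
             (∀ {z} → z ∈ xs → z ≢ y → p z ≡ q z) → count q xs ≡ suc (count p xs)
count-flip {p = p} {q} {x ∷ xs} (x∉ ∷ u) (here refl) py qy same rewrite py | qy =
  cong suc (count-cong xs (λ i → sym (same (there i) (λ e → All.lookup x∉ i (sym e)))))
count-flip {p = p} {q} {x ∷ xs} (x∉ ∷ u) (there i) py qy same = trans
  (cong₂ _+_ (cong b2n (sym (same (here refl) (All.lookup x∉ i)))) (count-flip u i py qy (λ j → same (there j))))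
  (+-suc _ _)

module _ {n : ℕ} where
  open Shifting n

  module _ {f : Family} {t : ℕ} (stable : Stable f) (meets : SinglesIntersecting t f) (1≤t : 1 ≤ t) where

    private
      -- Modified P up to position k: a member of f whose singletons below k are
      -- as many as those of P, but share fewer than t of them.
      record Avoiding (P : BlockMap n) (k : ℕ) : Set where
        field
          Q         : BlockMap n
          part      : Partition Q
          member    : f Q ≡ true
          unchanged : ∀ x → k ≤ toℕ x → single Q x ≡ single P x
          few       : count (λ x → single P x ∧ single Q x) (below k) < t
          as-many   : count (single Q) (below k) ≡ count (single P) (below k)
      open Avoiding

      -- Here `c` counts the singletons of `P` below `k`, while `u` and `w` count the points that
      -- are singletons of `P` or `Q`, and of both. If w = t - 1 and the union fills all `k` places,
      -- then k + 1 ≤ t + 2 i for i = c + 1 - t.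
      tight-bound : ∀ {c u w t k} → u + w ≡ c + c → suc w ≡ t → k ≤ u → suc k ≤ t + ((suc c ∸ t) + (suc c ∸ t)) ⊎ suc c < t
      tight-bound {c} {u} {w} {t} {k} e e′ l with t ≤? suc c
      ... | no h   = inj₂ (≰⇒> h)
      ... | yes t≤ = inj₁ (≤-trans (s≤s l) (≤-reflexive (+-cancelʳ-≡ t _ _ (begin
        suc u + t             ≡⟨ cong (suc u +_) e′ ⟨
        suc u + suc w         ≡⟨ shuffle u w ⟩
        suc (suc (u + w))     ≡⟨ cong (λ z → suc (suc z)) e ⟩
        suc (suc (c + c))     ≡⟨ cong suc (+-suc c c) ⟨
        suc c + suc c         ≡⟨ cong₂ _+_ (m+[n∸m]≡n t≤) (m+[n∸m]≡n t≤) ⟨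
        (t + d) + (t + d)     ≡⟨ shuffle′ t d ⟩
        t + (d + d) + t       ∎))))
        where
        open ≡-Reasoning
        d : ℕ
        d = suc c ∸ t
        shuffle : ∀ u w → suc u + suc w ≡ suc (suc (u + w))
        shuffle = solve-∀
        shuffle′ : ∀ t d → (t + d) + (t + d) ≡ t + (d + d) + t
        shuffle′ = solve-∀

    -- Were all inequalities violated, a scan from the left would turn `P` into a member `Q` meeting
    -- it in fewer than `t` singletons: a common singleton that would be the `t`-th is shifted in
    -- `Q` to an earlier place that is free in both.
    walk : ∀ {P} → Partition P → f P ≡ true → ∃[ i ] t + i ≤ count (single P) (below (t + (i + i)))
    walk {P} p fP with search (λ i → does (t + i ≤? count (single P) (below (t + (i + i))))) (upTo (suc n))
    ... | inj₁ (i , _ , e) = i , from-does (_ ≤? _) e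
    ... | inj₂ none = contradiction (meets .meet p (part final) fP (member final)) (<⇒≱ (few final))
      where
      σP : Fin n → Bool
      σP = single P

      violated : ∀ i → i ≤ n → count σP (below (t + (i + i))) < t + i
      violated i i≤n = ≰⇒> λ h →
        conflict (dec-true (t + i ≤? count σP (below (t + (i + i)))) h) (none (∈-upTo⁺ (s≤s i≤n)))

      module Step (k : ℕ) (k<n : k < n) (Av : Avoiding P k) where
        x : Fin n
        x = fromℕ< k<n
        σQ : Fin n → Bool
        σQ = single (Q Av)
        toℕ-x : toℕ x ≡ k
        toℕ-x = toℕ-fromℕ< k<n
        B≡A : σQ x ≡ σP x
        B≡A = unchanged Av x (≤-reflexive (sym toℕ-x))

        keep : b2n (σP x ∧ σQ x) + count (λ x → σP x ∧ σQ x) (below k) < t → Avoiding P (suc k)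
        keep l = record
          { Q = Q Av ; part = part Av ; member = member Av
          ; unchanged = λ z l → unchanged Av z (<⇒≤ l)
          ; few = subst (λ xs → count (λ x → σP x ∧ σQ x) xs < t) (sym (below-suc k<n)) l
          ; as-many = subst (λ xs → count σQ xs ≡ count σP xs) (sym (below-suc k<n))
                        (cong₂ _+_ (cong b2n B≡A) (as-many Av)) }

        -- Without a free place, the points up to `k` would lie among the first t + 2 i and include
        -- c + 1 = t + i singletons of `P`, where i = c + 1 - t; but that inequality is violated.
        free : σP x ≡ true → t ≤ suc (count (λ x → σP x ∧ σQ x) (below k)) →
               count (λ x → σP x ∨ σQ x) (below k) < length (below {n} k)
        free Ax tight with count (λ x → σP x ∨ σQ x) (below k) <? length (below {n} k)
        ... | yes l = l
        ... | no ≮ = impossible (tight-bound {c = c} doubled (≤-antisym (few Av) tight)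
                       (≤-trans (≤-reflexive (sym (length-below (<⇒≤ k<n)))) (≮⇒≥ ≮)))
          where
          c : ℕ
          c = count σP (below k)
          doubled : count (λ x → σP x ∨ σQ x) (below k) + count (λ x → σP x ∧ σQ x) (below k) ≡ c + c
          doubled = trans (count-∨∧ σP σQ (below k)) (cong (c +_) (as-many Av))
          c≤k : c ≤ k
          c≤k = ≤-trans (count≤length σP (below k)) (length-below≤ k)
          t≤1+c : t ≤ suc c
          t≤1+c = ≤-trans tight (s≤s (count-mono (below k) (λ _ e → ∧-elimˡ e)))
          impossible : ∀ {W : Set} → suc k ≤ t + ((suc c ∸ t) + (suc c ∸ t)) ⊎ suc c < t → W
          impossible (inj₂ l) = contradiction t≤1+c (<⇒≱ l)
          impossible (inj₁ l) = contradiction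
            (≤-trans (≤-reflexive (sym (trans (cong (count σP) (below-suc k<n)) (cong (λ b → b2n b + c) Ax))))
              (count-⊆ (below-unique (suc k)) (λ i e → ∈-below _ (≤-trans (below-sound (suc k) i) l) , e)))
            -- `1 ≤ t` gives `suc c ∸ t ≤ c ≤ n`, so this index is among those searched.
            (<⇒≱ (≤-trans (violated (suc c ∸ t) (≤-trans (∸-monoʳ-≤ (suc c) 1≤t) (≤-trans c≤k (<⇒≤ k<n))))
              (≤-reflexive (m+[n∸m]≡n t≤1+c))))

        move : σP x ≡ true → ∀ y → y ∈ below k → σP y ≡ false → σQ y ≡ false → Avoiding P (suc k)
        move Ax y y∈ Ay By = record
          { Q = Q′ ; part = pull-partition (transpose y x) (part Av)
          -- The singleton moves left, from `x` to `y`, so stability keeps the new partition in `f`.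
          ; member = stable (y , x) (part Av) (member Av) (shifted⁺ {y} {x} {Q′} y<x B′y B′x)
          ; unchanged = λ z l → trans (B′-other (λ e → <⇒≱ (≤-trans (below-sound k y∈) (≤-trans (n≤1+n k) l)) (≤-reflexive (cong toℕ e)))
                                                (λ e → <⇒≢ l (sym (trans (cong toℕ e) toℕ-x))))
                                      (unchanged Av z (<⇒≤ l))
          ; few = subst (λ xs → count (λ x → σP x ∧ single Q′ x) xs < t) (sym (below-suc k<n))
              (subst (λ b → b2n b + count (λ x → σP x ∧ single Q′ x) (below k) < t) (sym (trans (cong (σP x ∧_) B′x) (∧-zeroʳ (σP x))))
                (subst (_< t) (count-cong (below k) common-same) (few Av)))
          ; as-many = subst (λ xs → count (single Q′) xs ≡ count σP xs) (sym (below-suc k<n))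
              counts }
          where
          Q′ : BlockMap n
          Q′ = swap (y , x) (Q Av)
          y<x : y Fin.< x
          y<x = ≤-trans (below-sound k y∈) (≤-reflexive (sym toℕ-x))
          B′y : single Q′ y ≡ true
          B′y = trans (single-swap-i y x (part Av)) (trans B≡A Ax)
          B′x : single Q′ x ≡ false
          B′x = trans (single-swap-j y x (part Av)) By
          B′-other : ∀ {z} → z ≢ y → z ≢ x → single Q′ z ≡ σQ z
          B′-other {z} ne ne′ = trans (single-swap y x (part Av) z) (cong σQ (transpose-other ne ne′))
          ≢x : ∀ {z} → z ∈ below k → z ≢ x
          ≢x i e = <⇒≢ (below-sound k i) (trans (cong toℕ e) toℕ-x)
          common-same : ∀ {z} → z ∈ below k → σP z ∧ σQ z ≡ σP z ∧ single Q′ z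
          common-same {z} i with z ≟ y
          ... | yes refl rewrite Ay = refl
          ... | no ne = cong (σP z ∧_) (sym (B′-other ne (≢x i)))
          counts : b2n (single Q′ x) + count (single Q′) (below k) ≡ b2n (σP x) + count σP (below k)
          counts rewrite B′x | Ax = trans
            (count-flip (below-unique k) y∈ By B′y (λ i ne → sym (B′-other ne (≢x i)))) (cong suc (as-many Av))

        next : Avoiding P (suc k)
        next with true-or-false (σP x)
        ... | inj₂ Ax = keep (subst (λ b → b2n (b ∧ σQ x) + count (λ x → σP x ∧ σQ x) (below k) < t) (sym Ax) (few Av))
        ... | inj₁ Ax with suc (count (λ x → σP x ∧ σQ x) (below k)) <? t
        ...   | yes l = keep (subst (λ b → b2n b + count (λ x → σP x ∧ σQ x) (below k) < t) (sym (∧-intro Ax (trans B≡A Ax))) l)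
        ...   | no ≮ with count<length _ (below k) (free Ax (≮⇒≥ ≮))
        ...     | y , y∈ , neither = move Ax y y∈ (¬true⇒false λ e → conflict (∨-introˡ e) neither)
                                       (¬true⇒false λ e → conflict (∨-introʳ {σP y} e) neither)

      build : ∀ k → k ≤ n → Avoiding P k
      build zero    _ = record { Q = P ; part = p ; member = fP ; unchanged = λ _ _ → refl ; few = 1≤t ; as-many = refl }
      build (suc k) l = Step.next k l (build k (<⇒≤ l))

      final : Avoiding P n
      final = build n ≤-refl

-- Union bounds

binom : ℕ → ℕ → ℕ
binom k       zero    = 1
binom zero    (suc r) = 0
binom (suc k) (suc r) = binom k r + binom k (suc r)

binom-1 : ∀ k → binom k 1 ≡ k
binom-1 zero    = refl
binom-1 (suc k) = cong suc (binom-1 k)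

manySingles : List (Fin n) → List (Fin n) → ℕ → BlockMap n → Bool
manySingles A xs r P = hasSingles A P ∧ does (r ≤? count (single P) xs)

cnt-∨ : ∀ (p q : BlockMap n → Bool) → cnt (λ P → p P ∨ q P) ≤ cnt p + cnt q
cnt-∨ p q = count-∨ p q (allPartitions _)

-- Branching on whether the head of `xs` is a singleton follows Pascal's rule: if it is, it joins
-- `A` and one singleton less is asked for; otherwise `r` stays.
cnt-manySingles : ∀ (A xs : List (Fin n)) r → Unique A → Unique xs → (∀ {x} → x ∈ xs → x ∉ A) →
                  cnt (manySingles A xs r) ≤ binom (length xs) r * Bell (n ∸ (length A + r))
cnt-manySingles {n} A xs zero uA u d rewrite +-identityʳ (length A) | +-identityʳ (Bell (n ∸ length A)) =
  ≤-trans (cnt-mono (λ {P} _ e → ∧-elimˡ {hasSingles A P} e)) (cnt-star≤ uA)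
cnt-manySingles A [] (suc r) uA u d = ≤-reflexive (cnt-empty (λ {P} _ → ∧-zeroʳ (hasSingles A P)))
cnt-manySingles {n} A (x ∷ xs) (suc r) uA (x∉ ∷ u) d = begin
  cnt (manySingles A (x ∷ xs) (suc r))
    ≤⟨ cnt-mono (λ {P} _ → split P) ⟩
  cnt (λ P → manySingles (x ∷ A) xs r P ∨ manySingles A xs (suc r) P)
    ≤⟨ cnt-∨ (manySingles (x ∷ A) xs r) (manySingles A xs (suc r)) ⟩
  cnt (manySingles (x ∷ A) xs r) + cnt (manySingles A xs (suc r))
    ≤⟨ +-mono-≤
         (cnt-manySingles (x ∷ A) xs r (All.tabulate (λ i e → d (here refl) (subst (_∈ A) (sym e) i)) ∷ uA) u
           (λ { i (here refl) → All.lookup x∉ i refl ; i (there j) → d (there i) j }))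
         (cnt-manySingles A xs (suc r) uA u (λ i → d (there i))) ⟩
  binom (length xs) r * Bell (n ∸ (suc (length A) + r)) + binom (length xs) (suc r) * Bell (n ∸ (length A + suc r))
    ≡⟨ cong (λ z → binom (length xs) r * Bell (n ∸ z) + binom (length xs) (suc r) * Bell (n ∸ (length A + suc r)))
         (sym (+-suc (length A) r)) ⟩
  binom (length xs) r * Bell (n ∸ (length A + suc r)) + binom (length xs) (suc r) * Bell (n ∸ (length A + suc r))
    ≡⟨ *-distribʳ-+ (Bell (n ∸ (length A + suc r))) (binom (length xs) r) (binom (length xs) (suc r)) ⟨
  binom (suc (length xs)) (suc r) * Bell (n ∸ (length A + suc r)) ∎
  where
  open ≤-Reasoning
  split : ∀ P → manySingles A (x ∷ xs) (suc r) P ≡ true →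
          manySingles (x ∷ A) xs r P ∨ manySingles A xs (suc r) P ≡ true
  split P e with true-or-false (single P x) | from-does (suc r ≤? count (single P) (x ∷ xs)) (∧-elimʳ {hasSingles A P} e)
  ... | inj₁ s | l = ∨-introˡ (∧-intro (∧-intro s (∧-elimˡ {hasSingles A P} e))
                       (dec-true (r ≤? _) (≤-pred (subst (λ b → suc r ≤ b2n b + count (single P) xs) s l))))
  ... | inj₂ s | l = ∨-introʳ {manySingles (x ∷ A) xs r P} (∧-intro (∧-elimˡ {hasSingles A P} e)
                       (dec-true (suc r ≤? _) (subst (λ b → suc r ≤ b2n b + count (single P) xs) s l)))

anyOf : ∀ {I : Set} → (I → BlockMap n → Bool) → List I → BlockMap n → Bool
anyOf q []       P = false
anyOf q (i ∷ is) P = q i P ∨ anyOf q is P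

anyOf⁺ : ∀ {I : Set} (q : I → BlockMap n → Bool) {is i P} → i ∈ is → q i P ≡ true → anyOf q is P ≡ true
anyOf⁺ q (here refl) e = ∨-introˡ e
anyOf⁺ q {i ∷ _} {P = P} (there k) e = ∨-introʳ {q i P} (anyOf⁺ q k e)

cnt-anyOf : ∀ {I : Set} (q : I → BlockMap n → Bool) is → cnt (anyOf q is) ≤ sumOf (λ i → cnt (q i)) is
cnt-anyOf {n} q []       = ≤-reflexive (cnt-empty {n} {λ _ → false} (λ _ → refl))
cnt-anyOf q (i ∷ is) = ≤-trans (cnt-∨ (q i) (anyOf q is)) (+-monoʳ-≤ (cnt (q i)) (cnt-anyOf q is))

-- Adding two points and merging them with all singletons leaves no singleton.
module _ (R : BlockMap n) where
  loose : Fin (2 + n) → Bool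
  loose zero          = true
  loose (suc zero)    = true
  loose (suc (suc x)) = single R x

  core : Fin (2 + n) → Fin (2 + n) → Bool
  core (suc (suc x)) (suc (suc y)) = rel R x y
  core _             _             = false

  mergeSingles : BlockMap (2 + n)
  mergeSingles = matrix (λ x y → (loose x ∧ loose y) ∨ core x y)

  rel-mergeSingles : ∀ x y → rel mergeSingles x y ≡ (loose x ∧ loose y) ∨ core x y
  rel-mergeSingles = rel-matrix _

module _ {R : BlockMap n} (r : Partition R) where

  core-sym : ∀ x y → core R x y ≡ true → core R y x ≡ true
  core-sym (suc (suc x)) (suc (suc y)) e = rel-sym r e

  core-trans : ∀ x y z → core R x y ≡ true → core R y z ≡ true → core R x z ≡ true
  core-trans (suc (suc x)) (suc (suc y)) (suc (suc z)) e f = rel-trans r e f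

  core-loose : ∀ x y → core R x y ≡ true → loose R x ≡ true → loose R y ≡ true
  core-loose (suc (suc x)) (suc (suc y)) e l = subst (λ w → single R w ≡ true) (sym (single⇒≡ l e)) l

  mergeSingles-partition : Partition (mergeSingles R)
  mergeSingles-partition = matrix-partition (record { reflᵣ = refl′ ; symᵣ = sym′ ; transᵣ = trans′ })
    where
    E : Fin (2 + n) → Fin (2 + n) → Bool
    E x y = (loose R x ∧ loose R y) ∨ core R x y
    refl′ : ∀ x → E x x ≡ true
    refl′ zero          = refl
    refl′ (suc zero)    = refl
    refl′ (suc (suc x)) = ∨-introʳ {single R x ∧ single R x} (rel-refl r x)
    both : ∀ {x y} → loose R x ≡ true → loose R y ≡ true → E x y ≡ true
    both a b = ∨-introˡ (∧-intro a b)
    sym′ : ∀ x y → E x y ≡ true → E y x ≡ true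
    sym′ x y e with ∨-elim {loose R x ∧ loose R y} e
    ... | inj₁ l = both {y} {x} (∧-elimʳ {loose R x} l) (∧-elimˡ l)
    ... | inj₂ c = ∨-introʳ {loose R y ∧ loose R x} (core-sym x y c)
    trans′ : ∀ x y z → E x y ≡ true → E y z ≡ true → E x z ≡ true
    trans′ x y z e f with ∨-elim {loose R x ∧ loose R y} e | ∨-elim {loose R y ∧ loose R z} f
    ... | inj₁ l | inj₁ k = both {x} {z} (∧-elimˡ l) (∧-elimʳ {loose R y} k)
    ... | inj₁ l | inj₂ d = both {x} {z} (∧-elimˡ l) (core-loose y z d (∧-elimʳ {loose R x} l))
    ... | inj₂ c | inj₁ k = both {x} {z} (core-loose y x (core-sym x y c) (∧-elimˡ k)) (∧-elimʳ {loose R y} k)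
    ... | inj₂ c | inj₂ d = ∨-introʳ {loose R x ∧ loose R z} (core-trans x y z c d)

  mergeSingles-no-single : ∀ x → single (mergeSingles R) x ≡ false
  mergeSingles-no-single zero       = ¬single⇒≢ {y = suc zero} (rel-mergeSingles R zero (suc zero)) (λ ())
  mergeSingles-no-single (suc zero) = ¬single⇒≢ {y = zero} (rel-mergeSingles R (suc zero) zero) (λ ())
  mergeSingles-no-single (suc (suc x)) with true-or-false (single R x)
  ... | inj₁ s = ¬single⇒≢ {y = zero} (trans (rel-mergeSingles R (suc (suc x)) zero) (∨-introˡ (∧-intro s refl))) (λ ())
  ... | inj₂ s with ¬single⇒partner r s
  ...   | y , ne , e = ¬single⇒≢ {y = suc (suc y)} (trans (rel-mergeSingles R (suc (suc x)) (suc (suc y)))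
            (∨-introʳ {single R x ∧ single R y} e)) (λ { refl → ne refl })

  mergeSingles-loose : ∀ x → rel (mergeSingles R) (suc (suc x)) zero ≡ single R x
  mergeSingles-loose x = trans (rel-mergeSingles R (suc (suc x)) zero) (rearrange (single R x))
    where
    rearrange : ∀ b → (b ∧ true) ∨ false ≡ b
    rearrange true  = refl
    rearrange false = refl

-- The old points in the block of `zero` are the former singletons, and away from them the relation
-- is unchanged, so `R` can be read off.
mergeSingles-injective : ∀ {R R′ : BlockMap n} → Partition R → Partition R′ → mergeSingles R ≡ mergeSingles R′ → R ≡ R′
mergeSingles-injective {R = R} {R′} r r′ eq = rel-ext entry
  where
  same-single : ∀ x → single R x ≡ single R′ x
  same-single x = trans (sym (mergeSingles-loose r x)) (trans (cong (λ P → rel P (suc (suc x)) zero) eq) (mergeSingles-loose r′ x))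
  entry : ∀ x y → rel R x y ≡ rel R′ x y
  entry x y with true-or-false (single R x)
  ... | inj₁ s = iff⇒≡ (λ e → subst (λ z → rel R′ x z ≡ true) (sym (single⇒≡ s e)) (rel-refl r′ x))
                       (λ e → subst (λ z → rel R x z ≡ true) (sym (single⇒≡ (trans (sym (same-single x)) s) e)) (rel-refl r x))
  ... | inj₂ s = trans (sym (unmerge r s)) (trans (cong (λ P → rel P (suc (suc x)) (suc (suc y))) eq)
                   (unmerge r′ (trans (sym (same-single x)) s)))
    where
    unmerge : ∀ {S : BlockMap _} → Partition S → single S x ≡ false → rel (mergeSingles S) (suc (suc x)) (suc (suc y)) ≡ rel S x y
    unmerge {S} _ s′ = trans (rel-mergeSingles S (suc (suc x)) (suc (suc y))) (cong (λ b → (b ∧ single S y) ∨ rel S x y) s′)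

someSingle : BlockMap n → Bool
someSingle P = does (1 ≤? size P)

cnt-not : ∀ (p : BlockMap n → Bool) → cnt p + cnt (λ P → not (p P)) ≡ Bell n
cnt-not {n} p = trans (sym (sumOf-+ _ _ (allPartitions n)))
  (trans (sumOf-cong (allPartitions n) (λ {P} _ → one (p P))) (Bell≡cnt n))
  where
  one : ∀ b → b2n b + b2n (not b) ≡ 1
  one true  = refl
  one false = refl

-- `mergeSingles` embeds the partitions of [m - 2] into those partitions of [m] that have no
-- singleton.
cnt-someSingle : ∀ m → 2 ≤ m → cnt {m} someSingle + Bell (m ∸ 2) ≤ Bell m
cnt-someSingle (suc zero) (s≤s ())
cnt-someSingle (suc (suc m)) _ = ≤-trans (+-monoʳ-≤ (cnt {2 + m} someSingle)
  (≤-trans (≤-reflexive (sym (Bell≡cnt m))) (cnt-injection {n = m} {m = 2 + m} {p = λ _ → true} {q = λ P → not (someSingle P)} mergeSingles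
    (λ {P} p _ → mergeSingles-partition p , cong not (dec-false (1 ≤? size (mergeSingles P)) (λ l → contradiction
      (count≡0 (elements _) (λ {x} _ → mergeSingles-no-single p x)) (λ e → <⇒≢ l (sym e)))))
    (λ p q _ _ → mergeSingles-injective p q))))
  (≤-reflexive (cnt-not {2 + m} someSingle))

-- Deleting `A` from a partition with a further singleton leaves a partition with some singleton, so
-- the loss in `cnt-someSingle` carries over.
cnt-strictly-more-singles : ∀ {A : List (Fin n)} → Unique A → 2 ≤ n ∸ length A →
  cnt (λ P → hasSingles A P ∧ does (suc (length A) ≤? size P)) + Bell (n ∸ length A ∸ 2) ≤ Bell (n ∸ length A)
cnt-strictly-more-singles {n} {A} u l with complement A u
... | e , surj , inj = ≤-trans (+-monoˡ-≤ (Bell (n ∸ length A ∸ 2)) (cnt-injection (pull e)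
    (λ {P} p h → pull-partition e p , dec-true (1 ≤? size (pull e P)) (extra p h))
    (λ {P} {Q} p q h k → star-restriction e surj p q (∧-elimˡ {hasSingles A P} h) (∧-elimˡ {hasSingles A Q} k))))
  (cnt-someSingle (n ∸ length A) l)
  where
  open import Data.List.Membership.DecPropositional (_≟_ {n}) using (_∈?_)
  extra : ∀ {P} → Partition P → hasSingles A P ∧ does (suc (length A) ≤? size P) ≡ true → 1 ≤ size (pull e P)
  extra {P} p h with search (λ x → single P x ∧ not (does (x ∈? A))) (elements n)
  ... | inj₁ (x , _ , t) with x ∈? A
  ...   | yes _ = conflict (∧-elimʳ {single P x} t) refl
  ...   | no x∉ with surj x x∉
  ...     | k , refl = count>0 (∈-elements k) (single-intro (pull-partition e p)
              (λ j r → inj (single⇒≡ (∧-elimˡ t) (trans (sym (rel-pull e P k j)) r))))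
  extra {P} p h | inj₂ none = contradiction
    (≤-trans (from-does (suc (length A) ≤? size P) (∧-elimʳ {hasSingles A P} h))
      (≤-trans (count-⊆ {q = λ _ → true} (elements-unique n) (λ {x} i s → inside x s (none i) , refl)) (≤-reflexive (count-true A))))
    1+n≰n
    where
    inside : ∀ x → single P x ≡ true → single P x ∧ not (does (x ∈? A)) ≡ false → x ∈ A
    inside x s e with x ∈? A
    ... | yes i = i
    ... | no _  = conflict (∧-intro s refl) e

length≤count : ∀ {A : Set} (p : A → Bool) xs → length xs ≤ count p xs → ∀ {x} → x ∈ xs → p x ≡ true
length≤count p (x ∷ xs) l i with true-or-false (p x)
length≤count p (x ∷ xs) l i | inj₂ e rewrite e = contradiction (≤-trans l (count≤length p xs)) 1+n≰n
length≤count p (x ∷ xs) l (here refl) | inj₁ e = e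
length≤count p (x ∷ xs) l (there i) | inj₁ e rewrite e = length≤count p xs (≤-pred l) i

-- Stable families whose members all have more than t singletons

module _ {n : ℕ} where
  open Shifting n

  -- Summand `i` bounds the members with walk index `suc i`; index 0 is estimated separately, by
  -- means of a single member `Q`.
  walkBound : ℕ → ℕ → ℕ
  walkBound t s = sumOf (λ i → binom (t + (suc i + suc i)) (t + suc i) * Bell (n ∸ (t + suc i))) (upTo s)

  -- `s` separates moderate sizes from very large ones. `tail` serves when all members of moderate
  -- size have the first `t` points as singletons, `total` when some member `Q` of moderate size
  -- does not.
  stable-bound : ∀ {f : Family} {t s} → 1 ≤ t → t + (s + s) ≤ n → 2 ≤ n ∸ t →
    binom n s * Bell (n ∸ s) < Bell (n ∸ t ∸ 2) →
    s * Bell (n ∸ (t + 1)) + (binom n s * Bell (n ∸ s) + walkBound t s) < Bell (n ∸ t) →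
    Stable f → SinglesIntersecting t f → (∀ {P} → Partition P → f P ≡ true → suc t ≤ size P) →
    cnt f < Bell (n ∸ t)
  stable-bound {f} {t} {s} 1≤t fits 2≤m tail total stable meets large =
    conclude (search (λ P → f P ∧ (does (size P <? s) ∧ not (hasSingles (below t) P))) (allPartitions n))
    where
    t≤n : t ≤ n
    t≤n = ≤-trans (m≤m+n t (s + s)) fits

    big : BlockMap n → Bool
    big = manySingles [] (elements n) s
    cnt-big : cnt big ≤ binom n s * Bell (n ∸ s)
    cnt-big = subst (λ z → cnt big ≤ binom z s * Bell (n ∸ s)) (length-elements n)
      (cnt-manySingles [] (elements n) s [] (elements-unique n) (λ _ ()))

    reaches : ℕ → BlockMap n → Bool
    reaches i = manySingles [] (below (t + (suc i + suc i))) (t + suc i)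
    cnt-reaches : ∀ {i} → i ∈ upTo s → cnt (reaches i) ≤ binom (t + (suc i + suc i)) (t + suc i) * Bell (n ∸ (t + suc i))
    cnt-reaches {i} i∈ = subst (λ z → cnt (reaches i) ≤ binom z (t + suc i) * Bell (n ∸ (t + suc i)))
      (length-below (≤-trans (+-monoʳ-≤ t (+-mono-≤ i<s i<s)) fits))
      (cnt-manySingles [] (below (t + (suc i + suc i))) (t + suc i) [] (below-unique (t + (suc i + suc i))) (λ _ ()))
      where
      i<s : suc i ≤ s
      i<s = ∈-upTo⁻ i∈

    contains : ∀ {P} → t ≤ count (single P) (below t) → hasSingles (below t) P ≡ true
    contains {P} l = hasSingles⁺ (below t) {P} (length≤count (single P) (below t) (≤-trans (length-below≤ t) l))

    conclude : (∃[ Q ] (Q ∈ allPartitions n × f Q ∧ (does (size Q <? s) ∧ not (hasSingles (below t) Q)) ≡ true)) ⊎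
               (∀ {P} → P ∈ allPartitions n → f P ∧ (does (size P <? s) ∧ not (hasSingles (below t) P)) ≡ false) →
               cnt f < Bell (n ∸ t)
    conclude (inj₂ none) = <-≤-trans (≤-<-trans covered (+-monoʳ-< _ (≤-<-trans cnt-big tail)))
        (subst (λ k → cnt (more k) + Bell (n ∸ k ∸ 2) ≤ Bell (n ∸ k)) (length-below t≤n)
          (cnt-strictly-more-singles (below-unique t) (subst (λ k → 2 ≤ n ∸ k) (sym (length-below t≤n)) 2≤m)))
      where
      more : ℕ → BlockMap n → Bool
      more k P = hasSingles (below t) P ∧ does (suc k ≤? size P)
      cases : ∀ {P} → Partition P → f P ≡ true → more t P ∨ big P ≡ true
      cases {P} p fP with s ≤? size P | true-or-false (hasSingles (below t) P)
      ... | yes l | _      = ∨-introʳ {more t P} (dec-true (s ≤? size P) l)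
      ... | no _  | inj₁ h = ∨-introˡ (∧-intro h (dec-true (suc t ≤? size P) (large p fP)))
      ... | no s≰ | inj₂ h = conflict (∧-intro fP (∧-intro (dec-true (size P <? s) (≰⇒> s≰)) (cong not h))) (none (complete p))
      covered : cnt f ≤ cnt (more t) + cnt big
      covered = ≤-trans (cnt-mono cases) (cnt-∨ (more t) big)
    conclude (inj₁ (Q , Q∈ , e)) = ≤-<-trans covered total
      where
      fQ : f Q ≡ true
      fQ = ∧-elimˡ e
      sizeQ : size Q < s
      sizeQ = from-does (size Q <? s) (∧-elimˡ (∧-elimʳ {f Q} e))
      notContained : count (single Q) (below t) < t
      notContained = ≰⇒> (λ l → conflict (contains l) (not-true (∧-elimʳ {does (size Q <? s)} (∧-elimʳ {f Q} e))))
      Y? : (x : Fin n) → Dec (single Q x ≡ true × t ≤ toℕ x)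
      Y? x = (single Q x ≟ᵇ true) ×-dec (t ≤? toℕ x)
      Y : List (Fin n)
      Y = filter Y? (elements n)
      uniqueY : Unique Y
      uniqueY = Uniqueₚ.filter⁺ Y? (elements-unique n)
      Y-sound : ∀ {x} → x ∈ Y → single Q x ≡ true × t ≤ toℕ x
      Y-sound i = proj₂ (∈-filter⁻ Y? {xs = elements n} i)
      lengthY : length Y ≤ s
      lengthY = ≤-trans (≤-reflexive (sym (count-true Y))) (≤-trans
        (count-⊆ uniqueY (λ {x} i _ → ∈-elements x , proj₁ (Y-sound i))) (<⇒≤ sizeQ))
      meetsQ : BlockMap n → Bool
      meetsQ = manySingles (below t) Y 1
      cnt-meetsQ : cnt meetsQ ≤ s * Bell (n ∸ (t + 1))
      cnt-meetsQ = ≤-trans (cnt-manySingles (below t) Y 1 (below-unique t) uniqueY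
          (λ i j → <⇒≱ (below-sound t j) (proj₂ (Y-sound i))))
        (≤-trans (≤-reflexive (cong₂ (λ a b → a * Bell (n ∸ (b + 1))) (binom-1 (length Y)) (length-below t≤n)))
          (*-monoˡ-≤ (Bell (n ∸ (t + 1))) lengthY))

      -- If `P` missed `Y`, all its common singletons with `Q` would lie among the first `t` points,
      -- where `Q` has fewer than `t`.
      hits : ∀ {P} → Partition P → f P ≡ true → 1 ≤ count (single P) Y
      hits {P} p fP with 1 ≤? count (single P) Y
      ... | yes l = l
      ... | no h  = contradiction (≤-trans (meets .meet p (sound Q∈) fP fQ)
                      (count-⊆ (elements-unique n) (λ {x} _ c → low x c , ∧-elimʳ {single P x} c))) (<⇒≱ notContained)
        where
        low : ∀ x → single P x ∧ single Q x ≡ true → x ∈ below t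
        low x c with t ≤? toℕ x
        ... | no t≰  = ∈-below t (≰⇒> t≰)
        ... | yes t≤ = contradiction
          (count>0 (∈-filter⁺ Y? (∈-elements x) (∧-elimʳ {single P x} c , t≤)) (∧-elimˡ c)) h

      cases : ∀ {P} → Partition P → f P ≡ true → meetsQ P ∨ (big P ∨ anyOf reaches (upTo s) P) ≡ true
      cases {P} p fP with s ≤? size P | walk stable meets 1≤t p fP
      ... | yes l | _ = ∨-introʳ {meetsQ P} (∨-introˡ (dec-true (s ≤? size P) l))
      ... | no s≰ | zero , l = ∨-introˡ (∧-intro
              (contains (subst (λ k → k ≤ count (single P) (below k)) (+-identityʳ t) l))
              (dec-true (1 ≤? _) (hits p fP)))
      ... | no s≰ | suc i , l = ∨-introʳ {meetsQ P} (∨-introʳ {big P} (anyOf⁺ reaches {upTo s} {i} (∈-upTo⁺ i<s)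
              (dec-true (t + suc i ≤? _) l)))
        where
        i<s : i < s
        i<s = ≤-trans (m≤n+m (suc i) t) (≤-trans l (≤-trans
          (count-⊆ (below-unique (t + (suc i + suc i))) (λ {x} _ e → ∈-elements x , e)) (<⇒≤ (≰⇒> s≰))))

      covered : cnt f ≤ s * Bell (n ∸ (t + 1)) + (binom n s * Bell (n ∸ s) + walkBound t s)
      covered = ≤-trans (cnt-mono cases) (≤-trans (cnt-∨ meetsQ (λ P → big P ∨ anyOf reaches (upTo s) P))
        (+-mono-≤ cnt-meetsQ (≤-trans (cnt-∨ big (anyOf reaches (upTo s)))
          (+-mono-≤ cnt-big (≤-trans (cnt-anyOf reaches (upTo s)) (sumOf-mono (upTo s) cnt-reaches))))))

-- Growth of the Bell numbers

addSingle : BlockMap n → BlockMap (suc n)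
addSingle {n} Q = matrix R
  where
  R : Fin (suc n) → Fin (suc n) → Bool
  R zero    zero    = true
  R zero    (suc _) = false
  R (suc _) zero    = false
  R (suc x) (suc y) = rel Q x y

retract : Fin n → Fin (suc n) → Fin n
retract x zero    = x
retract x (suc y) = y

join : BlockMap n → Fin n → BlockMap (suc n)
join Q x = pull (retract x) Q

-- Partitions paired with a list of representatives of their blocks.
Marked : ℕ → Set
Marked n = BlockMap n × List (Fin n)

-- A partition with k blocks has one child with k + 1 blocks and k children with k blocks, as in the
-- recurrence of the Stirling numbers. The new point is `zero`; old points move up by `suc`.
children : Marked n → List (Marked (suc n))
children (Q , xs) = (addSingle Q , zero ∷ map suc xs) ∷ map (λ x → join Q x , map suc xs) xs

enumeration : ∀ n → List (Marked n)
enumeration zero    = (Vec.[] , []) ∷ []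
enumeration (suc n) = concatMap children (enumeration n)

-- The list holds exactly one point of every block, so its length is the number of blocks.
record WellMarked (M : Marked n) : Set where
  field
    valid    : Partition (proj₁ M)
    uniq     : Unique (proj₂ M)
    separate : ∀ {x y} → x ∈ proj₂ M → y ∈ proj₂ M → rel (proj₁ M) x y ≡ true → x ≡ y
    cover    : ∀ z → ∃[ x ] (x ∈ proj₂ M × rel (proj₁ M) x z ≡ true)
open WellMarked

addSingle-partition : {Q : BlockMap n} → Partition Q → Partition (addSingle Q)
addSingle-partition {Q = Q} q = matrix-partition (record
  { reflᵣ  = λ { zero → refl ; (suc x) → rel-refl q x }
  ; symᵣ   = λ { zero zero _ → refl ; (suc x) (suc y) e → rel-sym q e }
  ; transᵣ = λ { zero zero zero _ _ → refl ; (suc x) (suc y) (suc z) e f → rel-trans q e f } })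

addSingle-suc : ∀ (Q : BlockMap n) x y → rel (addSingle Q) (suc x) (suc y) ≡ rel Q x y
addSingle-suc Q x y = rel-matrix _ (suc x) (suc y)

children-wellMarked : {M : Marked n} → WellMarked M → ∀ {M′} → M′ ∈ children M → WellMarked M′
children-wellMarked {M = Q , xs} w (here refl) = record
  { valid = addSingle-partition (valid w)
  ; uniq = All.tabulate (λ i e → case i e) ∷ Uniqueₚ.map⁺ suc-injective (uniq w)
  ; separate = sep
  ; cover = cov }
  where
  case : ∀ {x} → x ∈ map suc xs → zero ≡ x → ⊥
  case i refl with ∈-map⁻ suc i
  ... | _ , _ , ()
  sep : ∀ {x y} → x ∈ zero ∷ map suc xs → y ∈ zero ∷ map suc xs → rel (addSingle Q) x y ≡ true → x ≡ y
  sep (here refl) (here refl) _ = refl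
  sep (here refl) (there j) e with ∈-map⁻ suc j
  ... | y , _ , refl = conflict e (rel-matrix _ zero (suc y))
  sep (there i) (here refl) e with ∈-map⁻ suc i
  ... | x , _ , refl = conflict e (rel-matrix _ (suc x) zero)
  sep (there i) (there j) e with ∈-map⁻ suc i | ∈-map⁻ suc j
  ... | x , x∈ , refl | y , y∈ , refl = cong suc (separate w x∈ y∈ (trans (sym (addSingle-suc Q x y)) e))
  cov : ∀ z → ∃[ x ] (x ∈ zero ∷ map suc xs × rel (addSingle Q) x z ≡ true)
  cov zero    = zero , here refl , rel-matrix _ zero zero
  cov (suc z) with cover w z
  ... | x , x∈ , e = suc x , there (∈-map⁺ suc x∈) , trans (addSingle-suc Q x z) e
children-wellMarked {M = Q , xs} w (there i) with ∈-map⁻ (λ x → join Q x , map suc xs) i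
... | r , r∈ , refl = record
  { valid = pull-partition (retract r) (valid w)
  ; uniq = Uniqueₚ.map⁺ suc-injective (uniq w)
  ; separate = sep
  ; cover = cov }
  where
  sep : ∀ {x y} → x ∈ map suc xs → y ∈ map suc xs → rel (join Q r) x y ≡ true → x ≡ y
  sep i j e with ∈-map⁻ suc i | ∈-map⁻ suc j
  ... | x , x∈ , refl | y , y∈ , refl = cong suc (separate w x∈ y∈ (trans (sym (rel-pull (retract r) Q (suc x) (suc y))) e))
  cov : ∀ z → ∃[ x ] (x ∈ map suc xs × rel (join Q r) x z ≡ true)
  cov z with cover w (retract r z)
  ... | x , x∈ , e = suc x , ∈-map⁺ suc x∈ , trans (rel-pull (retract r) Q (suc x) z) e

enumeration-wellMarked : ∀ n {M} → M ∈ enumeration n → WellMarked M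
enumeration-wellMarked zero (here refl) = record
  { valid = equiv⇒partition (record { reflᵣ = λ () ; symᵣ = λ () ; transᵣ = λ () })
  ; uniq = [] ; separate = λ () ; cover = λ () }
enumeration-wellMarked (suc n) i = from-parent (∈-concatMap⁻ children {xs = enumeration n} i) (enumeration-wellMarked n)
  where
  from-parent : ∀ {Ms : List (Marked n)} {M′} → Any (λ M → M′ ∈ children M) Ms → (∀ {M} → M ∈ Ms → WellMarked M) → WellMarked M′
  from-parent (here i)  h = children-wellMarked (h (here refl)) i
  from-parent (there a) h = from-parent a (λ i → h (there i))

pull-suc-addSingle : ∀ (Q : BlockMap n) → pull suc (addSingle Q) ≡ Q
pull-suc-addSingle Q = rel-ext (λ x y → trans (rel-pull suc (addSingle Q) x y) (addSingle-suc Q x y))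

pull-suc-join : ∀ (Q : BlockMap n) r → pull suc (join Q r) ≡ Q
pull-suc-join Q r = rel-ext (λ x y → trans (rel-pull suc (join Q r) x y) (rel-pull (retract r) Q (suc x) (suc y)))

children-pull : (M : Marked n) → ∀ {P} → P ∈ map proj₁ (children M) → pull suc P ≡ proj₁ M
children-pull (Q , xs) (here refl) = pull-suc-addSingle Q
children-pull (Q , xs) (there i) with ∈-map⁻ proj₁ i
... | _ , j , refl with ∈-map⁻ (λ x → join Q x , map suc xs) j
...   | r , _ , refl = pull-suc-join Q r

rel-join-zero : ∀ (Q : BlockMap n) r y → rel (join Q r) zero (suc y) ≡ rel Q r y
rel-join-zero Q r y = rel-pull (retract r) Q zero (suc y)

children-unique : {M : Marked n} → WellMarked M → Unique (map proj₁ (children M))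
children-unique {M = Q , xs} w = subst (λ zs → Unique (addSingle Q ∷ zs)) (map-∘ xs)
  (All.tabulate new ∷ map-unique joins (uniq w))
  where
  joins : ∀ {x y} → x ∈ xs → y ∈ xs → join Q x ≡ join Q y → x ≡ y
  joins {x} {y} x∈ y∈ e = separate w x∈ y∈ (trans (sym (rel-join-zero Q x y))
    (trans (cong (λ P → rel P zero (suc y)) e) (trans (rel-join-zero Q y y) (rel-refl (valid w) y))))
  new : ∀ {P} → P ∈ map (join Q) xs → addSingle Q ≢ P
  new i e with ∈-map⁻ (join Q) i
  ... | r , _ , refl = conflict (trans (rel-join-zero Q r r) (rel-refl (valid w) r))
    (trans (cong (λ P → rel P zero (suc r)) (sym e)) (rel-matrix _ zero (suc r)))

-- `κ` gives different labels to different parents and `ρ` recovers the label from a child, so no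
-- child has two parents.
concatMap-unique : ∀ {A B C : Set} (φ : A → List B) (κ : A → C) (ρ : B → C) xs → Unique (map κ xs) →
                   (∀ {x} → x ∈ xs → Unique (φ x)) → (∀ {x y} → x ∈ xs → y ∈ φ x → ρ y ≡ κ x) → Unique (concatMap φ xs)
concatMap-unique φ κ ρ [] _ _ _ = []
concatMap-unique {B = B} φ κ ρ (x ∷ xs) (x∉ ∷ u) un key =
  Uniqueₚ.++⁺ (un (here refl)) (concatMap-unique φ κ ρ xs u (λ i → un (there i)) (λ i → key (there i)))
    (λ { (i , j) → clash i (∈-concatMap⁻ φ {xs = xs} j) })
  where
  clash : ∀ {y} → y ∈ φ x → Any (λ z → y ∈ φ z) xs → ⊥
  clash {y} i a = go (λ k → k) a
    where
    go : ∀ {zs} → (∀ {z} → z ∈ zs → z ∈ xs) → Any (λ z → y ∈ φ z) zs → ⊥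
    go emb (here j)  = All.lookup x∉ (∈-map⁺ κ (emb (here refl)))
      (trans (sym (key (here refl) i)) (key (there (emb (here refl))) j))
    go emb (there a) = go (λ k → emb (there k)) a

enumeration-unique : ∀ n → Unique (map proj₁ (enumeration n))
enumeration-unique zero    = [] ∷ []
enumeration-unique (suc n) = subst Unique (sym (map-concatMap proj₁ children (enumeration n)))
  (concatMap-unique (λ M → map proj₁ (children M)) proj₁ (pull suc) (enumeration n) (enumeration-unique n)
    (λ i → children-unique (enumeration-wellMarked n i)) (λ {M} _ → children-pull M))

-- Deleting `zero` gives the parent. Either `zero` was a singleton, or it shares its block with some
-- `suc y`, and the representative `r` of the block of `y` names the child.
enumeration-complete : ∀ n {P : BlockMap n} → Partition P → ∃[ xs ] (P , xs) ∈ enumeration n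
enumeration-complete zero    {Vec.[]} p = [] , here refl
enumeration-complete (suc n) {P} p with enumeration-complete n (pull-partition suc p)
... | xs , i with true-or-false (single P zero)
...   | inj₁ s = zero ∷ map suc xs , ∈-concatMap⁺ children (Any.map (λ { refl → here (cong (_, _) P≡) }) i)
  where
  Q : BlockMap n
  Q = pull suc P
  P≡ : P ≡ addSingle Q
  P≡ = rel-ext λ
    { zero zero → trans (rel-refl p zero) (sym (rel-matrix _ zero zero))
    ; zero (suc y) → trans (¬true⇒false (λ e → Finₚ.0≢1+n (sym (single⇒≡ s e)))) (sym (rel-matrix _ zero (suc y)))
    ; (suc x) zero → trans (¬true⇒false (λ e → Finₚ.0≢1+n (sym (single⇒≡ s (rel-sym p e))))) (sym (rel-matrix _ (suc x) zero))
    ; (suc x) (suc y) → sym (trans (addSingle-suc Q x y) (rel-pull suc P x y)) }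
...   | inj₂ s with ¬single⇒partner p s
...     | zero , ne , _ = ⊥-elim (ne refl)
...     | suc y , _ , e with cover (enumeration-wellMarked n i) y
...       | r , r∈ , f = map suc xs , ∈-concatMap⁺ children (Any.map
              (λ { refl → there (subst (λ R → (R , map suc xs) ∈ map (λ x → join Q x , map suc xs) xs) (sym P≡)
                                  (∈-map⁺ (λ x → join Q x , map suc xs) r∈)) }) i)
  where
  Q : BlockMap n
  Q = pull suc P
  close : ∀ a → rel P a (suc (retract r a)) ≡ true
  close zero    = rel-trans p e (rel-sym p (trans (sym (rel-pull suc P r y)) f))
  close (suc x) = rel-refl p (suc x)
  P≡ : P ≡ join Q r
  P≡ = rel-ext (λ a b → trans
    (iff⇒≡ (λ h → rel-trans p (rel-sym p (close a)) (rel-trans p h (close b)))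
           (λ h → rel-trans p (close a) (rel-trans p h (rel-sym p (close b)))))
    (sym (trans (rel-pull (retract r) Q a b) (rel-pull suc P (retract r a) (retract r b)))))

-- ∑ₖ S(n,k) φ(k), where S(n,k) is the Stirling number of the second kind.
blockSum : ℕ → (ℕ → ℕ) → ℕ
blockSum n φ = sumOf (λ M → φ (length (proj₂ M))) (enumeration n)

-- The Stirling recurrence, transposed to act on the weight `φ` instead of on the numbers.
blockSum-suc : ∀ n φ → blockSum (suc n) φ ≡ blockSum n (λ k → φ (suc k) + k * φ k)
blockSum-suc n φ = trans (sumOf-concatMap g children (enumeration n))
  (sumOf-cong (enumeration n) (λ { {Q , xs} _ → cong₂ _+_ (cong (λ k → φ (suc k)) (length-map suc xs))
    (trans (sumOf-map g (λ x → join Q x , map suc xs) xs)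
      (trans (sumOf-const (φ (length (map suc xs))) xs) (cong (λ k → length xs * φ k) (length-map suc xs)))) }))
  where
  g : Marked (suc n) → ℕ
  g M = φ (length (proj₂ M))

blockSum-mono : ∀ n {φ ψ} → (∀ k → φ k ≤ ψ k) → blockSum n φ ≤ blockSum n ψ
blockSum-mono n l = sumOf-mono (enumeration n) (λ {M} _ → l (length (proj₂ M)))

Bell≡blockSum : ∀ n → Bell n ≡ blockSum n (λ _ → 1)
Bell≡blockSum n = trans (≤-antisym
    (length-⊆ (allPartitions-unique n) (λ i → ∈-map⁺ proj₁ (proj₂ (enumeration-complete n (sound i)))))
    (length-⊆ (enumeration-unique n) (λ i → from (∈-map⁻ proj₁ i))))
  (trans (length-map proj₁ (enumeration n)) (sym (trans (sumOf-const 1 (enumeration n)) (*-identityʳ _))))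
  where
  from : ∀ {P} → ∃[ M ] (M ∈ enumeration n × P ≡ proj₁ M) → P ∈ allPartitions n
  from (M , i , refl) = complete (valid (enumeration-wellMarked n i))

atLeast : ℕ → ℕ → ℕ
atLeast K k = b2n (does (K ≤? k))

fewer : ℕ → ℕ → ℕ
fewer K k = b2n (does (k <? K))

fewer-no : ∀ {K k} → ¬ (k < K) → fewer K k ≡ 0
fewer-no {K} {k} h = cong b2n (dec-false (k <? K) h)

fewer-yes : ∀ {K k} → k < K → fewer K k ≡ 1
fewer-yes {K} {k} h = cong b2n (dec-true (k <? K) h)

-- A partition with `k < K` blocks has at most `k + 1 ≤ K` children with fewer than `K` blocks; any
-- other partition has none.
blockSum-fewer : ∀ K n → blockSum n (fewer K) ≤ K ^ n
blockSum-fewer K zero    = ≤-trans (≤-reflexive (+-identityʳ _)) (b2n≤1 (does (0 <? K)))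
blockSum-fewer K (suc n) = begin
  blockSum (suc n) (fewer K)                          ≡⟨ blockSum-suc n (fewer K) ⟩
  blockSum n (λ k → fewer K (suc k) + k * fewer K k)  ≤⟨ blockSum-mono n step ⟩
  blockSum n (λ k → K * fewer K k)                    ≡⟨ sumOf-* K _ (enumeration n) ⟩
  K * blockSum n (fewer K)                            ≤⟨ *-monoʳ-≤ K (blockSum-fewer K n) ⟩
  K ^ suc n                                           ∎
  where
  open ≤-Reasoning
  step : ∀ k → fewer K (suc k) + k * fewer K k ≤ K * fewer K k
  step k with k <? K
  ... | yes l rewrite fewer-yes l | *-identityʳ k | *-identityʳ K = ≤-trans (+-monoˡ-≤ k (b2n≤1 _)) l
  ... | no h  rewrite fewer-no h | fewer-no {K} {suc k} (λ l → h (<⇒≤ l)) | *-zeroʳ k = z≤n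

-- Blocks are never lost, so every partition with at least `K` blocks has at least `K` children of
-- the same kind.
blockSum-atLeast : ∀ K j i → K ^ j * blockSum i (atLeast K) ≤ blockSum (j + i) (atLeast K)
blockSum-atLeast K zero    i = ≤-reflexive (+-identityʳ _)
blockSum-atLeast K (suc j) i = begin
  K * K ^ j * blockSum i (atLeast K)                          ≡⟨ *-assoc K (K ^ j) _ ⟩
  K * (K ^ j * blockSum i (atLeast K))                        ≤⟨ *-monoʳ-≤ K (blockSum-atLeast K j i) ⟩
  K * blockSum (j + i) (atLeast K)                            ≡⟨ sumOf-* K _ (enumeration (j + i)) ⟨
  blockSum (j + i) (λ k → K * atLeast K k)                    ≤⟨ blockSum-mono (j + i) step ⟩
  blockSum (j + i) (λ k → atLeast K (suc k) + k * atLeast K k) ≡⟨ blockSum-suc (j + i) (atLeast K) ⟨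
  blockSum (suc j + i) (atLeast K)                            ∎
  where
  open ≤-Reasoning
  step : ∀ k → K * atLeast K k ≤ atLeast K (suc k) + k * atLeast K k
  step k with K ≤? k
  ... | yes l rewrite dec-true (K ≤? k) l = ≤-trans (*-monoˡ-≤ 1 l) (m≤n+m (k * 1) _)
  ... | no h  rewrite dec-false (K ≤? k) h | *-zeroʳ K = z≤n

-- The partition of [K] into singletons is counted.
blockSum-all : ∀ K → 1 ≤ blockSum K (atLeast K)
blockSum-all zero    = ≤-refl
blockSum-all (suc K) = begin
  1                                                                  ≤⟨ blockSum-all K ⟩
  blockSum K (atLeast K)                                             ≤⟨ blockSum-mono K step ⟩
  blockSum K (λ k → atLeast (suc K) (suc k) + k * atLeast (suc K) k) ≡⟨ blockSum-suc K (atLeast (suc K)) ⟨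
  blockSum (suc K) (atLeast (suc K))                                 ∎
  where
  open ≤-Reasoning
  step : ∀ k → atLeast K k ≤ atLeast (suc K) (suc k) + k * atLeast (suc K) k
  step k = ≤-trans (b2n-mono (λ e → dec-true (suc K ≤? suc k) (s≤s (from-does (K ≤? k) e)))) (m≤m+n _ _)

-- Start from the partition of [K] into singletons; each of the `j` further points can then join any
-- of at least `K` blocks.
Bell-lower : ∀ K j → K ^ j ≤ Bell (j + K)
Bell-lower K j = begin
  K ^ j                            ≡⟨ *-identityʳ (K ^ j) ⟨
  K ^ j * 1                        ≤⟨ *-monoʳ-≤ (K ^ j) (blockSum-all K) ⟩
  K ^ j * blockSum K (atLeast K)   ≤⟨ blockSum-atLeast K j K ⟩
  blockSum (j + K) (atLeast K)     ≤⟨ blockSum-mono (j + K) (λ k → b2n≤1 (does (K ≤? k))) ⟩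
  blockSum (j + K) (λ _ → 1)       ≡⟨ Bell≡blockSum (j + K) ⟨
  Bell (j + K)                     ∎
  where open ≤-Reasoning

-- A partition with k blocks has k + 1 extensions, hence at least r unless k < r; the last term pays
-- for these exceptions, of which there are at most `r ^ n`.
Bell-suc : ∀ r n → r * Bell n ≤ Bell (suc n) + r * r ^ n
Bell-suc r n = begin
  r * Bell n                                            ≡⟨ cong (r *_) (Bell≡blockSum n) ⟩
  r * blockSum n (λ _ → 1)                              ≡⟨ sumOf-* r _ (enumeration n) ⟨
  blockSum n (λ _ → r * 1)                              ≤⟨ blockSum-mono n step ⟩
  blockSum n (λ k → (1 + k * 1) + r * fewer r k)        ≡⟨ sumOf-+ _ _ (enumeration n) ⟩
  blockSum n (λ k → 1 + k * 1) + blockSum n (λ k → r * fewer r k)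
    ≡⟨ cong₂ _+_ (sym (trans (Bell≡blockSum (suc n)) (blockSum-suc n (λ _ → 1)))) (sumOf-* r _ (enumeration n)) ⟩
  Bell (suc n) + r * blockSum n (fewer r)               ≤⟨ +-monoʳ-≤ (Bell (suc n)) (*-monoʳ-≤ r (blockSum-fewer r n)) ⟩
  Bell (suc n) + r * r ^ n                              ∎
  where
  open ≤-Reasoning
  step : ∀ k → r * 1 ≤ (1 + k * 1) + r * fewer r k
  step k with k <? r
  ... | yes l rewrite fewer-yes l = m≤n+m (r * 1) (1 + k * 1)
  ... | no h  = ≤-trans (*-monoˡ-≤ 1 (≮⇒≥ h)) (≤-trans (n≤1+n (k * 1)) (m≤m+n (1 + k * 1) (r * fewer r k)))

-- Inequalities for binomial coefficients, powers and factorials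

binom>k : ∀ {k r} → k < r → binom k r ≡ 0
binom>k {zero}  {suc r} _ = refl
binom>k {suc k} {suc r} (s≤s l) = cong₂ _+_ (binom>k l) (binom>k (m<n⇒m<1+n l))

1≤m^n : ∀ {m} n → 1 ≤ m → 1 ≤ m ^ n
1≤m^n zero    _ = ≤-refl
1≤m^n (suc n) l = *-mono-≤ l (1≤m^n n l)

-- By symmetry the coefficient chooses `e` points. The exponent `e` is the one that the gain `R ^ e`
-- can match in the walk sum.
binom-≤^ : ∀ r e → binom (e + r) r ≤ (e + r) ^ e
binom-≤^ zero zero    = ≤-refl
binom-≤^ zero (suc e) = 1≤m^n (suc e) (s≤s z≤n)
binom-≤^ (suc r) zero rewrite binom>k (n<1+n r) | +-identityʳ (binom r r) = binom-≤^ r zero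
binom-≤^ (suc r) (suc e) = begin
  binom (e + suc r) r + binom (e + suc r) (suc r)
    ≡⟨ +-comm (binom (e + suc r) r) _ ⟩
  binom (e + suc r) (suc r) + binom (e + suc r) r
    ≤⟨ +-mono-≤ (binom-≤^ (suc r) e) (subst (λ k → binom k r ≤ k ^ suc e) (sym (+-suc e r)) (binom-≤^ r (suc e))) ⟩
  suc k * k ^ e ≤⟨ *-monoʳ-≤ (suc k) (^-monoˡ-≤ e (n≤1+n k)) ⟩
  suc k ^ suc e ∎
  where
  open ≤-Reasoning
  k : ℕ
  k = e + suc r

-- The two leading terms of the binomial expansion.
bernoulli : ∀ k r → suc r * k ^ r + k ^ suc r ≤ suc k ^ suc r
bernoulli k zero    = ≤-reflexive (lemma k)
  where
  lemma : ∀ k → 1 * 1 + k * 1 ≡ suc k * 1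
  lemma = solve-∀
bernoulli k (suc r) = begin
  suc (suc r) * (k * k ^ r) + k * (k * k ^ r)                     ≤⟨ m≤m+n _ (suc r * k ^ r) ⟩
  suc (suc r) * (k * k ^ r) + k * (k * k ^ r) + suc r * k ^ r     ≡⟨ lemma k r (k ^ r) ⟩
  suc k * (suc r * k ^ r + k * k ^ r)                             ≤⟨ *-monoʳ-≤ (suc k) (bernoulli k r) ⟩
  suc k ^ suc (suc r)                                             ∎
  where
  open ≤-Reasoning
  lemma : ∀ k r x → suc (suc r) * (k * x) + k * (k * x) + suc r * x ≡ suc k * (suc r * x + k * x)
  lemma = solve-∀

binom-! : ∀ k r → binom k r * r ! ≤ k ^ r
binom-! k       zero    = ≤-refl
binom-! zero    (suc r) = z≤n
binom-! (suc k) (suc r) = begin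
  (binom k r + binom k (suc r)) * (suc r * r !)             ≡⟨ lemma (binom k r) (binom k (suc r)) (suc r) (r !) ⟩
  suc r * (binom k r * r !) + binom k (suc r) * (suc r * r !) ≤⟨ +-mono-≤ (*-monoʳ-≤ (suc r) (binom-! k r)) (binom-! k (suc r)) ⟩
  suc r * k ^ r + k ^ suc r                                 ≤⟨ bernoulli k r ⟩
  suc k ^ suc r                                             ∎
  where
  open ≤-Reasoning
  lemma : ∀ a b c d → (a + b) * (c * d) ≡ c * (a * d) + b * (c * d)
  lemma = solve-∀

1≤! : ∀ n → 1 ≤ n !
1≤! zero    = ≤-refl
1≤! (suc n) = *-mono-≤ {1} {suc n} (s≤s z≤n) (1≤! n)

-- The `v` largest factors of the factorial all exceed `u`.
^-≤-! : ∀ u v → u ^ v ≤ (v + u) !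
^-≤-! u zero    = 1≤! u
^-≤-! u (suc v) = *-mono-≤ (≤-trans (m≤n+m u v) (n≤1+n (v + u))) (^-≤-! u v)

-- A geometric series in natural numbers: `y` is doubled at each step in place of halving the bound.
-- `φ` is general because the recursion of `applyUpTo` shifts the index function.
sum-halving : ∀ s (y : ℕ → ℕ) B (φ : ℕ → ℕ) → (∀ i → i < s → 2 ^ suc i * y (φ i) ≤ B) → sumOf y (applyUpTo φ s) ≤ B
sum-halving zero    y B φ l = z≤n
sum-halving (suc s) y B φ l = *-cancelˡ-≤ 2 (begin
  2 * (y (φ 0) + sumOf y (applyUpTo (λ i → φ (suc i)) s))               ≡⟨ *-distribˡ-+ 2 (y (φ 0)) _ ⟩
  2 * y (φ 0) + 2 * sumOf y (applyUpTo (λ i → φ (suc i)) s)             ≡⟨ cong (2 * y (φ 0) +_) (sumOf-* 2 y (applyUpTo (λ i → φ (suc i)) s)) ⟨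
  2 * y (φ 0) + sumOf (λ x → 2 * y x) (applyUpTo (λ i → φ (suc i)) s)
    ≤⟨ +-mono-≤ (l 0 (s≤s z≤n)) (sum-halving s (λ x → 2 * y x) B (λ i → φ (suc i))
         (λ i i<s → ≤-trans (≤-reflexive (lemma (2 ^ i) (y (φ (suc i))))) (l (suc i) (s≤s i<s)))) ⟩
  B + B                                                                 ≡⟨ cong (B +_) (+-identityʳ B) ⟨
  2 * B                                                                 ∎)
  where
  open ≤-Reasoning
  lemma : ∀ p y → 2 * p * (2 * y) ≡ 2 * (2 * p) * y
  lemma = solve-∀

-- Numerical estimates from the growth factor R

module Estimates (β : ℕ → ℕ) (β-positive : ∀ m → 1 ≤ β m) {n t s R d : ℕ}
  (ratio : ∀ j → n ≤ j + (t + s) → R * β j ≤ β (suc j))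
  (fits : t + (s + s) ≤ n)
  (t+2≤s : s ≡ t + 2 + d)
  (small : 4 * (t + (s + s)) ≤ R)
  (tail : n ^ s < s ! * R ^ d)
  where

  open ≤-Reasoning

  ts≤n : t + s ≤ n
  ts≤n = ≤-trans (+-monoʳ-≤ t (m≤m+n s s)) fits

  -- Multiplies `e` consecutive ratios; `b + e ≤ t + s` keeps all indices in the range where `ratio`
  -- applies.
  descend : ∀ e b → b + e ≤ t + s → R ^ e * β (n ∸ (b + e)) ≤ β (n ∸ b)
  descend zero    b l = ≤-reflexive (trans (+-identityʳ _) (cong (λ z → β (n ∸ z)) (+-identityʳ b)))
  descend (suc e) b l = begin
    R * R ^ e * β (n ∸ (b + suc e))    ≡⟨ lemma R (R ^ e) _ ⟩
    R ^ e * (R * β (n ∸ (b + suc e)))  ≤⟨ *-monoʳ-≤ (R ^ e) (ratio (n ∸ (b + suc e)) above) ⟩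
    R ^ e * β (suc (n ∸ (b + suc e)))  ≡⟨ cong (λ z → R ^ e * β z) step ⟩
    R ^ e * β (n ∸ (b + e))            ≤⟨ descend e b (≤-trans (+-monoʳ-≤ b (n≤1+n e)) l) ⟩
    β (n ∸ b)                          ∎
    where
    lemma : ∀ r p x → r * p * x ≡ p * (r * x)
    lemma = solve-∀
    above : n ≤ (n ∸ (b + suc e)) + (t + s)
    above = ≤-trans (≤-reflexive (sym (m∸n+n≡m (≤-trans l ts≤n)))) (+-monoʳ-≤ (n ∸ (b + suc e)) l)
    step : suc (n ∸ (b + suc e)) ≡ n ∸ (b + e)
    step = trans (sym (+-∸-assoc 1 (≤-trans l ts≤n))) (cong (suc n ∸_) (+-suc b e))

  2+t≤s : t + 2 ≤ s
  2+t≤s = ≤-trans (m≤m+n (t + 2) d) (≤-reflexive (sym t+2≤s))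

  1≤s : 1 ≤ s
  1≤s = ≤-trans (≤-trans (s≤s z≤n) (m≤n+m 2 t)) 2+t≤s

  8s≤R : 8 * s ≤ R
  8s≤R = ≤-trans (≤-trans (m≤n+m (8 * s) (4 * t)) (≤-reflexive (lemma t s))) small
    where
    lemma : ∀ t s → 4 * t + 8 * s ≡ 4 * (t + (s + s))
    lemma = solve-∀

  8≤R : 8 ≤ R
  8≤R = ≤-trans (*-monoʳ-≤ 8 1≤s) 8s≤R

  one-step : R * β (n ∸ (t + 1)) ≤ β (n ∸ t)
  one-step = ≤-trans (*-monoˡ-≤ (β (n ∸ (t + 1))) (≤-reflexive (sym (*-identityʳ R)))) (descend 1 t (+-monoʳ-≤ t 1≤s))

  two-steps : R * β (n ∸ (t + 2)) ≤ β (n ∸ t)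
  two-steps = ≤-trans (*-monoˡ-≤ (β (n ∸ (t + 2))) (≤-trans (≤-reflexive (sym (*-identityʳ R)))
    (*-monoʳ-≤ R (≤-trans (≤-trans (s≤s z≤n) 8≤R) (≤-reflexive (sym (*-identityʳ R)))))))
    (descend 2 t (≤-trans 2+t≤s (m≤n+m s t)))

  binom-tail : binom n s < R ^ d
  binom-tail = *-cancelʳ-< (s !) (binom n s) (R ^ d) (≤-<-trans (binom-! n s) (<-≤-trans tail (≤-reflexive (*-comm (s !) (R ^ d)))))

  -- There are fewer than `R ^ d` choices of `s` singletons, and the descent from n - t - 2 to n - s
  -- gains exactly `R ^ d`, as d = s - t - 2.
  tail-bound : binom n s * β (n ∸ s) < β (n ∸ t ∸ 2)
  tail-bound = begin-strict
    binom n s * β (n ∸ s)       <⟨ *-monoˡ-< (β (n ∸ s)) {{>-nonZero (β-positive (n ∸ s))}} binom-tail ⟩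
    R ^ d * β (n ∸ s)           ≡⟨ cong (λ z → R ^ d * β (n ∸ z)) t+2≤s ⟩
    R ^ d * β (n ∸ (t + 2 + d)) ≤⟨ descend d (t + 2) (≤-trans (≤-reflexive (sym t+2≤s)) (m≤n+m s t)) ⟩
    β (n ∸ (t + 2))             ≡⟨ cong β (∸-+-assoc n t 2) ⟨
    β (n ∸ t ∸ 2)               ∎

  term : ℕ → ℕ
  term i = binom (t + (suc i + suc i)) (t + suc i) * β (n ∸ (t + suc i))

  -- The coefficient is at most `N ^ e` and `4 * N ≤ R`, so a factor `4 ^ e` is to spare: `2 ^ e`
  -- for the geometric series and at least 2 to keep the whole sum at most half of `β (n ∸ t)`.
  term-bound : ∀ i → i < s → 2 ^ suc i * (2 * term i) ≤ β (n ∸ t)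
  term-bound i i<s = begin
    2 ^ e * (2 * (binom (t + (e + e)) (t + e) * β (n ∸ (t + e))))
      ≡⟨ cong (λ z → 2 ^ e * (2 * (binom z (t + e) * β (n ∸ (t + e))))) (shuffle t e) ⟩
    2 ^ e * (2 * (binom (e + (t + e)) (t + e) * β (n ∸ (t + e))))
      ≤⟨ *-monoʳ-≤ (2 ^ e) (*-monoʳ-≤ 2 (*-monoˡ-≤ (β (n ∸ (t + e))) (≤-trans (binom-≤^ (t + e) e) (^-monoˡ-≤ e wide)))) ⟩
    2 ^ e * (2 * (N ^ e * β (n ∸ (t + e))))
      ≤⟨ *-monoʳ-≤ (2 ^ e) (*-monoˡ-≤ (N ^ e * β (n ∸ (t + e))) (≤-trans (≤-reflexive (sym (*-identityʳ 2))) (*-monoʳ-≤ 2 (1≤m^n i (s≤s z≤n))))) ⟩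
    2 ^ e * (2 ^ e * (N ^ e * β (n ∸ (t + e))))
      ≡⟨ regroup (2 ^ e) (N ^ e) (β (n ∸ (t + e))) ⟩
    2 ^ e * 2 ^ e * N ^ e * β (n ∸ (t + e))
      ≡⟨ cong (_* β (n ∸ (t + e))) (trans (cong (_* N ^ e) (sym (^-distribʳ-* e 2 2))) (sym (^-distribʳ-* e 4 N))) ⟩
    (4 * N) ^ e * β (n ∸ (t + e))
      ≤⟨ *-monoˡ-≤ (β (n ∸ (t + e))) (^-monoˡ-≤ e small) ⟩
    R ^ e * β (n ∸ (t + e))
      ≤⟨ descend e t (+-monoʳ-≤ t i<s) ⟩
    β (n ∸ t) ∎
    where
    e N : ℕ
    e = suc i
    N = t + (s + s)
    shuffle : ∀ t e → t + (e + e) ≡ e + (t + e)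
    shuffle = solve-∀
    regroup : ∀ a b c → a * (a * (b * c)) ≡ a * a * b * c
    regroup = solve-∀
    wide : e + (t + e) ≤ N
    wide = ≤-trans (≤-reflexive (sym (shuffle t e))) (+-monoʳ-≤ t (+-mono-≤ i<s i<s))
    ^-distribʳ-* : ∀ e x y → (x * y) ^ e ≡ x ^ e * y ^ e
    ^-distribʳ-* zero    x y = refl
    ^-distribʳ-* (suc e) x y = trans (cong (x * y *_) (^-distribʳ-* e x y)) (inter x y (x ^ e) (y ^ e))
      where
      inter : ∀ a b c d → a * b * (c * d) ≡ a * c * (b * d)
      inter = solve-∀

  walk-bound : 2 * sumOf term (upTo s) ≤ β (n ∸ t)
  walk-bound = ≤-trans (≤-reflexive (sym (sumOf-* 2 term (upTo s))))
    (sum-halving s (λ i → 2 * term i) (β (n ∸ t)) (λ i → i) term-bound)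

  total-bound : s * β (n ∸ (t + 1)) + (binom n s * β (n ∸ s) + sumOf term (upTo s)) < β (n ∸ t)
  -- The three summands are at most an eighth, an eighth and a half of `β (n ∸ t)`.
  total-bound = *-cancelˡ-< 8 _ _ (begin-strict
    8 * (s * β (n ∸ (t + 1)) + (x + W))     ≡⟨ expand s (β (n ∸ (t + 1))) x W ⟩
    8 * s * β (n ∸ (t + 1)) + 8 * x + 4 * (2 * W)
      ≤⟨ +-mono-≤ (+-mono-≤ (≤-trans (*-monoˡ-≤ (β (n ∸ (t + 1))) 8s≤R) one-step) tail8) (*-monoʳ-≤ 4 walk-bound) ⟩
    b₀ + b₀ + 4 * b₀                              ≡⟨ collect b₀ ⟩
    6 * b₀                                      <⟨ *-monoˡ-< b₀ {{>-nonZero (β-positive (n ∸ t))}} {6} {8} (s≤s (s≤s (s≤s (s≤s (s≤s (s≤s (s≤s z≤n))))))) ⟩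
    8 * b₀                                      ∎)
    where
    x W b₀ : ℕ
    x = binom n s * β (n ∸ s)
    W = sumOf term (upTo s)
    b₀ = β (n ∸ t)
    expand : ∀ s b x w → 8 * (s * b + (x + w)) ≡ 8 * s * b + 8 * x + 4 * (2 * w)
    expand = solve-∀
    collect : ∀ b → b + b + 4 * b ≡ 6 * b
    collect = solve-∀
    tail8 : 8 * x ≤ b₀
    tail8 = ≤-trans (*-mono-≤ 8≤R (≤-trans (<⇒≤ tail-bound) (≤-reflexive (cong β (∸-+-assoc n t 2))))) two-steps

-- At most (2 R) ^ j partitions of [j] have fewer than 2 R blocks, which is at most half
-- of Bell j ≥ K ^ (j ∸ K); each of the others extends to at least 2 R partitions of [j + 1].
growth : ∀ (β : ℕ → ℕ) → (∀ K j → K ^ j ≤ β (j + K)) → (∀ r j → r * β j ≤ β (suc j) + r * r ^ j) →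
         ∀ m {n c} → (m + 12) * 2 ^ (m + 12) ≤ n → c ≤ 2 ^ (m + 12) →
         ∀ j → n ≤ j + c → 2 ^ (m + 8) * β j ≤ β (suc j)
growth β β-lower β-suc m {n} {c} n≥ c≤ j j≥ = +-cancelʳ-≤ (R * β j) _ _ (begin
  R * β j + R * β j                         ≡⟨ twice R (β j) ⟩
  2 * R * β j                                  ≤⟨ β-suc (2 * R) j ⟩
  β (suc j) + 2 * R * (2 * R) ^ j              ≤⟨ +-monoʳ-≤ (β (suc j)) (≤-trans (≤-reflexive (rotate R ((2 * R) ^ j))) (*-monoʳ-≤ R many)) ⟩
  β (suc j) + R * β j                       ∎)
  where
  open ≤-Reasoning
  R K i : ℕ
  R = 2 ^ (m + 8)
  K = 2 ^ (m + 12)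
  i = j ∸ K
  twice : ∀ r b → r * b + r * b ≡ 2 * r * b
  twice = solve-∀
  rotate : ∀ r x → 2 * r * x ≡ r * (2 * x)
  rotate = solve-∀
  -- Of the m + 12 multiples of `K` in `n`, one is lost to `c` and one is set aside for the `K`
  -- starting points of `β-lower`.
  j-large : (m + 10) * K + K ≤ j
  j-large = +-cancelʳ-≤ K _ _ (≤-trans (≤-reflexive (fold m K)) (≤-trans n≥ (≤-trans j≥ (+-monoʳ-≤ j c≤))))
    where
    fold : ∀ m k → (m + 10) * k + k + k ≡ (m + 12) * k
    fold = solve-∀
  j≡ : j ≡ i + K
  j≡ = sym (m∸n+n≡m (≤-trans (m≤n+m K ((m + 10) * K)) j-large))
  i-large : (m + 10) * K ≤ i
  i-large = +-cancelʳ-≤ K _ _ (≤-trans j-large (≤-reflexive j≡))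
  -- `K` is 8 times `2 * R`. Already a factor 2 for each of the `i ≥ (m + 10) * K` points pays for
  -- the `K` points that are missing in the exponent of `K ^ i`.
  exponent : 1 + (suc (m + 8)) * j ≤ (m + 12) * i
  exponent = begin
    1 + (suc (m + 8)) * j               ≡⟨ cong (λ z → 1 + (suc (m + 8)) * z) j≡ ⟩
    1 + (suc (m + 8)) * (i + K)         ≤⟨ +-monoˡ-≤ (suc (m + 8) * (i + K)) (1≤m^n (m + 12) (s≤s z≤n)) ⟩
    K + (suc (m + 8)) * (i + K)         ≡⟨ split m i K ⟩
    (suc (m + 8)) * i + (m + 10) * K    ≤⟨ +-monoʳ-≤ (suc (m + 8) * i) i-large ⟩
    (suc (m + 8)) * i + i               ≤⟨ m≤m+n _ (i + i) ⟩
    (suc (m + 8)) * i + i + (i + i)     ≡⟨ merge m i ⟩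
    (m + 12) * i                  ∎
    where
    split : ∀ m i k → k + (suc (m + 8)) * (i + k) ≡ (suc (m + 8)) * i + (m + 10) * k
    split = solve-∀
    merge : ∀ m i → (suc (m + 8)) * i + i + (i + i) ≡ (m + 12) * i
    merge = solve-∀
  many : 2 * (2 * R) ^ j ≤ β j
  many = begin
    2 * (2 ^ (suc (m + 8))) ^ j    ≡⟨ cong (2 *_) (^-*-assoc 2 (suc (m + 8)) j) ⟩
    2 ^ (1 + (suc (m + 8)) * j)    ≤⟨ ^-monoʳ-≤ 2 exponent ⟩
    2 ^ ((m + 12) * i)       ≡⟨ ^-*-assoc 2 (m + 12) i ⟨
    K ^ i                    ≤⟨ β-lower K i ⟩
    β (i + K)             ≡⟨ cong β j≡ ⟨
    β j                   ∎

false-if : ∀ {b c} → (b ≡ true → c ≡ true) → c ≡ false → b ≡ false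
false-if h e = ¬true⇒false (λ t → conflict (h t) e)

-- Splitting

splitRel : Fin n → BlockMap n → Fin n → Fin n → Bool
splitRel i P x y = does (x ≟ y) ∨ (not (does (x ≟ i)) ∧ (not (does (y ≟ i)) ∧ rel P x y))

split : Fin n → BlockMap n → BlockMap n
split i P = matrix (splitRel i P)

glueMap : Fin n → Fin n → Fin n → Fin n
glueMap i j x = if does (x ≟ i) then j else x

-- Takes a partition with `i` alone to one in which `i` and `j` share a block, undoing `split i`.
glue : Fin n → Fin n → BlockMap n → BlockMap n
glue i j = pull (glueMap i j)

glueMap-i : ∀ (i j : Fin n) → glueMap i j i ≡ j
glueMap-i i j = cong (if_then j else i) (dec-true (i ≟ i) refl)

glueMap-other : ∀ {i j x : Fin n} → x ≢ i → glueMap i j x ≡ x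
glueMap-other {i = i} {j} {x} ne = cong (if_then j else x) (dec-false (x ≟ i) ne)

module _ {i : Fin n} {P : BlockMap n} (p : Partition P) where

  rel-split : ∀ {x y} → x ≢ i → y ≢ i → rel (split i P) x y ≡ rel P x y
  rel-split {x} {y} x≢i y≢i = trans (rel-matrix _ x y) compute
    where
    compute : splitRel i P x y ≡ rel P x y
    compute rewrite dec-false (x ≟ i) x≢i | dec-false (y ≟ i) y≢i with x ≟ y
    ... | yes refl = sym (rel-refl p x)
    ... | no _     = refl

  rel-split-left : ∀ {y} → rel (split i P) i y ≡ true → y ≡ i
  rel-split-left {y} e with i ≟ y
  ... | yes eq = sym eq
  ... | no ne  = conflict (trans (sym (rel-matrix (splitRel i P) i y)) e) compute
    where
    compute : splitRel i P i y ≡ false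
    compute rewrite dec-false (i ≟ y) ne | dec-true (i ≟ i) refl = refl

  rel-split-right : ∀ {x} → rel (split i P) x i ≡ true → x ≡ i
  rel-split-right {x} e with x ≟ i
  ... | yes eq = eq
  ... | no ne  = conflict (trans (sym (rel-matrix (splitRel i P) x i)) e) compute
    where
    compute : splitRel i P x i ≡ false
    compute rewrite dec-false (x ≟ i) ne | dec-true (i ≟ i) refl = refl

  rel-split-refl : ∀ x → rel (split i P) x x ≡ true
  rel-split-refl x = trans (rel-matrix _ x x) (∨-introˡ (dec-true (x ≟ x) refl))

  split-partition : Partition (split i P)
  split-partition = equiv⇒partition (record
    { reflᵣ = rel-split-refl
    ; symᵣ = λ x y e → symm x y (x ≟ i) (y ≟ i) e
    ; transᵣ = λ x y z e f → tran x y z (x ≟ i) (y ≟ i) (z ≟ i) e f })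
    where
    S : Fin n → Fin n → Bool
    S = rel (split i P)
    symm : ∀ x y → Dec (x ≡ i) → Dec (y ≡ i) → S x y ≡ true → S y x ≡ true
    symm x y (yes refl) _ e = subst (λ w → S w x ≡ true) (sym (rel-split-left e)) (rel-split-refl x)
    symm x y (no _) (yes refl) e = subst (λ w → S y w ≡ true) (sym (rel-split-right e)) (rel-split-refl y)
    symm x y (no a) (no b) e = trans (rel-split b a) (rel-sym p (trans (sym (rel-split a b)) e))
    tran : ∀ x y z → Dec (x ≡ i) → Dec (y ≡ i) → Dec (z ≡ i) → S x y ≡ true → S y z ≡ true → S x z ≡ true
    tran x y z (yes refl) _ _ e f = subst (λ w → S w z ≡ true) (rel-split-left e) f
    tran x y z (no _) (yes refl) _ e f = subst (λ w → S w z ≡ true) (sym (rel-split-right e)) f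
    tran x y z (no _) (no _) (yes refl) e f = subst (λ w → S x w ≡ true) (rel-split-right f) e
    tran x y z (no a) (no b) (no c) e f = trans (rel-split a c)
      (rel-trans p (trans (sym (rel-split a b)) e) (trans (sym (rel-split b c)) f))

  single-split : single (split i P) i ≡ true
  single-split = single-intro split-partition (λ _ → rel-split-left)

  split-away : ∀ {x} → rel P x i ≡ false → ∀ z → rel (split i P) x z ≡ rel P x z
  split-away {x} e z with z ≟ i
  ... | no z≢i   = rel-split (λ { refl → conflict (rel-refl p x) e }) z≢i
  ... | yes refl = trans (¬true⇒false (λ t → conflict (trans (cong (λ w → rel P w z) (rel-split-right t)) (rel-refl p z)) e)) (sym e)

module _ {i j : Fin n} {P : BlockMap n} (p : Partition P) (i≢j : i ≢ j) where

  rel-glue : ∀ {x y} → x ≢ i → y ≢ i → rel (glue i j P) x y ≡ rel P x y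
  rel-glue {x} {y} a b = trans (rel-pull (glueMap i j) P x y) (cong₂ (rel P) (glueMap-other a) (glueMap-other b))

  rel-glue-ij : rel (glue i j P) i j ≡ true
  rel-glue-ij = trans (rel-pull (glueMap i j) P i j)
    (trans (cong₂ (rel P) (glueMap-i i j) (glueMap-other (λ e → i≢j (sym e)))) (rel-refl p j))

  glue-split : rel P i j ≡ true → glue i j (split i P) ≡ P
  glue-split e = rel-ext (λ x y → trans (rel-pull (glueMap i j) (split i P) x y)
    (trans (rel-split p (avoids x) (avoids y)) (iff⇒≡
      (λ h → rel-trans p (moves x) (rel-trans p h (rel-sym p (moves y))))
      (λ h → rel-trans p (rel-sym p (moves x)) (rel-trans p h (moves y))))))
    where
    avoids : ∀ x → glueMap i j x ≢ i
    avoids x with x ≟ i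
    ... | yes _ = λ eq → i≢j (sym eq)
    ... | no ne = ne
    moves : ∀ x → rel P x (glueMap i j x) ≡ true
    moves x with x ≟ i
    ... | yes refl = e
    ... | no _     = rel-refl p x

  split-glue : single P i ≡ true → split i (glue i j P) ≡ P
  split-glue s = rel-ext (λ x y → entry x y (x ≟ i) (y ≟ i))
    where
    g : Partition (glue i j P)
    g = pull-partition (glueMap i j) p
    left : ∀ y → rel (split i (glue i j P)) i y ≡ rel P i y
    left y = iff⇒≡ (λ e → subst (λ w → rel P i w ≡ true) (sym (rel-split-left g e)) (rel-refl p i))
                   (λ e → subst (λ w → rel (split i (glue i j P)) i w ≡ true) (sym (single⇒≡ s e)) (rel-split-refl g i))
    entry : ∀ x y → Dec (x ≡ i) → Dec (y ≡ i) → rel (split i (glue i j P)) x y ≡ rel P x y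
    entry x y (yes refl) _ = left y
    entry x y (no _) (yes refl) = trans (rel-comm (split-partition g) x y) (trans (left x) (rel-comm p y x))
    entry x y (no a) (no b) = trans (rel-split g a b) (rel-glue a b)

single-rows : ∀ {P Q : BlockMap n} {x} → Partition Q → (∀ z → rel P x z ≡ rel Q x z) → single P x ≡ true → single Q x ≡ true
single-rows q same s = single-intro q (λ y e → single⇒≡ s (trans (same y) e))

record Intersecting (t : ℕ) (P Q : BlockMap n) : Set where
  field
    shared   : Fin t → Fin n
    distinct : ∀ {k l} → rel P (shared k) (shared l) ≡ true → k ≡ l
    same     : ∀ k z → rel P (shared k) z ≡ rel Q (shared k) z
open Intersecting

intersecting-sym : ∀ {t} {P Q : BlockMap n} → Intersecting t P Q → Intersecting t Q P
intersecting-sym I = record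
  { shared = shared I
  ; distinct = λ {k} {l} e → distinct I (trans (same I k (shared I l)) e)
  ; same = λ k z → sym (same I k z) }

shared-injective : ∀ {t} {P Q : BlockMap n} → Partition P → (I : Intersecting t P Q) → ∀ {k l} → shared I k ≡ shared I l → k ≡ l
shared-injective {P = P} p I {k} e = distinct I (subst (λ w → rel P (shared I k) w ≡ true) e (rel-refl p (shared I k)))

-- In contrast to `TIntersectingFamily`, the diagonal P = Q is included, so each member has at least
-- `t` blocks.
IntersectingFamily : ℕ → (BlockMap n → Bool) → Set
IntersectingFamily t f = ∀ {P Q} → Partition P → Partition Q → f P ≡ true → f Q ≡ true → Intersecting t P Q

module Splitting (n : ℕ) where

  -- Pairs the partitions in which `i` and `j` share a block with those in which `i` is alone, and
  -- fixes all others. Isolating `i` increases the number of singletons, which is the rank.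
  move : Fin n × Fin n → BlockMap n → BlockMap n
  move (i , j) P = if does (i ≟ j) then P else (if rel P i j then split i P else (if single P i then glue i j P else P))

  isolated : Fin n × Fin n → BlockMap n → Bool
  isolated (i , j) P = not (does (i ≟ j)) ∧ single P i

  isolated⁺ : ∀ {i j : Fin n} {P : BlockMap n} → i ≢ j → single P i ≡ true → isolated (i , j) P ≡ true
  isolated⁺ {i} {j} ne s = ∧-intro (cong not (dec-false (i ≟ j) ne)) s

  isolated⁻ : ∀ {i j : Fin n} {P : BlockMap n} → isolated (i , j) P ≡ true → i ≢ j × single P i ≡ true
  isolated⁻ {i} {j} e = (λ eq → conflict (∧-elimˡ e) (cong not (dec-true (i ≟ j) eq))) , ∧-elimʳ {not (does (i ≟ j))} e

  single-unrelated : ∀ {i j : Fin n} {P : BlockMap n} → i ≢ j → single P i ≡ true → rel P i j ≡ false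
  single-unrelated ne s = ¬true⇒false (λ e → ne (sym (single⇒≡ s e)))

  move-split : ∀ {i j : Fin n} {P : BlockMap n} → i ≢ j → rel P i j ≡ true → move (i , j) P ≡ split i P
  move-split {i} {j} ne e rewrite dec-false (i ≟ j) ne | e = refl

  move-glue : ∀ {i j : Fin n} {P : BlockMap n} → i ≢ j → single P i ≡ true → move (i , j) P ≡ glue i j P
  move-glue {i} {j} {P} ne s rewrite dec-false (i ≟ j) ne | single-unrelated {i} {j} {P} ne s | s = refl

  data Move (i j : Fin n) (P : BlockMap n) : Set where
    splits : i ≢ j → rel P i j ≡ true → move (i , j) P ≡ split i P → Move i j P
    glues  : i ≢ j → single P i ≡ true → move (i , j) P ≡ glue i j P → Move i j P
    stays  : isolated (i , j) P ≡ false → move (i , j) P ≡ P → Move i j P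

  view : ∀ i j P → Move i j P
  view i j P with true-or-false (does (i ≟ j)) | true-or-false (rel P i j) | true-or-false (single P i)
  ... | inj₁ e | _ | _ = stays (cong (λ b → not b ∧ single P i) e) trivial
    where
    trivial : move (i , j) P ≡ P
    trivial rewrite e = refl
  ... | inj₂ e | inj₁ r | _ = splits ne r (move-split {i} {j} {P} ne r)
    where
    ne : i ≢ j
    ne eq = conflict (dec-true (i ≟ j) eq) e
  ... | inj₂ e | inj₂ r | inj₁ s = glues ne s (move-glue {i} {j} {P} ne s)
    where
    ne : i ≢ j
    ne eq = conflict (dec-true (i ≟ j) eq) e
  ... | inj₂ e | inj₂ r | inj₂ s = stays (trans (cong (λ b → not (does (i ≟ j)) ∧ b) s) (false-∧ (not (does (i ≟ j))))) unmoved
    where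
    false-∧ : ∀ b → b ∧ false ≡ false
    false-∧ true  = refl
    false-∧ false = refl
    unmoved : move (i , j) P ≡ P
    unmoved rewrite e | r | s = refl

  move-partition : ∀ k {P} → Partition P → Partition (move k P)
  move-partition (i , j) {P} p with view i j P
  ... | splits _ _ e = subst Partition (sym e) (split-partition p)
  ... | glues _ _ e  = subst Partition (sym e) (pull-partition (glueMap i j) p)
  ... | stays _ e    = subst Partition (sym e) p

  move-involutive : ∀ k {P} → Partition P → move k (move k P) ≡ P
  move-involutive k@(i , j) {P} p with view i j P
  ... | splits ne r e = trans (cong (move k) e) (trans (move-glue {i} {j} {split i P} ne (single-split p)) (glue-split p ne r))
  ... | glues ne s e  = trans (cong (move k) e) (trans (move-split {i} {j} {glue i j P} ne (rel-glue-ij p ne)) (split-glue p ne s))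
  ... | stays _ e     = trans (cong (move k) e) e

  isolated-flips : ∀ k {P} → Partition P → isolated k P ≡ true → isolated k (move k P) ≡ false
  isolated-flips (i , j) {P} p u with isolated⁻ {i} {j} {P} u
  ... | ne , s = ¬true⇒false (λ v → ne (sym (single⇒≡ (subst (λ Q → single Q i ≡ true) (move-glue {i} {j} {P} ne s)
                   (proj₂ (isolated⁻ {i} {j} {move (i , j) P} v))) (rel-glue-ij p ne))))

  isolated-size : ∀ k {P} → Partition P → isolated k P ≡ true → size (move k P) < size P
  isolated-size (i , j) {P} p u with isolated⁻ {i} {j} {P} u
  ... | ne , s rewrite move-glue {i} {j} {P} ne s =
    sumOf-strict {xs = elements n} (λ {x} _ → b2n-mono (smaller x)) (∈-elements i) strict
    where
    smaller : ∀ x → single (glue i j P) x ≡ true → single P x ≡ true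
    smaller x h with x ≟ i
    ... | yes refl = s
    ... | no x≢i = single-intro p (λ y e → single⇒≡ h
            (trans (rel-glue p ne x≢i (λ { refl → x≢i (single⇒≡ s (rel-sym p e)) })) e))
    strict : b2n (single (glue i j P) i) < b2n (single P i)
    strict rewrite s | ¬single⇒≢ (rel-glue-ij p ne) (λ e → ne (sym e)) = ≤-refl

  open Compression (pairs n) ∈-pairs move isolated size move-partition move-involutive isolated-flips isolated-size public

  -- A representative `i` of a common block is replaced by `j`, which represents what remains of
  -- that block after the split.
  split-both : ∀ {t i j} {P Q : BlockMap n} → Partition P → Partition Q → i ≢ j → rel P i j ≡ true → rel Q i j ≡ true →
               Intersecting t P Q → Intersecting t (split i P) (split i Q)
  split-both {t} {i} {j} {P} {Q} p q ne rP rQ I = record { shared = g ; distinct = dist ; same = sam }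
    where
    g : Fin t → Fin n
    g k = glueMap i j (shared I k)
    avoids : ∀ k → g k ≢ i
    avoids k with shared I k ≟ i
    ... | yes _ = λ e → ne (sym e)
    ... | no ne = ne
    moves : ∀ k → rel P (shared I k) (g k) ≡ true
    moves k with shared I k ≟ i
    ... | yes e = subst (λ w → rel P w j ≡ true) (sym e) rP
    ... | no _  = rel-refl p _
    dist : ∀ {k l} → rel (split i P) (g k) (g l) ≡ true → k ≡ l
    dist {k} {l} e = distinct I (rel-trans p (moves k)
      (rel-trans p (trans (sym (rel-split p (avoids k) (avoids l))) e) (rel-sym p (moves l))))
    sameRow : ∀ k z → rel P (g k) z ≡ rel Q (g k) z
    sameRow k z = trans (rel-rows {P = P} {P} (rel⇒row≡ p (moves k)) z)
      (trans (same I k z) (sym (rel-rows {P = Q} {Q} (rel⇒row≡ q (trans (sym (same I k (g k))) (moves k))) z)))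
    sam : ∀ k z → rel (split i P) (g k) z ≡ rel (split i Q) (g k) z
    sam k z with z ≟ i
    ... | no z≢i   = trans (rel-split p (avoids k) z≢i) (trans (sameRow k z) (sym (rel-split q (avoids k) z≢i)))
    ... | yes refl = trans (¬true⇒false (λ e → avoids k (rel-split-right p e)))
                       (sym (¬true⇒false (λ e → avoids k (rel-split-right q e))))

  -- A block of P that contains i contains j, so it is not a block of Q.
  avoids-i : ∀ {t i j} {P Q : BlockMap n} → Partition P → Partition Q → rel P i j ≡ true → rel Q i j ≡ false →
             (I : Intersecting t P Q) → ∀ k → rel P (shared I k) i ≡ false
  avoids-i {i = i} {j} p q rP rQ I k = ¬true⇒false (λ e → conflict
    (rel-trans q (rel-sym q (trans (sym (same I k i)) e)) (trans (sym (same I k j)) (rel-trans p e rP))) rQ)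

  split-one : ∀ {t i j} {P Q : BlockMap n} → Partition P → Partition Q → rel P i j ≡ true → rel Q i j ≡ false →
              Intersecting t P Q → Intersecting t (split i P) Q
  split-one {i = i} p q rP rQ I = record
    { shared = shared I
    ; distinct = λ {k} {l} e → distinct I (trans (sym (split-away p (away k) (shared I l))) e)
    ; same = λ k z → trans (split-away p (away k) z) (same I k z) }
    where
    away : ∀ k → rel _ (shared I k) i ≡ false
    away = avoids-i p q rP rQ I

  -- A block common to `P` and `split i Q` avoids `i` in `P`, as `i` and `j` are together in one
  -- partition and apart in the other. Hence it avoids `j` too, and is a block of `Q` that the split
  -- left untouched.
  exchange : ∀ {t i j} {P Q : BlockMap n} → Partition P → Partition Q → i ≢ j → rel P i j ≡ true → rel Q i j ≡ true →
             Intersecting t P (split i Q) → Intersecting t (split i P) Q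
  exchange {i = i} {j} {P} {Q} p q ne rP rQ I = record
    { shared = shared I
    ; distinct = distinct J
    ; same = λ k z → trans (same J k z) (split-away q (away k) z) }
    where
    s : Partition (split i Q)
    s = split-partition q
    unrelated : rel (split i Q) i j ≡ false
    unrelated = single-unrelated {i} {j} {split i Q} ne (single-split q)
    J : Intersecting _ (split i P) (split i Q)
    J = split-one p s rP unrelated I
    away : ∀ k → rel Q (shared I k) i ≡ false
    away k = ¬true⇒false (λ e → conflict
      (trans (same I k j) (trans (rel-split q g≢i (λ e → ne (sym e))) (rel-trans q e rQ)))
      (false-if (λ h → rel-trans p h (rel-sym p rP)) gi))
      where
      gi : rel P (shared I k) i ≡ false
      gi = avoids-i p s rP unrelated I k
      g≢i : shared I k ≢ i
      g≢i eq = conflict (subst (λ w → rel P w i ≡ true) (sym eq) (rel-refl p i)) gi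

  -- In the mixed case `P` arises by splitting `move k P`, while `Q` is old. If `Q` separates `i`
  -- and `j`, the split harms no common block; otherwise `split i Q` belongs to `f` as well, and
  -- `exchange` moves the split from one partition to the other.
  compress-intersecting : ∀ {t f} k → IntersectingFamily t f → IntersectingFamily t (compress k f)
  compress-intersecting {t} {f} k@(i , j) h = go
    where
    module New {P} (p : Partition P) (u : isolated k P ≡ true) where
      ne : i ≢ j
      ne = proj₁ (isolated⁻ {i} {j} {P} u)
      s : single P i ≡ true
      s = proj₂ (isolated⁻ {i} {j} {P} u)
      merged : move k P ≡ glue i j P
      merged = move-glue {i} {j} {P} ne s
      part : Partition (move k P)
      part = move-partition k p
      rl : rel (move k P) i j ≡ true
      rl = subst (λ R → rel R i j ≡ true) (sym merged) (rel-glue-ij p ne)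
      back : split i (move k P) ≡ P
      back = trans (cong (split i) merged) (split-glue p ne s)

    mixed : ∀ {P Q} → Partition P → Partition Q → isolated k P ≡ true → f (move k P) ≡ true → f Q ≡ true →
            (isolated k (move k Q) ≡ true → f (move k Q) ≡ true) → Intersecting t P Q
    mixed {P} {Q} p q u fιP fQ st = subst (λ R → Intersecting t R Q) N.back (by (true-or-false (rel Q i j)))
      where
      module N = New p u
      by : rel Q i j ≡ true ⊎ rel Q i j ≡ false → Intersecting t (split i (move k P)) Q
      by (inj₂ r) = split-one N.part q N.rl r (h N.part q fιP fQ)
      by (inj₁ r) = exchange N.part q N.ne N.rl r (subst (Intersecting t (move k P)) eq
          (h N.part (move-partition k q) fιP (st (isolated⁺ {i} {j} {move k Q} N.ne
            (subst (λ R → single R i ≡ true) (sym eq) (single-split q))))))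
        where
        eq : move k Q ≡ split i Q
        eq = move-split {i} {j} {Q} N.ne r

    go : IntersectingFamily t (compress k f)
    go {P} {Q} p q cP cQ with compress-elim k f p cP | compress-elim k f q cQ
    ... | inj₁ (fP , _)  | inj₁ (fQ , _)  = h p q fP fQ
    ... | inj₂ (u , fιP) | inj₁ (fQ , st) = mixed p q u fιP fQ st
    ... | inj₁ (fP , st) | inj₂ (u , fιQ) = intersecting-sym (mixed q p u fιQ fP st)
    ... | inj₂ (u , fιP) | inj₂ (v , fιQ) =
      subst (λ R → Intersecting t R Q) (New.back p u) (subst (Intersecting t (split i (move k P))) (New.back q v)
        (split-both (New.part p u) (New.part q v) (New.ne p u) (New.rl p u) (New.rl q v) (h (New.part p u) (New.part q v) fιP fιQ)))

  sameBlock? : ∀ (P Q : BlockMap n) x → Dec (∀ z → rel P x z ≡ rel Q x z)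
  sameBlock? P Q x = Finₚ.all? (λ z → rel P x z ≟ᵇ rel Q x z)

  commonLarge : BlockMap n → BlockMap n → Fin n → Bool
  commonLarge P Q x = does (sameBlock? P Q x) ∧ not (single P x)

  -- Splitting a point off a common block of P and Q that is not a singleton
  -- destroys that common block and creates no common singleton.
  stable-singles : ∀ {t f} → Stable f → IntersectingFamily t f → SinglesIntersecting t f
  stable-singles {t} {f} st h = singlesIntersecting (λ {P} {Q} p q fP fQ → go (suc (large P Q)) ≤-refl p q fP fQ)
    where
    large : BlockMap n → BlockMap n → ℕ
    large P Q = count (commonLarge P Q) (elements n)
    go : ∀ fuel {P Q} → large P Q < fuel → Partition P → Partition Q → f P ≡ true → f Q ≡ true → t ≤ commonSingles P Q
    go (suc fuel) {P} {Q} l p q fP fQ with search (commonLarge P Q) (elements n)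
    -- All common blocks are singletons now, so the `t` representatives are common singletons.
    ... | inj₂ none = ≤-trans (≤-reflexive (sym (trans (count-true (List.tabulate (shared I))) (length-tabulate (shared I)))))
        (count-⊆ (Uniqueₚ.tabulate⁺ (shared-injective p I)) (λ i _ → ∈-elements _ , both i))
      where
      I : Intersecting t P Q
      I = h p q fP fQ
      alone : ∀ k → single P (shared I k) ≡ true
      alone k = by (true-or-false (single P (shared I k)))
        where
        by : single P (shared I k) ≡ true ⊎ single P (shared I k) ≡ false → single P (shared I k) ≡ true
        by (inj₁ s) = s
        by (inj₂ s) = conflict (∧-intro (dec-true (sameBlock? P Q (shared I k)) (same I k)) (cong not s)) (none (∈-elements (shared I k)))
      both : ∀ {x} → x ∈ List.tabulate (shared I) → single P x ∧ single Q x ≡ true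
      both i with ∈-tabulate⁻ i
      ... | k , refl = ∧-intro (alone k) (single-rows q (same I k) (alone k))
    ... | inj₁ (x , _ , e) with ¬single⇒partner p (not-true (∧-elimʳ {does (sameBlock? P Q x)} e))
    ...   | y , y≢x , rxy = ≤-trans (go fuel (≤-trans decreases (≤-pred l)) p′ q fP′ fQ) (count-mono (elements n) (λ {z} _ → noNew z))
      where
      x≢y : x ≢ y
      x≢y eq = y≢x (sym eq)
      P′ : BlockMap n
      P′ = split x P
      p′ : Partition P′
      p′ = split-partition p
      fP′ : f P′ ≡ true
      fP′ = subst (λ R → f R ≡ true) (move-split {x} {y} {P} x≢y rxy) (st (x , y) p fP
        (isolated⁺ {x} {y} {move (x , y) P} x≢y (subst (λ R → single R x ≡ true) (sym (move-split {x} {y} {P} x≢y rxy)) (single-split p))))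
      sameₓ : ∀ z → rel P x z ≡ rel Q x z
      sameₓ = from-does (sameBlock? P Q x) (∧-elimˡ e)
      related : ∀ {z} → rel P z x ≡ true → rel Q z x ≡ true
      related {z} r = rel-sym q (trans (sym (sameₓ z)) (rel-sym p r))
      shrinks : ∀ z → commonLarge P′ Q z ≡ true → commonLarge P Q z ≡ true
      shrinks z c = ∧-intro (dec-true (sameBlock? P Q z) (λ w → trans (sym (split-away p away w)) (samez w)))
                      (cong not (¬true⇒false (λ s → conflict (single-rows p′ (λ w → sym (split-away p away w)) s) notSingle)))
        where
        samez : ∀ w → rel P′ z w ≡ rel Q z w
        samez = from-does (sameBlock? P′ Q z) (∧-elimˡ c)
        notSingle : single P′ z ≡ false
        notSingle = not-true (∧-elimʳ {does (sameBlock? P′ Q z)} c)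
        z≢x : z ≢ x
        z≢x refl = conflict (single-split p) notSingle
        away : rel P z x ≡ false
        away = ¬true⇒false (λ r → z≢x (rel-split-right p (trans (samez x) (related r))))
      decreases : large P′ Q < large P Q
      decreases = sumOf-strict {xs = elements n} (λ {z} _ → b2n-mono (shrinks z)) (∈-elements x) strict
        where
        strict : b2n (commonLarge P′ Q x) < b2n (commonLarge P Q x)
        strict rewrite e | single-split {i = x} p = s≤s (≤-reflexive (cong b2n (∧-zeroʳ (does (sameBlock? P′ Q x)))))
      noNew : ∀ z → single P′ z ∧ single Q z ≡ true → single P z ∧ single Q z ≡ true
      noNew z c = ∧-intro (single-rows p (split-away p away) (∧-elimˡ c)) sQ
        where
        sQ : single Q z ≡ true
        sQ = ∧-elimʳ {single P′ z} c
        z≢x : z ≢ x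
        z≢x refl = y≢x (single⇒≡ sQ (trans (sym (sameₓ y)) rxy))
        away : rel P z x ≡ false
        away = ¬true⇒false (λ r → z≢x (sym (single⇒≡ sQ (related r))))

-- Recovering the star before a split

no-injection : ∀ {A : Set} {t} {T : List A} {w} (g : Fin t → A) → length T ≡ t → (∀ {k l} → g k ≡ g l → k ≡ l) →
               (∀ k → g k ∈ T) → w ∈ T → (∀ k → g k ≢ w) → ⊥
no-injection {T = T} {w} g len inj into w∈ miss = 1+n≰n (≤-trans
  (≤-reflexive (cong suc (trans len (sym (length-tabulate g)))))
  (length-⊆ {xs = w ∷ List.tabulate g} (All.tabulate (λ i e → missed i e) ∷ Uniqueₚ.tabulate⁺ inj) inside))
  where
  missed : ∀ {x} → x ∈ List.tabulate g → w ≡ x → ⊥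
  missed i e with ∈-tabulate⁻ i
  ... | k , refl = miss k (sym e)
  inside : ∀ {x} → x ∈ w ∷ List.tabulate g → x ∈ T
  inside (here refl) = w∈
  inside (there i) with ∈-tabulate⁻ i
  ... | k , refl = into k

module _ {n : ℕ} where
  open Splitting n
  open import Data.List.Membership.DecPropositional (_≟_ {n}) using (_∈?_)

  outside : ∀ (T : List (Fin n)) → length T < n → ∃[ x ] x ∉ T
  outside T l with count<length (λ x → does (x ∈? T)) (elements n) (≤-trans (s≤s (≤-trans
        (count-⊆ {q = λ _ → true} (elements-unique n) (λ {x} _ e → from-does (x ∈? T) e , refl)) (≤-reflexive (count-true T))))
        (≤-trans l (≤-reflexive (sym (length-elements n)))))
  ... | x , _ , e = x , λ i → conflict (dec-true (x ∈? T) i) e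

  discrete : BlockMap n
  discrete = matrix (λ x y → does (x ≟ y))

  rel-discrete : ∀ x y → rel discrete x y ≡ does (x ≟ y)
  rel-discrete = rel-matrix _

  lumpRel : List (Fin n) → Fin n → Fin n → Bool
  lumpRel T x y = does (x ≟ y) ∨ (not (does (x ∈? T)) ∧ not (does (y ∈? T)))

  -- Together with `discrete`, one of the two extreme members of the star of `T`: the points outside
  -- `T` are all in one block, or all apart. Both serve as test members.
  lumped : List (Fin n) → BlockMap n
  lumped T = matrix (lumpRel T)

  rel-lumped : ∀ {T x y} → x ∉ T → y ∉ T → rel (lumped T) x y ≡ true
  rel-lumped {T} {x} {y} a b = trans (rel-matrix (lumpRel T) x y)
    (∨-introʳ {does (x ≟ y)} (∧-intro (cong not (dec-false (x ∈? T) a)) (cong not (dec-false (y ∈? T) b))))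

  rel-lumped⁻ : ∀ {T x y} → rel (lumped T) x y ≡ true → x ≡ y ⊎ (x ∉ T × y ∉ T)
  rel-lumped⁻ {T} {x} {y} e with ∨-elim {does (x ≟ y)} (trans (sym (rel-matrix (lumpRel T) x y)) e)
  ... | inj₁ d = inj₁ (from-does (x ≟ y) d)
  ... | inj₂ c = inj₂ ((λ i → conflict (∧-elimˡ c) (cong not (dec-true (x ∈? T) i))) ,
                       (λ i → conflict (∧-elimʳ {not (does (x ∈? T))} c) (cong not (dec-true (y ∈? T) i))))

  discrete-partition : Partition discrete
  discrete-partition = equiv⇒partition (record
    { reflᵣ = λ x → trans (rel-discrete x x) (dec-true (x ≟ x) refl)
    ; symᵣ = λ x y e → trans (rel-discrete y x) (dec-true (y ≟ x) (sym (eq x y e)))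
    ; transᵣ = λ x y z e f → trans (rel-discrete x z) (dec-true (x ≟ z) (trans (eq x y e) (eq y z f))) })
    where
    eq : ∀ x y → rel discrete x y ≡ true → x ≡ y
    eq x y e = from-does (x ≟ y) (trans (sym (rel-discrete x y)) e)

  single-discrete : ∀ x → single discrete x ≡ true
  single-discrete x = single-intro discrete-partition
    (λ y e → sym (from-does (x ≟ y) (trans (sym (rel-discrete x y)) e)))

  lumped-partition : ∀ T → Partition (lumped T)
  lumped-partition T = equiv⇒partition (record
    { reflᵣ = rfl
    ; symᵣ = λ x y e → symm x y (rel-lumped⁻ {T} e)
    ; transᵣ = λ x y z e f → tran x y z e f (rel-lumped⁻ {T} e) (rel-lumped⁻ {T} f) })
    where
    R : Fin n → Fin n → Bool
    R = rel (lumped T)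
    rfl : ∀ x → R x x ≡ true
    rfl x = trans (rel-matrix (lumpRel T) x x) (∨-introˡ (dec-true (x ≟ x) refl))
    symm : ∀ x y → x ≡ y ⊎ (x ∉ T × y ∉ T) → R y x ≡ true
    symm x y (inj₁ refl)    = rfl x
    symm x y (inj₂ (a , b)) = rel-lumped b a
    tran : ∀ x y z → R x y ≡ true → R y z ≡ true → x ≡ y ⊎ (x ∉ T × y ∉ T) → y ≡ z ⊎ (y ∉ T × z ∉ T) → R x z ≡ true
    tran x y z e f (inj₁ refl) _ = f
    tran x y z e f (inj₂ _) (inj₁ refl) = e
    tran x y z e f (inj₂ (a , _)) (inj₂ (_ , c)) = rel-lumped a c

  single-lumped : ∀ {T x} → x ∈ T → single (lumped T) x ≡ true
  single-lumped {T} {x} i = single-intro (lumped-partition T) (λ y e → by y (rel-lumped⁻ {T} e))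
    where
    by : ∀ y → x ≡ y ⊎ (x ∉ T × y ∉ T) → y ≡ x
    by y (inj₁ e)       = sym e
    by y (inj₂ (a , _)) = ⊥-elim (a i)

  -- If compressing f yields the star of T, then f contains, for every member Q of
  -- the star, either Q or Q with i glued to j.  Taking Q discrete or Q = lumped T
  -- gives a member that shares too few blocks with a P outside the star.
  module Transfer {t f k T} (h : IntersectingFamily t f) (uT : Unique T) (lenT : length T ≡ t) (room : 2 + t ≤ n)
                  (star : ∀ {P} → Partition P → compress k f P ≡ hasSingles T P) where
    i j : Fin n
    i = proj₁ k
    j = proj₂ k

    another : ∀ x → ∃[ e ] (e ∉ T × e ≢ x)
    another x with outside (x ∷ T) (subst (λ l → suc l < n) (sym lenT) room)
    ... | e , e∉ = e , (λ m → e∉ (there m)) , (λ eq → e∉ (here eq))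

    member : ∀ {Q} → Partition Q → (∀ {x} → x ∈ T → single Q x ≡ true) →
             f Q ≡ true ⊎ (i ≢ j × single Q i ≡ true × f (glue i j Q) ≡ true)
    member {Q} q s with compress-elim k f q (trans (star q) (hasSingles⁺ T {Q} s))
    ... | inj₁ (fQ , _) = inj₁ fQ
    ... | inj₂ (u , fιQ) with isolated⁻ {i} {j} {Q} u
    ...   | ne , si = inj₂ (ne , si , subst (λ R → f R ≡ true) (move-glue {i} {j} {Q} ne si) fιQ)

    -- The situation to be refuted: `P` belongs to `f` and its split lies in the star, but `P`
    -- itself does not, because the point `z` of `T` is no singleton of `P`.
    module Outlier {P} (p : Partition P) (fP : f P ≡ true) (i≢j : i ≢ j) (rij : rel P i j ≡ true)
                   (apart : ∀ {x} → x ∈ T → single (split i P) x ≡ true) {z} (z∈ : z ∈ T) (nz : single P z ≡ false) where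

      j≢i : j ≢ i
      j≢i e = i≢j (sym e)

      in-T : ∀ {x y} → x ∈ T → x ≢ i → y ≢ i → rel P x y ≡ true → y ≡ x
      in-T x∈ x≢i y≢i r = single⇒≡ (apart x∈) (trans (rel-split p x≢i y≢i) r)

      -- Any point of T that is not a singleton of P is glued to i.
      j∈T : i ∉ T → j ∈ T
      j∈T i∉ with ¬single⇒partner p nz
      ... | w , w≢z , r = subst (_∈ T) (sym (in-T z∈ z≢i j≢i (rel-trans p zi rij))) z∈
        where
        z≢i : z ≢ i
        z≢i refl = i∉ z∈
        zi : rel P z i ≡ true
        zi with w ≟ i
        ... | yes refl = r
        ... | no w≢i   = ⊥-elim (w≢z (in-T z∈ z≢i w≢i r))

      impossible : ∀ {Q} (g : Intersecting t P Q) → (∀ x → (∀ y → rel P x y ≡ rel Q x y) → x ∈ T) →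
                   (∃[ w ] (w ∈ T × ¬ (∀ y → rel P w y ≡ rel Q w y))) → ⊥
      impossible I into (w , w∈ , miss) = no-injection (shared I) lenT (shared-injective p I)
        (λ k → into _ (same I k)) w∈ (λ k e → miss (λ y → subst (λ x → rel P x y ≡ rel _ x y) e (same I k y)))

      z-missed : ∀ {Q} → single Q z ≡ true → ¬ (∀ y → rel P z y ≡ rel Q z y)
      z-missed s eq = conflict (single-rows p (λ y → sym (eq y)) s) nz

      -- A common block of `P` and `lumped T` outside `T` would contain `i`, hence `j` by `rij`,
      -- although `j` lies in `T` and is a singleton of `lumped T`. Gluing is excluded since `i` is
      -- no singleton of `lumped T`: by `room` a further point lies outside `T`.
      case-i∉T : i ∉ T → ⊥
      case-i∉T i∉ with member (lumped-partition T) single-lumped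
      ... | inj₁ fQ = impossible (h p (lumped-partition T) fP fQ) into (z , z∈ , z-missed (single-lumped z∈))
        where
        into : ∀ x → (∀ y → rel P x y ≡ rel (lumped T) x y) → x ∈ T
        into x eq with x ∈? T
        ... | yes x∈ = x∈
        ... | no x∉ = [ (λ { refl → j∈T i∉ }) , (λ c → ⊥-elim (proj₂ c (j∈T i∉))) ]
              (rel-lumped⁻ {T} (trans (sym (eq j)) (rel-trans p (trans (eq i) (rel-lumped x∉ i∉)) rij)))
      ... | inj₂ (_ , s , _) with another i
      ...   | e , e∉ , e≢i = e≢i (single⇒≡ s (rel-lumped i∉ e∉))

      module _ (i∈ : i ∈ T) where

        not-i : ∀ {x} → x ∉ T → x ≢ i
        not-i x∉ refl = x∉ i∈

        -- The last hypothesis says that no block of Q outside T is a block of P.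
        finish : ∀ {Q} → Partition Q → (∀ {x} → x ∈ T → single Q x ≡ true) →
                 (∀ x → x ∉ T → ∃[ a ] ∃[ b ] (a ∉ T × b ∉ T × (rel Q x a ≡ rel P x a → rel Q x b ≡ rel P x b → ⊥))) → ⊥
        finish {Q} q s differ with member q s
        ... | inj₁ fQ = impossible (h p q fP fQ) into (z , z∈ , z-missed (s z∈))
          where
          into : ∀ x → (∀ y → rel P x y ≡ rel Q x y) → x ∈ T
          into x eq with x ∈? T
          ... | yes x∈ = x∈
          ... | no x∉ with differ x x∉
          ...   | a , b , _ , _ , d = ⊥-elim (d (sym (eq a)) (sym (eq b)))
        ... | inj₂ (_ , si , fG) = glued (j ∈? T)
          where
          G : BlockMap n
          G = glue i j Q
          g : Partition G
          g = pull-partition (glueMap i j) q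
          I : Intersecting t P G
          I = h p g fP fG
          into : ∀ x → (∀ y → rel P x y ≡ rel G x y) → x ∈ T
          into x eq with x ∈? T
          ... | yes x∈ = x∈
          ... | no x∉ with differ x x∉
          ...   | a , b , a∉ , b∉ , d = ⊥-elim (d
                  (trans (sym (rel-glue q i≢j (not-i x∉) (not-i a∉))) (sym (eq a)))
                  (trans (sym (rel-glue q i≢j (not-i x∉) (not-i b∉))) (sym (eq b))))
          glued : Dec (j ∈ T) → ⊥
          -- The block of `i` contains `j` in both `P` and `G`. If it were common, `j` would
          -- represent a common block, and `into` would put `j` into `T`; so the point `i` of `T` is
          -- missed.
          glued (no j∉) = impossible I into (i , i∈ , λ eq → j∉ (into j (λ y →
            trans (rel-rows {P = P} {P} (rel⇒row≡ p rij) y)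
              (trans (eq y) (sym (rel-rows {P = G} {G} (rel⇒row≡ g (rel-glue-ij q i≢j)) y))))))
          -- i and j now lie in the same block: replace j by i to exhibit fewer than t blocks.
          glued (yes j∈) = no-injection (λ k → norm (shared I k)) lenT inj (λ k → norm∈ (into _ (same I k))) j∈ (λ k → norm≢j (shared I k))
            where
            norm : Fin n → Fin n
            norm = glueMap j i
            norm∈ : ∀ {x} → x ∈ T → norm x ∈ T
            norm∈ {x} x∈ with x ≟ j
            ... | yes _ = i∈
            ... | no _  = x∈
            norm≢j : ∀ x → norm x ≢ j
            norm≢j x with x ≟ j
            ... | yes _ = i≢j
            ... | no ne = ne
            norm-rel : ∀ x → rel P x (norm x) ≡ true
            norm-rel x with x ≟ j
            ... | yes refl = rel-sym p rij
            ... | no _     = rel-refl p x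
            inj : ∀ {k l} → norm (shared I k) ≡ norm (shared I l) → k ≡ l
            inj {k} {l} e = distinct I (rel-trans p (norm-rel (shared I k))
              (subst (λ w → rel P w (shared I l) ≡ true) (sym e) (rel-sym p (norm-rel (shared I l)))))

        -- If P relates all points outside T, compare it with the discrete partition,
        -- otherwise with the partition that lumps them together.
        case-i∈T : ⊥
        case-i∈T with Finₚ.any? (λ a → ¬? (a ∈? T) ×-dec Finₚ.any? (λ b → ¬? (b ∈? T) ×-dec (rel P a b ≟ᵇ false)))
        ... | yes (a , a∉ , b , b∉ , r) = finish (lumped-partition T) single-lumped (λ x x∉ → a , b , a∉ , b∉ , λ e e′ →
                conflict (rel-trans p (rel-sym p (trans (sym e) (rel-lumped x∉ a∉))) (trans (sym e′) (rel-lumped x∉ b∉))) r)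
        ... | no close = finish discrete-partition (λ _ → single-discrete _) differ
          where
          differ : ∀ x → x ∉ T → ∃[ a ] ∃[ b ] (a ∉ T × b ∉ T × (rel discrete x a ≡ rel P x a → rel discrete x b ≡ rel P x b → ⊥))
          differ x x∉ with another x
          ... | e , e∉ , e≢x = e , e , e∉ , e∉ , λ eq _ → close (x , x∉ , e , e∉ ,
                  trans (sym eq) (trans (rel-discrete x e) (dec-false (x ≟ e) (λ q → e≢x (sym q)))))

      absurd : ⊥
      absurd with i ∈? T
      ... | yes i∈ = case-i∈T i∈
      ... | no i∉  = case-i∉T i∉

    -- A member `P` of `f` outside the star was dropped in favour of `move k P`, which lies in the
    -- star and is the upper one of the pair. So the move was a split, and `Outlier` applies.
    transfer : ∀ {P} → Partition P → f P ≡ true → hasSingles T P ≡ true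
    transfer {P} p fP with search (λ x → not (single P x)) T
    ... | inj₂ none = hasSingles⁺ T {P} (λ {x} x∈ → not-false (none x∈))
      where
      not-false : ∀ {b} → not b ≡ false → b ≡ true
      not-false {true} _ = refl
    ... | inj₁ (z , z∈ , nz) with compress-down k f p fP (trans (star p) (false-if (λ e → hasSingles⁻ T {P} e z∈) (not-true nz)))
    ...   | v , c with view i j P
    ...     | stays u e = conflict (trans (cong (isolated k) (sym e)) v) u
    ...     | glues ne s e = conflict v (isolated-flips k p (isolated⁺ {i} {j} {P} ne s))
    ...     | splits ne r e = ⊥-elim (Outlier.absurd p fP ne r
                (λ {x} x∈ → subst (λ R → single R x ≡ true) e (hasSingles⁻ T {move k P} (trans (sym (star (move-partition k p))) c) x∈))
                z∈ (not-true nz))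

  -- A partition of the star missing from `f` would push the size of the star above the bound in
  -- `cnt-star≤`.
  star-equality : ∀ {f : BlockMap n → Bool} {T} → Unique T → (∀ {P} → Partition P → f P ≡ true → hasSingles T P ≡ true) →
                  cnt f ≡ Bell (n ∸ length T) → ∀ {P} → Partition P → f P ≡ hasSingles T P
  star-equality {f} {T} u l e {P} p = iff⇒≡ (l p) converse
    where
    converse : hasSingles T P ≡ true → f P ≡ true
    converse s = by (true-or-false (f P))
      where
      by : f P ≡ true ⊎ f P ≡ false → f P ≡ true
      by (inj₁ t) = t
      by (inj₂ t) = contradiction (cnt-star≤ u) (<⇒≱ (≤-trans (≤-reflexive (cong suc (sym e)))
        (sumOf-strict {xs = allPartitions n} (λ i → b2n-mono (l (sound i))) (complete p) strict)))
        where
        strict : b2n (f P) < b2n (hasSingles T P)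
        strict rewrite t | s = ≤-refl

  -- The bound and its equality case for all intersecting families

  IsStar : ℕ → (BlockMap n → Bool) → Set
  IsStar t f = ∃[ T ] (Unique T × length T ≡ t × (∀ {P} → Partition P → f P ≡ hasSingles T P))

  -- Recovering a star through `Transfer` uses the intersecting property of the family before the
  -- split. The induction therefore proves an implication and hands its premise on to
  -- `compress k f`.
  intersecting-bound : ∀ {t} → 2 + t ≤ n →
    (∀ {f} → SinglesIntersecting t f → (∀ {P} → Partition P → f P ≡ true → suc t ≤ size P) → cnt {n} f < Bell (n ∸ t)) →
    ∀ f → IntersectingFamily t f → cnt f ≤ Bell (n ∸ t) × (cnt f ≡ Bell (n ∸ t) → IsStar t f)
  intersecting-bound {t} room nontrivial = compression-induction
    (λ f → IntersectingFamily t f → cnt f ≤ Bell (n ∸ t) × (cnt f ≡ Bell (n ∸ t) → IsStar t f)) base step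
    where
    base : ∀ f → Stable f → IntersectingFamily t f → cnt f ≤ Bell (n ∸ t) × (cnt f ≡ Bell (n ∸ t) → IsStar t f)
    base f st h with search (λ P → f P ∧ does (size P ≤? t)) (allPartitions n)
    ... | inj₂ none = <⇒≤ less , λ e → contradiction e (<⇒≢ less)
      where
      less : cnt f < Bell (n ∸ t)
      less = nontrivial (stable-singles st h) (λ {P} p fP → ≰⇒> (λ l →
        conflict (∧-intro fP (dec-true (size P ≤? t) l)) (none (complete p))))
    ... | inj₁ (P , P∈ , e) = bound , λ e → T , uT , lenT , star-equality uT inStar (trans e (cong (λ k → Bell (n ∸ k)) (sym lenT)))
      where
      meets : SinglesIntersecting t f
      meets = stable-singles st h
      fP : f P ≡ true
      fP = ∧-elimˡ e
      small : size P ≤ t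
      small = from-does (size P ≤? t) (∧-elimʳ {f P} e)
      T? : (x : Fin n) → Dec (single P x ≡ true)
      T? x = single P x ≟ᵇ true
      T : List (Fin n)
      T = filter T? (elements n)
      uT : Unique T
      uT = Uniqueₚ.filter⁺ T? (elements-unique n)
      T-sound : ∀ {x} → x ∈ T → single P x ≡ true
      T-sound i = proj₂ (∈-filter⁻ T? {xs = elements n} i)
      lengthT : length T ≡ size P
      lengthT = trans (sym (count-true T)) (≤-antisym
        (count-⊆ uT (λ i _ → ∈-elements _ , T-sound i))
        (count-⊆ (elements-unique n) (λ {x} i s → ∈-filter⁺ T? (∈-elements x) s , refl)))
      lenT : length T ≡ t
      -- Applied to `P` and itself, `meets` yields at least `t` singletons.
      lenT = trans lengthT (≤-antisym small (≤-trans (meets .meet (sound P∈) (sound P∈) fP fP)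
        (count-mono (elements n) (λ _ c → ∧-elimˡ c))))
      inStar : ∀ {Q} → Partition Q → f Q ≡ true → hasSingles T Q ≡ true
      inStar {Q} q fQ = hasSingles⁺ T {Q} (λ {x} x∈ → by x x∈ (true-or-false (single Q x)))
        where
        by : ∀ x → x ∈ T → single Q x ≡ true ⊎ single Q x ≡ false → single Q x ≡ true
        by x x∈ (inj₁ s) = s
        by x x∈ (inj₂ s) = contradiction (meets .meet (sound P∈) q fP fQ) (<⇒≱ (≤-trans
          (sumOf-strict {xs = elements n} (λ {y} _ → b2n-mono (λ c → ∧-elimˡ {single P y} c)) (∈-elements x) strict) small))
          where
          strict : b2n (single P x ∧ single Q x) < b2n (single P x)
          strict rewrite T-sound x∈ | s = ≤-refl
      bound : cnt f ≤ Bell (n ∸ t)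
      bound = ≤-trans (cnt-mono inStar) (≤-trans (cnt-star≤ uT) (≤-reflexive (cong (λ k → Bell (n ∸ k)) lenT)))

    step : ∀ k f → (IntersectingFamily t (compress k f) → cnt (compress k f) ≤ Bell (n ∸ t) ×
             (cnt (compress k f) ≡ Bell (n ∸ t) → IsStar t (compress k f))) →
           IntersectingFamily t f → cnt f ≤ Bell (n ∸ t) × (cnt f ≡ Bell (n ∸ t) → IsStar t f)
    step k f ih h with ih (compress-intersecting k h)
    ... | le , eq = ≤-trans (≤-reflexive (sym (cnt-compress k f))) le , star
      where
      star : cnt f ≡ Bell (n ∸ t) → IsStar t f
      star e with eq (trans (cnt-compress k f) e)
      ... | T , uT , lenT , s = T , uT , lenT , star-equality uT (Transfer.transfer {k = k} h uT lenT room s)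
              (trans e (cong (λ k → Bell (n ∸ k)) (sym lenT)))

-- Choice of the parameters

opaque
  -- With ℓ = 4 q this is the lower bound on `n` that `growth` asks for at m = ℓ. The factor 4 makes
  -- `2 ^ q` a fourth root of `2 ^ ℓ`: large enough to dominate ℓ, yet small compared with s. Being
  -- opaque, it is not evaluated at large arguments.
  threshold : ℕ → ℕ
  threshold q = (q * 4 + 12) * 2 ^ (q * 4 + 12)

  threshold-def : ∀ q → threshold q ≡ (q * 4 + 12) * 2 ^ (q * 4 + 12)
  threshold-def q = refl

q≤threshold : ∀ q → q ≤ threshold q
q≤threshold q = ≤-trans (m≤m*n q 4) (≤-trans (m≤m+n (q * 4) 12)
  (≤-trans (≤-reflexive (sym (*-identityʳ (q * 4 + 12)))) (≤-trans (*-monoʳ-≤ (q * 4 + 12) (1≤m^n (q * 4 + 12) (s≤s z≤n)))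
    (≤-reflexive (sym (threshold-def q))))))

-- The upward search ends because `q≤threshold` makes the thresholds unbounded.
bracket : ∀ n q → threshold q ≤ n → ∃[ k ] (threshold (k + q) ≤ n × n < threshold (suc (k + q)))
bracket n q l = go n zero (≤-trans (s≤s (m≤m+n n q)) ≤-refl) l
  where
  go : ∀ fuel k → n < suc (fuel + (k + q)) → threshold (k + q) ≤ n → ∃[ k ] (threshold (k + q) ≤ n × n < threshold (suc (k + q)))
  go fuel k b l with n <? threshold (suc (k + q))
  ... | yes h = k , l , h
  go zero       k b l | no h = contradiction (≤-trans b (≤-trans (q≤threshold (suc (k + q))) (≮⇒≥ h))) 1+n≰n
  go (suc fuel) k b l | no h = go fuel (suc k) (≤-trans b (≤-reflexive (cong suc (sym (+-suc fuel (k + q)))))) (≮⇒≥ h)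

opaque
  unfolding threshold

  -- C ≥ threshold 11 makes the parameter q below at least 11; C ≥ 17 * 2 ^ 17 makes t + 2 ≤ 2 ^ (4 q).
  C : ℕ
  C = threshold 11

  threshold≤C : threshold 11 ≤ C
  threshold≤C = ≤-refl

  2^16 : ℕ
  2^16 = 2 ^ 16

  2^16-shift : ∀ ℓ → 2 ^ (ℓ + 16) ≡ 2^16 * 2 ^ ℓ
  2^16-shift ℓ = trans (^-distribˡ-+-* 2 ℓ 16) (*-comm (2 ^ ℓ) (2 ^ 16))

  17*2^17≤C : 17 * (2 * 2^16) ≤ C
  17*2^17≤C = ≤ᵇ⇒≤ (17 * (2 * 2 ^ 16)) (threshold 11) _

  1≤C : 1 ≤ C
  1≤C = ≤ᵇ⇒≤ 1 (threshold 11) _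

-- Replaces the logarithmic factor `ℓ + 16` in the upper bound on `n`, so that `n` is compared with
-- a pure power of two.
16+4q≤2^q : ∀ k → 16 + (k + 11) * 4 ≤ 2 ^ (k + 11)
16+4q≤2^q zero    = ≤ᵇ⇒≤ 60 2048 _
16+4q≤2^q (suc k) = begin
  16 + suc (k + 11) * 4                            ≡⟨ shift ((k + 11) * 4) ⟩
  4 + (16 + (k + 11) * 4)                          ≤⟨ +-monoˡ-≤ (16 + (k + 11) * 4) (m≤m+n 4 (12 + (k + 11) * 4)) ⟩
  (16 + (k + 11) * 4) + (16 + (k + 11) * 4)        ≤⟨ +-mono-≤ (16+4q≤2^q k) (16+4q≤2^q k) ⟩
  2 ^ (k + 11) + 2 ^ (k + 11)                      ≡⟨ cong (2 ^ (k + 11) +_) (+-identityʳ (2 ^ (k + 11))) ⟨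
  2 ^ suc (k + 11)                                 ∎
  where
  open ≤-Reasoning
  shift : ∀ x → 16 + (4 + x) ≡ 4 + (16 + x)
  shift = solve-∀

-- All quantities are measured by w = 2 ^ ℓ, which is of order n / log n: t + 2 ≤ w, s = 16 w, R =
-- 256 w and u = s / 2. Then t + 2 s ≤ 33 w is below a quarter of R, while d ≥ 15 w is nearly all of
-- s.
module Parameters {n t k : ℕ} (1≤t : 1 ≤ t) (n≥ : C * t * suc ⌊log₂ t ⌋ ^ 2 ≤ n)
  (lower : threshold (k + 11) ≤ n) (upper : n < threshold (suc (k + 11))) where

  open ≤-Reasoning

  q ℓ w s R u d : ℕ
  q = k + 11
  ℓ = q * 4
  w = 2 ^ ℓ
  s = 2 ^ (ℓ + 4)
  R = 2 ^ (ℓ + 8)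
  u = 2 ^ (ℓ + 3)
  d = s ∸ (t + 2)

  1≤w : 1 ≤ w
  1≤w = 1≤m^n ℓ (s≤s z≤n)

  power : ∀ c x → 2 ^ c ≡ x → 2 ^ (ℓ + c) ≡ x * w
  power c _ refl = trans (^-distribˡ-+-* 2 ℓ c) (*-comm w (2 ^ c))

  s≡ : s ≡ 16 * w
  s≡ = power 4 16 refl
  R≡ : R ≡ 256 * w
  R≡ = power 8 256 refl
  u≡ : u ≡ 8 * w
  u≡ = power 3 8 refl
  K≡ : 2 ^ (ℓ + 12) ≡ 4096 * w
  K≡ = power 12 4096 refl

  lower′ : (ℓ + 12) * 2 ^ (ℓ + 12) ≤ n
  lower′ = subst (_≤ n) (threshold-def q) lower

  below-next : n < (ℓ + 16) * 2 ^ (ℓ + 16)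
  below-next = subst (n <_) (trans (threshold-def (suc q)) (cong (λ z → z * 2 ^ z) (shift ℓ))) upper
    where
    shift : ∀ x → 4 + x + 12 ≡ x + 16
    shift = solve-∀

  -- If w ≤ t + 1 ≤ 2 t, then ℓ ≤ L = 1 + ⌊log₂ t⌋, and the next threshold, which exceeds `n`, is at
  -- most 17 * 2 ^ 17 * t * L, contrary to the hypothesis on `n`.
  1+t<w : suc t < w
  1+t<w with suc t <? w
  ... | yes l = l
  ... | no h  = contradiction n≥ (<⇒≱ (begin-strict
    n                                        <⟨ below-next ⟩
    (ℓ + 16) * 2 ^ (ℓ + 16)                  ≡⟨ cong ((ℓ + 16) *_) (2^16-shift ℓ) ⟩
    (ℓ + 16) * (2^16 * w)                  ≤⟨ *-mono-≤ (+-mono-≤ m≤L (*-monoʳ-≤ 16 1≤L)) (*-monoʳ-≤ 2^16 w≤2t) ⟩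
    (L + 16 * L) * (2^16 * (2 * t))        ≡⟨ regroup L 2^16 t ⟩
    17 * (2 * 2^16) * t * L                ≤⟨ *-mono-≤ (*-monoˡ-≤ t 17*2^17≤C) (≤-trans (≤-reflexive (sym (*-identityʳ L))) (*-monoʳ-≤ L (≤-trans 1≤L (≤-reflexive (sym (*-identityʳ L)))))) ⟩
    C * t * L ^ 2                            ∎))
    where
    L : ℕ
    L = suc ⌊log₂ t ⌋
    1≤L : 1 ≤ L
    1≤L = s≤s z≤n
    w≤2t : w ≤ 2 * t
    w≤2t = ≤-trans (≮⇒≥ h) (≤-trans (+-monoˡ-≤ t 1≤t) (≤-reflexive (cong (t +_) (sym (+-identityʳ t)))))
    m≤L : ℓ ≤ L
    m≤L = begin
      ℓ               ≡⟨ ⌊log₂[2^n]⌋≡n ℓ ⟨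
      ⌊log₂ w ⌋       ≤⟨ ⌊log₂⌋-mono-≤ w≤2t ⟩
      ⌊log₂ 2 * t ⌋   ≡⟨ ⌊log₂[2*b]⌋≡1+⌊log₂b⌋ t {{>-nonZero 1≤t}} ⟩
      L               ∎
    regroup : ∀ l p t → (l + 16 * l) * (p * (2 * t)) ≡ 17 * (2 * p) * t * l
    regroup = solve-∀

  2+t≤w : t + 2 ≤ w
  2+t≤w = ≤-trans (≤-reflexive (+-comm t 2)) 1+t<w

  t≤w : t ≤ w
  t≤w = ≤-trans (m≤m+n t 2) 2+t≤w

  multiple≤n : ∀ c → c ≤ 4096 → c * w ≤ n
  multiple≤n c l = ≤-trans (*-monoˡ-≤ w l) (≤-trans (≤-reflexive (sym K≡))
    (≤-trans (m≤n*m (2 ^ (ℓ + 12)) (ℓ + 12) {{>-nonZero (≤-trans (s≤s z≤n) (m≤n+m 12 ℓ))}}) lower′))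

  s-split : s ≡ t + 2 + d
  s-split = sym (m+[n∸m]≡n (≤-trans 2+t≤w (≤-trans (m≤n*m w 16) (≤-reflexive (sym s≡)))))

  sizes : t + (s + s) ≤ 33 * w
  sizes = begin
    t + (s + s)            ≤⟨ +-monoˡ-≤ (s + s) t≤w ⟩
    w + (s + s)            ≡⟨ cong (λ z → w + (z + z)) s≡ ⟩
    w + (16 * w + 16 * w)  ≡⟨ lemma w ⟩
    33 * w                 ∎
    where
    lemma : ∀ w → w + (16 * w + 16 * w) ≡ 33 * w
    lemma = solve-∀

  fits : t + (s + s) ≤ n
  fits = ≤-trans sizes (multiple≤n 33 (≤ᵇ⇒≤ 33 4096 _))

  small : 4 * (t + (s + s)) ≤ R
  small = begin
    4 * (t + (s + s))  ≤⟨ *-monoʳ-≤ 4 sizes ⟩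
    4 * (33 * w)       ≡⟨ *-assoc 4 33 w ⟨
    132 * w            ≤⟨ *-monoˡ-≤ w (≤ᵇ⇒≤ 132 256 _) ⟩
    256 * w            ≡⟨ R≡ ⟨
    R                  ∎

  ratio : ∀ j → n ≤ j + (t + s) → R * Bell j ≤ Bell (suc j)
  ratio = growth Bell Bell-lower Bell-suc ℓ lower′ (≤-trans (+-monoʳ-≤ t (m≤m+n s s))
    (≤-trans sizes (≤-trans (*-monoˡ-≤ w (≤ᵇ⇒≤ 33 4096 _)) (≤-reflexive (sym K≡)))))

  n≤2^ : n ≤ 2 ^ (q + (ℓ + 16))
  n≤2^ = begin
    n                        ≤⟨ <⇒≤ below-next ⟩
    (ℓ + 16) * 2 ^ (ℓ + 16)  ≤⟨ *-monoˡ-≤ (2 ^ (ℓ + 16)) (≤-trans (≤-reflexive (+-comm ℓ 16)) (16+4q≤2^q k)) ⟩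
    2 ^ q * 2 ^ (ℓ + 16)     ≡⟨ ^-distribˡ-+-* 2 q (ℓ + 16) ⟨
    2 ^ (q + (ℓ + 16))       ∎

  15w≤d : 15 * w ≤ d
  15w≤d = +-cancelˡ-≤ (t + 2) _ _ (begin
    t + 2 + 15 * w   ≤⟨ +-monoˡ-≤ (15 * w) 2+t≤w ⟩
    16 * w           ≡⟨ s≡ ⟨
    s                ≡⟨ s-split ⟩
    t + 2 + d        ∎)

  -- Divided by `w`, this says 16 (q + ℓ + 16) < 8 (ℓ + 3) + 15 (ℓ + 8). For ℓ = 4 q the sides
  -- differ by 12 q - 112, which is 20 + 12 k as q = k + 11.
  exponents : (q + (ℓ + 16)) * s < (ℓ + 3) * u + (ℓ + 8) * (15 * w)
  exponents = begin-strict
    (q + (ℓ + 16)) * s                                       ≡⟨ cong ((q + (ℓ + 16)) *_) s≡ ⟩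
    (q + (ℓ + 16)) * (16 * w)                                ≡⟨ +-identityʳ _ ⟨
    (q + (ℓ + 16)) * (16 * w) + 0                            <⟨ +-monoʳ-< ((q + (ℓ + 16)) * (16 * w)) (≤-trans 1≤w (m≤n*m w (20 + k * 12))) ⟩
    (q + (ℓ + 16)) * (16 * w) + (20 + k * 12) * w            ≡⟨ balance k w ⟩
    (ℓ + 3) * (8 * w) + (ℓ + 8) * (15 * w)                   ≡⟨ cong (λ z → (ℓ + 3) * z + (ℓ + 8) * (15 * w)) u≡ ⟨
    (ℓ + 3) * u + (ℓ + 8) * (15 * w)                         ∎
    where
    balance : ∀ k w → ((k + 11) + ((k + 11) * 4 + 16)) * (16 * w) + (20 + k * 12) * w ≡
                      ((k + 11) * 4 + 3) * (8 * w) + ((k + 11) * 4 + 8) * (15 * w)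
    balance = solve-∀

  -- Compared with `R`, each factor `n` is too large by up to `2 ^ (q + 8)`, and `d` falls short of
  -- `s` by up to `w`. Both losses are covered by `u ^ u ≤ s !`.
  tail : n ^ s < s ! * R ^ d
  tail = begin-strict
    n ^ s                                            ≤⟨ ^-monoˡ-≤ s n≤2^ ⟩
    (2 ^ (q + (ℓ + 16))) ^ s                         ≡⟨ ^-*-assoc 2 (q + (ℓ + 16)) s ⟩
    2 ^ ((q + (ℓ + 16)) * s)                         <⟨ ^-monoʳ-< 2 (s≤s (s≤s z≤n)) exponents ⟩
    2 ^ ((ℓ + 3) * u + (ℓ + 8) * (15 * w))           ≡⟨ ^-distribˡ-+-* 2 ((ℓ + 3) * u) ((ℓ + 8) * (15 * w)) ⟩
    2 ^ ((ℓ + 3) * u) * 2 ^ ((ℓ + 8) * (15 * w))     ≡⟨ cong₂ _*_ (sym (^-*-assoc 2 (ℓ + 3) u)) (sym (^-*-assoc 2 (ℓ + 8) (15 * w))) ⟩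
    u ^ u * R ^ (15 * w)                             ≤⟨ *-mono-≤ factorial (^-monoʳ-≤ R {{>-nonZero (1≤m^n (ℓ + 8) (s≤s z≤n))}} 15w≤d) ⟩
    s ! * R ^ d                                      ∎
    where
    factorial : u ^ u ≤ s !
    factorial = subst (λ z → u ^ u ≤ z !) (sym (trans s≡ (trans (double w) (sym (cong₂ _+_ u≡ u≡))))) (^-≤-! u u)
      where
      double : ∀ w → 16 * w ≡ 8 * w + 8 * w
      double = solve-∀

  -- `Bell-lower j 0` reads `j ^ 0 ≤ Bell (0 + j)`, which is positivity.
  module E = Estimates Bell (λ j → Bell-lower j 0) {n} {t} {s} {R} {d} ratio fits s-split small tail

  room : 2 + t ≤ n
  room = ≤-trans (≤-reflexive (+-comm 2 t)) (≤-trans 2+t≤w (≤-trans (≤-reflexive (sym (*-identityˡ w))) (multiple≤n 1 (s≤s z≤n))))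

  2≤Bell : 2 ≤ Bell (n ∸ t)
  2≤Bell = ≤-trans (*-mono-≤ (≤-trans (s≤s (s≤s z≤n)) E.8≤R) (Bell-lower (n ∸ (t + 1)) 0)) E.one-step

  -- Shifting preserves the size of the family and both lower bounds on singletons, so the strict
  -- bound passes back from stable families.
  nontrivial : ∀ {f : BlockMap n → Bool} → SinglesIntersecting t f → (∀ {P} → Partition P → f P ≡ true → suc t ≤ size P) →
               cnt f < Bell (n ∸ t)
  nontrivial {f} = compression-induction (λ f → SinglesIntersecting t f → (∀ {P} → Partition P → f P ≡ true → suc t ≤ size P) → cnt f < Bell (n ∸ t))
    (λ f st → stable-bound {s = s} 1≤t fits 2≤n∸t E.tail-bound E.total-bound st)
    (λ κ f ih meets large → subst (_< Bell (n ∸ t)) (cnt-compress κ f) (ih (compress-meet κ meets) (compress-size κ large)))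
    f
    where
    open Shifting n
    2≤n∸t : 2 ≤ n ∸ t
    2≤n∸t = ≤-trans (≤-reflexive (sym (m+n∸n≡m 2 t))) (∸-monoˡ-≤ t room)

  bound : ∀ f → IntersectingFamily t f → cnt {n} f ≤ Bell (n ∸ t) × (cnt f ≡ Bell (n ∸ t) → IsStar t f)
  bound = intersecting-bound room nontrivial

-- Families given as lists

lookup-injective : ∀ {A : Set} {xs : List A} → Unique xs → ∀ {i j} → List.lookup xs i ≡ List.lookup xs j → i ≡ j
lookup-injective (_ ∷ _)  {zero}  {zero}  _ = refl
lookup-injective (x∉ ∷ _) {zero}  {suc j} e = ⊥-elim (All.lookup x∉ (∈-lookup j) e)
lookup-injective (x∉ ∷ _) {suc i} {zero}  e = ⊥-elim (All.lookup x∉ (∈-lookup i) (sym e))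
lookup-injective (_ ∷ u)  {suc i} {suc j} e = cong suc (lookup-injective u e)

TIntersecting⇒Intersecting : ∀ {n t} {P Q : BlockMap n} → Partition P → Partition Q → TIntersecting t P Q → Intersecting t P Q
TIntersecting⇒Intersecting {P = P} {Q} p q (g , inj , parts) = record
  { shared = g
  ; distinct = λ {k} {l} e → inj k l (sym (rel⇒row≡ p e))
  ; same = sameRow }
  where
  sameRow : ∀ k z → rel P (g k) z ≡ rel Q (g k) z
  sameRow k z with parts k
  ... | x , e = trans (rel-rows {P = P} {Q} (sym e) z) (sym (rel-rows {P = Q} {Q} (rel⇒row≡ q
                  (trans (rel-rows {P = Q} {P} e (g k)) (rel-refl p (g k)))) z))

single⇔IsPart : ∀ {n} {P : BlockMap n} {x} → Partition P → (single P x ≡ true → IsPart P ⁅ x ⁆) × (IsPart P ⁅ x ⁆ → single P x ≡ true)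
single⇔IsPart {P = P} {x} p = (λ s → x , single⇒row s) , back
  where
  back : IsPart P ⁅ x ⁆ → single P x ≡ true
  back (y , e) = row⇒single (subst (λ z → lookup P z ≡ ⁅ x ⁆)
    (x∈⁅y⁆⇒x≡y x (subst (y ∈ₛ_) e (proj₁ (isPartition p) y))) e)

_≟ᴾ_ : ∀ {n} (P Q : BlockMap n) → Dec (P ≡ Q)
_≟ᴾ_ = ≡-dec (≡-dec _≟ᵇ_)

module FromList {n} (F : List (BlockMap n)) (unique : Unique F) (partitions : All IsPartition F) where
  open import Data.List.Membership.DecPropositional (_≟ᴾ_ {n}) using (_∈?_)

  family : BlockMap n → Bool
  family P = does (P ∈? F)

  family⁺ : ∀ {P} → P ∈ F → family P ≡ true
  family⁺ {P} = dec-true (P ∈? F)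

  family⁻ : ∀ {P} → family P ≡ true → P ∈ F
  family⁻ {P} = from-does (P ∈? F)

  part : ∀ {P} → P ∈ F → Partition P
  part i = partition (All.lookup partitions i)

  cnt-family : cnt family ≡ length F
  cnt-family = trans (≤-antisym
    (count-⊆ {q = λ _ → true} (allPartitions-unique n) (λ {P} _ e → family⁻ {P} e , refl))
    (count-⊆ {p = λ _ → true} unique (λ i _ → complete (part i) , family⁺ i))) (count-true F)

  partner : ∀ {P} → 2 ≤ length F → ∃[ Q ] (Q ∈ F × P ≢ Q)
  partner {P} = go unique
    where
    go : ∀ {xs} → Unique xs → 2 ≤ length xs → ∃[ Q ] (Q ∈ xs × P ≢ Q)
    go {x ∷ []} _ (s≤s ())
    go {x ∷ y ∷ xs} ((x≢y ∷ _) ∷ _) _ with P ≟ᴾ x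
    ... | yes refl = y , there (here refl) , x≢y
    ... | no P≢x   = x , here refl , P≢x

  -- The given condition concerns distinct members only. For P = Q a second member `R` helps: the
  -- `t` blocks that `P` shares with `R` are `t` blocks of `P`.
  intersecting : ∀ {t} → 2 ≤ length F → TIntersectingFamily t F → IntersectingFamily t family
  intersecting {t} two h {P} {Q} p q fP fQ with P ≟ᴾ Q
  ... | no P≢Q = TIntersecting⇒Intersecting p q (h P Q (family⁻ {P} fP) (family⁻ {Q} fQ) P≢Q)
  ... | yes refl with partner {P} two
  ...   | R , R∈ , P≢R = record { shared = I.shared ; distinct = I.distinct ; same = λ _ _ → refl }
    where
    module I = Intersecting (TIntersecting⇒Intersecting p (part R∈) (h P R (family⁻ {P} fP) R∈ P≢R))

  Conclusion : ℕ → Set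
  Conclusion t = Σ (Fin t → Fin n) λ x → ((i j : Fin t) → x i ≡ x j → i ≡ j) ×
    ((P : BlockMap n) → (P ∈ F → IsPartition P × ((i : Fin t) → IsPart P ⁅ x i ⁆)) ×
                        (IsPartition P × ((i : Fin t) → IsPart P ⁅ x i ⁆) → P ∈ F))

  conclude : ∀ {t} → IsStar t family → Conclusion t
  conclude (T , uT , refl , star) = List.lookup T , (λ _ _ → lookup-injective uT) , λ P →
    (λ P∈ → isPartition (part P∈) , λ i → proj₁ (single⇔IsPart (part P∈))
      (hasSingles⁻ T {P} (trans (sym (star (part P∈))) (family⁺ P∈)) (∈-lookup i))) ,
    λ { (p , singles) → family⁻ {P} (trans (star (partition p)) (hasSingles⁺ T {P} (λ i →
      subst (λ x → single P x ≡ true) (sym (lookup-index i)) (proj₂ (single⇔IsPart (partition p)) (singles (Any.index i)))))) }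

-- `suc ⌊log₂ t ⌋` stands for log t, so that at t = 1 the condition on `n` still reads n ≥ C; the
-- base of the logarithm only affects the constant.
theorem2 : ∃[ C ] (C ≥ 1 ×
    ((n t : ℕ) → t ≥ 1 → n ≥ C * t * (suc ⌊log₂ t ⌋) ^ 2 →
    (F : List (BlockMap n)) → Unique F → All IsPartition F → TIntersectingFamily t F →
    (length F ≤ Bell (n ∸ t)) ×
    (length F ≡ Bell (n ∸ t) →
    Σ (Fin t → Fin n) λ x →
    ((i j : Fin t) → x i ≡ x j → i ≡ j) ×
    ((P : BlockMap n) →
    (P ∈ F → IsPartition P × ((i : Fin t) → IsPart P ⁅ x i ⁆)) ×
    (IsPartition P × ((i : Fin t) → IsPart P ⁅ x i ⁆) → P ∈ F)))))
theorem2 = C , 1≤C , λ n t 1≤t n≥ → main {n} {t} 1≤t n≥ (bracket n 11 (start {n} {t} 1≤t n≥))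
  where
  start : ∀ {n t} → 1 ≤ t → C * t * suc ⌊log₂ t ⌋ ^ 2 ≤ n → threshold 11 ≤ n
  start {n} {t} 1≤t n≥ = ≤-trans threshold≤C (≤-trans
    (≤-trans (≤-reflexive (trans (sym (*-identityʳ C)) (sym (*-identityʳ (C * 1)))))
      (*-mono-≤ (*-mono-≤ (≤-reflexive {C} refl) 1≤t) (1≤m^n {suc ⌊log₂ t ⌋} 2 (s≤s z≤n)))) n≥)

  main : ∀ {n t} → 1 ≤ t → C * t * suc ⌊log₂ t ⌋ ^ 2 ≤ n →
         ∃[ k ] (threshold (k + 11) ≤ n × n < threshold (suc (k + 11))) →
         (F : List (BlockMap n)) → (u : Unique F) → (a : All IsPartition F) → TIntersectingFamily t F →
         (length F ≤ Bell (n ∸ t)) × (length F ≡ Bell (n ∸ t) → FromList.Conclusion F u a t)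
  main {n} {t} 1≤t n≥ (k , lower , upper) F u a h = by-size (2 ≤? length F)
    where
    module P = Parameters {k = k} 1≤t n≥ lower upper
    module F = FromList F u a
    by-size : Dec (2 ≤ length F) → (length F ≤ Bell (n ∸ t)) × (length F ≡ Bell (n ∸ t) → F.Conclusion t)
    -- A family with at most one member is subject to no intersection condition, but it stays
    -- strictly below the bound because `Bell (n ∸ t)` is at least 2.
    by-size (no small) = ≤-trans (<⇒≤ few) P.2≤Bell , λ e → contradiction P.2≤Bell (<⇒≱ (subst (_< 2) e few))
      where
      few : length F < 2
      few = ≰⇒> small
    by-size (yes two) = subst (_≤ Bell (n ∸ t)) F.cnt-family (proj₁ bounds) ,
                        λ e → F.conclude (proj₂ bounds (trans F.cnt-family e))
      where
      bounds : cnt F.family ≤ Bell (n ∸ t) × (cnt F.family ≡ Bell (n ∸ t) → IsStar t F.family)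
      bounds = P.bound F.family (F.intersecting two h)
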